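{- Fix $n\geq 1$ and $a=(a_1,\dots,a_n)\in\mathbb{R}^n_{>0}$. Let $w_1,w_2,\dots$ be independent random letters in the alphabet $[n,\bar n]$, each with distribution $\rho$ given by $\rho(l)=a_l/\sum_{i=1}^n(a_i+a_i^{ -1})$ and $\rho(\bar l)=a_l^{ -1}/\sum_{i=1}^n(a_i+a_i^{ -1})$ for $1\leq l\leq n$. Let $P(0)$ be the empty tableau and, for $m\geq 1$, let $P(m)$ be the symplectic tableau obtained by Berele-inserting $w_m$ into $P(m-1)$. Then the sequence of shapes $(\mathrm{sh}P(m))_{m\geq 0}$ is a Markov chain on $\Lambda_n$, started from the empty partition, with transition kernel \[\Pi(\mu,\lambda)=\frac{1}{\sum_{i=1}^n(a_i+a_i^{ -1})}\,\frac{Sp^{(n)}_\lambda(a)}{Sp^{(n)}_\mu(a)}\,\mathbb{1}_{\mu\rightsquigarrow\lambda}.\]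
   Context: The alphabet $[n,\bar n]$ is the totally ordered set $1<\bar 1<2<\bar 2<\dots<n<\bar n$. A partition is a weakly decreasing sequence of nonnegative integers with finitely many nonzero terms; $\Lambda_n$ is the set of partitions with at most $n$ nonzero parts, identified with Young diagrams (left/top justified rows of boxes, row $i$ having $\lambda_i$ boxes). For partitions $\mu,\lambda$, $\mu\rightsquigarrow\lambda$ means $\lambda$ is obtained from $\mu$ by adding or deleting exactly one box. A symplectic tableau is a filling of a Young diagram with letters of $[n,\bar n]$ that is weakly increasing along rows, strictly increasing down columns, and such that no entry smaller than $i$ (i.e. no entry in $\{1,\bar 1,\dots,i-1,\overline{i-1}\}$) occurs in row $i$, for every $i$. Its shape $\mathrm{sh}P$ is the underlying partition. For a symplectic tableau $P$, $a^P=\prod_{l=1}^n a_l^{\#\{l\text{'s in }P\}-\#\{\bar l\text{'s in }P\}}$, and the symplectic Schur function is $Sp^{(n)}_\lambda(a)=\sum_{P:\ \mathrm{sh}P=\lambda}a^P$, the sum over symplectic tableaux with entries in $[n,\bar n]$. Jeu de taquin: given a tableau with one empty box at position (row $i$, column $j$), repeatedly do the following: if the empty box has both a right neighbour $t_{i,j+1}$ and a lower neighbour $t_{i+1,j}$, swap the empty box with $t_{i,j+1}$ if $t_{i,j+1}<t_{i+1,j}$ and with $t_{i+1,j}$ if $t_{i,j+1}\geq t_{i+1,j}$; if it has only one of these neighbours, swap with that one; when it has neither, delete the empty box. Berele insertion of a letter $c$ into a symplectic tableau $P$: start at row $r=1$. If $c$ is at least every entry of row $r$ (or the row is empty), append $c$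 at the end of row $r$ and stop. Otherwise let $b$ be the leftmost (i.e. smallest) entry of row $r$ strictly greater than $c$ and replace $b$ by $c$. If $c$ is the unbarred letter $r$ and $b=\bar r$, then (since $\bar r$ cannot be placed in row $r+1$) erase both: the box that held $b$ (now holding $c$) becomes empty, apply jeu de taquin, and stop. Otherwise set $c:=b$, $r:=r+1$ and repeat. -}

module Defs where

open import Level using (Level)
open import Data.Nat using (ℕ; zero; suc; _+_; _*_; _<ᵇ_; _≡ᵇ_; _≤ᵇ_; _/_; _%_)
open import Data.Bool using (Bool; true; false; _∧_; _∨_; not; if_then_else_)
open import Data.List using (List; []; _∷_; _++_; length; map; foldr; foldl; upTo; concatMap; concat; take)
open import Data.Maybe using (Maybe; just; nothing)
open import Data.Product using (_×_; _,_)
open import Data.Fin using (Fin)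
import Data.Fin as F
open import Algebra.Bundles using (CommutativeRing)

-- Letters of [n, n̄] are encoded by natural numbers:
--   the unbarred letter l (1 ≤ l ≤ n) is the code 2(l-1),
--   the barred letter l̄ is the code 2(l-1)+1.
-- The order 1 < 1̄ < 2 < 2̄ < … < n < n̄ is then the usual order on codes
-- 0 < 1 < … < 2n-1.
-- A tableau is a list of rows (row 1 first), each row a list of codes.
-- Internally rows are indexed from 0 (internal row k = paper row k+1).

Tableau : Set
Tableau = List (List ℕ)

alphabet : ℕ → List ℕ
alphabet n = upTo (2 * n)

lookupL : List ℕ → ℕ → Maybe ℕ
lookupL []       _       = nothing
lookupL (x ∷ xs) zero    = just x
lookupL (x ∷ xs) (suc j) = lookupL xs j

setL : List ℕ → ℕ → ℕ → List ℕ
setL []       _       v = []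
setL (x ∷ xs) zero    v = v ∷ xs
setL (x ∷ xs) (suc j) v = x ∷ setL xs j v

rowAt : Tableau → ℕ → List ℕ
rowAt []       _       = []
rowAt (r ∷ rs) zero    = r
rowAt (r ∷ rs) (suc k) = rowAt rs k

get : Tableau → ℕ → ℕ → Maybe ℕ
get T i j = lookupL (rowAt T i) j

setRow : Tableau → ℕ → List ℕ → Tableau
setRow []       _       r = r ∷ []
setRow (x ∷ xs) zero    r = r ∷ xs
setRow (x ∷ xs) (suc k) r = x ∷ setRow xs k r

setT : Tableau → ℕ → ℕ → ℕ → Tableau
setT T i j v = setRow T i (setL (rowAt T i) j v)

dropLastL : List ℕ → List ℕ
dropLastL []           = []
dropLastL (x ∷ [])     = []
dropLastL (x ∷ y ∷ xs) = x ∷ dropLastL (y ∷ xs)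

removeEmpty : Tableau → Tableau
removeEmpty []            = []
removeEmpty ([] ∷ rs)     = removeEmpty rs
removeEmpty ((x ∷ r) ∷ rs) = (x ∷ r) ∷ removeEmpty rs

sumℕ : List ℕ → ℕ
sumℕ = foldr _+_ 0

size : Tableau → ℕ
size T = sumℕ (map length T)

-- Jeu de taquin: the box (i , j) is considered empty (its stored value is
-- irrelevant).  Each step increases i + j by one, so 2·|T| + 2 steps of
-- fuel always suffice.

jdtF : ℕ → ℕ → ℕ → Tableau → Tableau
jdtF zero i j T = T
jdtF (suc f) i j T with get T i (suc j) | get T (suc i) j
... | just r  | just d  = if r <ᵇ d then jdtF f i (suc j) (setT T i j r)
                                   else jdtF f (suc i) j (setT T i j d)
... | just r  | nothing = jdtF f i (suc j) (setT T i j r)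
... | nothing | just d  = jdtF f (suc i) j (setT T i j d)
... | nothing | nothing = removeEmpty (setRow T i (dropLastL (rowAt T i)))

jdt : ℕ → ℕ → Tableau → Tableau
jdt i j T = jdtF (2 * size T + 2) i j T

firstGreaterFrom : ℕ → ℕ → List ℕ → Maybe (ℕ × ℕ)
firstGreaterFrom c j []       = nothing
firstGreaterFrom c j (x ∷ xs) = if c <ᵇ x then just (j , x) else firstGreaterFrom c (suc j) xs

firstGreater : ℕ → List ℕ → Maybe (ℕ × ℕ)
firstGreater c r = firstGreaterFrom c 0 r

-- insert letter c into internal row k (paper row k+1); the row index can
-- grow at most to the number of rows, so suc (length T) fuel suffices.
insF : ℕ → ℕ → ℕ → Tableau → Tableau
insF zero k c T = T
insF (suc f) k c T with firstGreater c (rowAt T k)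
... | nothing      = setRow T k (rowAt T k ++ (c ∷ []))
... | just (j , b) =
  if (c ≡ᵇ 2 * k) ∧ (b ≡ᵇ suc (2 * k))
    -- c is the unbarred letter k+1 and b is its barred letter
    then jdt k j (setT T k j c)
    else insF f (suc k) b (setT T k j c)

berele : ℕ → Tableau → Tableau
berele c T = insF (suc (length T)) 0 c T

insertWord : List ℕ → Tableau
insertWord w = foldl (λ T c → berele c T) [] w

Partition : Set
Partition = List ℕ

shape : Tableau → Partition
shape T = map length T

decreasingB : List ℕ → Bool
decreasingB []           = true
decreasingB (x ∷ [])     = true
decreasingB (x ∷ y ∷ xs) = (y ≤ᵇ x) ∧ decreasingB (y ∷ xs)

positiveB : List ℕ → Bool
positiveB []       = true
positiveB (x ∷ xs) = (0 <ᵇ x) ∧ positiveB xs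

isPartition : Partition → Bool
isPartition μ = decreasingB μ ∧ positiveB μ

eqList : List ℕ → List ℕ → Bool
eqList []       []       = true
eqList (x ∷ xs) (y ∷ ys) = (x ≡ᵇ y) ∧ eqList xs ys
eqList _        _        = false

partAt : Partition → ℕ → ℕ
partAt []       _       = 0
partAt (x ∷ xs) zero    = x
partAt (x ∷ xs) (suc i) = partAt xs i

allB : {A : Set} → (A → Bool) → List A → Bool
allB p = foldr (λ x b → p x ∧ b) true

anyB : {A : Set} → (A → Bool) → List A → Bool
anyB p = foldr (λ x b → p x ∨ b) false

containedB : Partition → Partition → Bool
containedB μ ν = allB (λ i → partAt μ i ≤ᵇ partAt ν i) (upTo (length μ))

adjacentB : Partition → Partition → Bool
adjacentB μ ν = (containedB μ ν ∧ (sumℕ ν ≡ᵇ suc (sumℕ μ)))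
              ∨ (containedB ν μ ∧ (sumℕ μ ≡ᵇ suc (sumℕ ν)))

rowIncrB : List ℕ → Bool
rowIncrB = decreasingB' where
  decreasingB' : List ℕ → Bool
  decreasingB' []           = true
  decreasingB' (x ∷ [])     = true
  decreasingB' (x ∷ y ∷ xs) = (x ≤ᵇ y) ∧ decreasingB' (y ∷ xs)

-- every entry of the lower row is strictly greater than the one above it
-- (the lower row is assumed not longer, which holds for fillings of a shape)
colPairB : List ℕ → List ℕ → Bool
colPairB (x ∷ xs) (y ∷ ys) = (x <ᵇ y) ∧ colPairB xs ys
colPairB _        _        = true

colStrictB : Tableau → Bool
colStrictB []            = true
colStrictB (r ∷ [])      = true
colStrictB (r ∷ s ∷ rs)  = colPairB r s ∧ colStrictB (s ∷ rs)

-- internal row k (paper row k+1) has no entry smaller than the letter k+1,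
-- i.e. all codes are ≥ 2k; all codes lie in [n, n̄], i.e. are < 2n
rowCondFrom : ℕ → ℕ → Tableau → Bool
rowCondFrom n k []       = true
rowCondFrom n k (r ∷ rs) =
  allB (λ e → (2 * k ≤ᵇ e) ∧ (e <ᵇ 2 * n)) r ∧ rowCondFrom n (suc k) rs

isSymplectic : ℕ → Tableau → Bool
isSymplectic n T = allB rowIncrB T ∧ colStrictB T ∧ rowCondFrom n 0 T

words : List ℕ → ℕ → List (List ℕ)
words L zero    = [] ∷ []
words L (suc k) = concatMap (λ x → map (x ∷_) (words L k)) L

fillings : ℕ → Partition → List Tableau
fillings n []       = [] ∷ []
fillings n (p ∷ ps) = concatMap (λ r → map (r ∷_) (fillings n ps)) (words (alphabet n) p)

filterB : {A : Set} → (A → Bool) → List A → List A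
filterB p []       = []
filterB p (x ∷ xs) = if p x then x ∷ filterB p xs else filterB p xs

sympTableaux : ℕ → Partition → List Tableau
sympTableaux n ν = filterB (isSymplectic n) (fillings n ν)

module Sym {c ℓ : Level} (R : CommutativeRing c ℓ) where
  open CommutativeRing R renaming (_+_ to _+R_; _*_ to _*R_)

  sumR : List Carrier → Carrier
  sumR = foldr _+R_ 0#

  prodR : List Carrier → Carrier
  prodR = foldr _*R_ 1#

  atN : {n : ℕ} → (Fin n → Carrier) → ℕ → Carrier
  atN {zero}  f _       = 1#
  atN {suc n} f zero    = f F.zero
  atN {suc n} f (suc i) = atN (λ x → f (F.suc x)) i

  wt : {n : ℕ} → (a ainv : Fin n → Carrier) → ℕ → Carrier
  wt a ainv e = if (e % 2) ≡ᵇ 0 then atN a (e / 2) else atN ainv (e / 2)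

  weightT : {n : ℕ} → (a ainv : Fin n → Carrier) → Tableau → Carrier
  weightT a ainv T = prodR (map (wt a ainv) (concat T))

  Sp : (n : ℕ) → (a ainv : Fin n → Carrier) → Partition → Carrier
  Sp n a ainv ν = sumR (map (weightT a ainv) (sympTableaux n ν))

  sumFin : (n : ℕ) → (Fin n → Carrier) → Carrier
  sumFin zero    f = 0#
  sumFin (suc n) f = f F.zero +R sumFin n (λ i → f (F.suc i))

  Z : (n : ℕ) → (a ainv : Fin n → Carrier) → Carrier
  Z n a ainv = sumFin n (λ i → a i +R ainv i)

  ρ : {n : ℕ} → (a ainv : Fin n → Carrier) → (Zinv : Carrier) → ℕ → Carrier
  ρ a ainv Zinv e = wt a ainv e *R Zinv

  indicator : Bool → Carrier
  indicator b = if b then 1# else 0#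

  pathMatches : ℕ → (ℕ → Partition) → List ℕ → Bool
  pathMatches m μ w = allB (λ k → eqList (shape (insertWord (take k w))) (μ k)) (upTo (suc m))

  -- P( sh P(0) = μ 0 , … , sh P(m) = μ m ) for i.i.d. letters w_1,…,w_m with law ρ
  pathProb : (n : ℕ) → (a ainv : Fin n → Carrier) → (Zinv : Carrier) →
             (m : ℕ) → (ℕ → Partition) → Carrier
  pathProb n a ainv Zinv m μ =
    sumR (map (λ w → prodR (map (ρ a ainv Zinv) w) *R indicator (pathMatches m μ w))
              (words (alphabet n) m))

  Π : (n : ℕ) → (a ainv : Fin n → Carrier) → (Zinv : Carrier) →
      (spinv : Partition → Carrier) → Partition → Partition → Carrier
  Π n a ainv Zinv spinv μ ν =
    Zinv *R Sp n a ainv ν *R spinv μ *R indicator (adjacentB μ ν)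

  chainProb : (n : ℕ) → (a ainv : Fin n → Carrier) → (Zinv : Carrier) →
              (spinv : Partition → Carrier) → (m : ℕ) → (ℕ → Partition) → Carrier
  chainProb n a ainv Zinv spinv m μ =
    indicator (eqList (μ 0) []) *R
    prodR (map (λ k → Π n a ainv Zinv spinv (μ k) (μ (suc k))) (upTo m))

{-# OPTIONS --safe #-}
module Submission where

open import Defs
open import Level using (Level)
open import Data.Nat using (ℕ; _≤_)
open import Data.Bool using (true)
open import Data.List using (length)
open import Data.Fin using (Fin)
open import Relation.Binary.PropositionalEquality using (_≡_)
open import Algebra.Bundles using (CommutativeRing)

-- For a fixed shape μ, Berele insertion (P , w) ↦ P ← w is a weight-preserving
-- bijection from {P of shape μ} × letters onto the tableaux whose shape is adjacent
-- to μ.  By induction on m, the sum of the weights of the words with shape path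
-- μ 0 , … , μ m whose tableau P(m) lies in any given set is therefore the sum of the
-- weights of the tableaux of shape μ m in that set (or 0, if some step of the path is
-- not an adjacency), and the factors Sp telescope.
--
-- For the bijection, the algorithm is run one elementary step at a time on pairs
-- (tableau, current box): "insert the letter c into row k" and "slide the hole at
-- (i , j)".  A step can be undone uniquely.  For bumps this is ordinary reverse row
-- insertion.  A hole in row i was created by cancelling i against ī exactly when the
-- entry to its left is at most i and the entry above it is smaller than i; otherwise
-- it came from the larger of its left and upper neighbours.  Hence runs of the algorithm
-- are determined by their last state, and every admissible last state is reached.

-- Tableaux are replaced by infinite grids in which a cell of row x (counted from 0) outside the
-- shape holds `out x`, a value above all letters that grows with x. Missing neighbours then need no
-- case of their own: every comparison made by insertion or jeu de taquin has a meaning, and adding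
-- a box amounts to bumping out the value `out k`. The obstacle is the hole. The letter stored there
-- is stale, so grids are compared off the hole, and the order conditions are imposed on arbitrary
-- pairs of cells, because a chain of neighbours could pass through it. The two halves of the
-- bijection use the steps differently. Injectivity traces two runs back from a common last state.
-- Surjectivity builds a run backwards from the target and then needs determinism in the forward
-- direction, to know that Berele insertion performs exactly this run. Weights live in a commutative
-- ring with chosen inverses, so all weight identities are kept in product form.

module Combinatorics where

  open import Data.Bool using (Bool; false; _∧_; T)
  open import Data.Bool.Properties using (∨-zeroʳ)
  open import Data.Empty using (⊥; ⊥-elim)
  open import Data.List using (List; []; _∷_; _++_; map; upTo; applyUpTo; concatMap; drop; cartesianProductWith)
  open import Data.List.Membership.Propositional using (_∈_)
  open import Data.List.Membership.Propositional.Properties using (∈-cartesianProductWith⁺; ∈-cartesianProductWith⁻; ∈-upTo⁺)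
  open import Data.List.Properties using (length-map; length-upTo; map-upTo; map-applyUpTo; ∷-injective; ∷-injectiveˡ; ∷-injectiveʳ)
  open import Data.List.Relation.Unary.All as All using ([]; _∷_)
  import Data.List.Relation.Unary.All.Properties as All
  open import Data.List.Relation.Unary.AllPairs using ([]; _∷_)
  open import Data.List.Relation.Unary.Any using (here; there)
  open import Data.List.Relation.Unary.Unique.Propositional using (Unique)
  open import Data.List.Relation.Unary.Unique.Propositional.Properties using (cartesianProductWith⁺; upTo⁺)
  open import Data.Maybe using (just; nothing)
  open import Data.Nat
  open import Data.Nat.Properties
  open import Data.Product using (_×_; _,_; proj₁; proj₂; ∃)
  open import Data.Sum using (_⊎_; inj₁; inj₂)
  open import Data.Unit using (⊤; tt)
  open import Function using (id; _∘_)
  open import Relation.Binary.Construct.Closure.ReflexiveTransitive using (Star; ε; _◅_)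
  open import Relation.Binary.Definitions using (tri<; tri≈; tri>)
  open import Relation.Binary.PropositionalEquality using (_≢_; refl; sym; trans; cong; cong₂; subst; subst₂)
  open import Relation.Nullary using (¬_; Dec; yes; no)

  -- Cells and infinite grids

  Cell : Set
  Cell = ℕ × ℕ

  Grid : Set
  Grid = ℕ → ℕ → ℕ

  _≟ᶜ_ : (z w : Cell) → Dec (z ≡ w)
  (x , y) ≟ᶜ (i , j) with x ≟ i | y ≟ j
  ... | yes refl | yes refl = yes refl
  ... | no ¬p    | _        = no λ { refl → ¬p refl }
  ... | yes _    | no ¬p    = no λ { refl → ¬p refl }

  AgreeOff : ℕ → ℕ → Grid → Grid → Set
  AgreeOff i j G H = ∀ x y → (x , y) ≢ (i , j) → G x y ≡ H x y

  AgreeOff₂ : Cell → Cell → Grid → Grid → Set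
  AgreeOff₂ z w G H = ∀ x y → (x , y) ≢ z → (x , y) ≢ w → G x y ≡ H x y

  update : ℕ → ℕ → ℕ → Grid → Grid
  update i j v G x y with (x , y) ≟ᶜ (i , j)
  ... | yes _ = v
  ... | no _  = G x y

  update-same : ∀ i j v G → update i j v G i j ≡ v
  update-same i j v G with (i , j) ≟ᶜ (i , j)
  ... | yes _ = refl
  ... | no ¬p = ⊥-elim (¬p refl)

  update-other : ∀ i j v G → AgreeOff i j (update i j v G) G
  update-other i j v G x y z≢ with (x , y) ≟ᶜ (i , j)
  ... | yes p = ⊥-elim (z≢ p)
  ... | no _  = refl

  Anywhere : Cell → Set
  Anywhere _ = ⊤

  Off : ℕ → ℕ → Cell → Set
  Off i j z = z ≢ (i , j)

  row≢ : ∀ {x y i j : ℕ} → x ≢ i → (x , y) ≢ (i , j)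
  row≢ x≢i refl = x≢i refl

  col≢ : ∀ {x y i j : ℕ} → y ≢ j → (x , y) ≢ (i , j)
  col≢ y≢j refl = y≢j refl

  AddBox : ℕ → (ℕ → ℕ) → (ℕ → ℕ) → Set
  AddBox k μ ν = ν k ≡ suc (μ k) × (∀ x → x ≢ k → ν x ≡ μ x)

  first-≥ : ∀ (f : ℕ → ℕ) {b} e → b ≤ f e → ∃ λ q → b ≤ f q × (∀ {y} → y < q → f y < b)
  first-≥ f {b} e b≤ with b ≤? f 0
  ... | yes p = 0 , p , λ ()
  first-≥ f zero b≤ | no ¬p = ⊥-elim (¬p b≤)
  first-≥ f {b} (suc e) b≤ | no ¬p with first-≥ (f ∘ suc) e b≤
  ... | q , b≤q , before = suc q , b≤q , λ { {zero} _ → ≰⇒> ¬p ; {suc y} y< → before (s≤s⁻¹ y<) }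

  -- `L` and `U` stand for the left and upper neighbours of a hole, `m` for the unbarred letter of
  -- its row. The cases are the three origins of the hole: cancellation, a slide from the left, a
  -- slide from above. A tie `L = U` belongs to the slide from above, since rows increase weakly and
  -- columns strictly.
  direction : ∀ L U m → (L ≤ m × U < m) ⊎ (m < L × U < L) ⊎ (m ≤ U × L ≤ U)
  direction L U m with m <? L | U <? m | U <? L
  ... | yes m<L | _       | yes U<L = inj₂ (inj₁ (m<L , U<L))
  ... | yes m<L | _       | no U≮L  = inj₂ (inj₂ (≤-trans (<⇒≤ m<L) (≮⇒≥ U≮L) , ≮⇒≥ U≮L))
  ... | no m≮L  | yes U<m | _       = inj₁ (≮⇒≥ m≮L , U<m)
  ... | no m≮L  | no U≮m  | _       = inj₂ (inj₂ (≮⇒≥ U≮m , ≤-trans (≮⇒≥ m≮L) (≮⇒≥ U≮m)))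

  -- Semistandard fillings of the infinite grid

  module Insertion (n : ℕ) where

    -- Cells outside the shape carry a value depending on their row, so that the
    -- infinite grid is still strictly increasing down columns.
    out : ℕ → ℕ
    out x = 2 * (n + x)

    out-< : ∀ {x x'} → x < x' → out x < out x'
    out-< x<x' = *-monoʳ-< 2 (+-monoʳ-< n x<x')

    2n≤out : ∀ x → 2 * n ≤ out x
    2n≤out x = *-monoʳ-≤ 2 (m≤m+n n x)

    2x≤out : ∀ x → 2 * x ≤ out x
    2x≤out x = *-monoʳ-≤ 2 (m≤n+m x n)

    -- `ok` marks the cells whose value counts. The order conditions compare any two such cells,
    -- `col` even in different columns, so that they remain usable across a cell excluded by `ok`.
    record SemiStd (ok : Cell → Set) (μ : ℕ → ℕ) (G : Grid) : Set where
      field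
        row     : ∀ {x y y'} → ok (x , y) → ok (x , y') → y ≤ y' → G x y ≤ G x y'
        col     : ∀ {x x' y y'} → ok (x , y) → ok (x' , y') → x < x' → y ≤ y' → G x y < G x' y'
        low     : ∀ {x y} → ok (x , y) → 2 * x ≤ G x y
        inside  : ∀ {x y} → ok (x , y) → y < μ x → G x y < 2 * n
        outside : ∀ {x y} → ok (x , y) → μ x ≤ y → G x y ≡ out x

      inside⁻¹ : ∀ {x y} → ok (x , y) → G x y < 2 * n → y < μ x
      inside⁻¹ {x} {y} o G< with y <? μ x
      ... | yes p = p
      ... | no ¬p = ⊥-elim (<⇒≱ G< (subst (2 * n ≤_) (sym (outside o (≮⇒≥ ¬p))) (2n≤out x)))

      outside⁻¹ : ∀ {x y} → ok (x , y) → 2 * n ≤ G x y → μ x ≤ y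
      outside⁻¹ {x} {y} o G≥ with y <? μ x
      ... | yes p = ⊥-elim (<⇒≱ (inside o p) G≥)
      ... | no ¬p = ≮⇒≥ ¬p

    open SemiStd public

    -- Every step, forward or backward, changes at most one cell that counts afterwards, so
    -- comparing that cell with the cells to its left, right, upper left and lower right is enough.
    -- The shape may change at this cell too, which covers adding and deleting a box.
    refill : ∀ {ok ok' μ μ' G H} i j →
      SemiStd ok μ G →
      (∀ {x y} → ok' (x , y) → (x , y) ≢ (i , j) → G x y ≡ H x y) →
      (∀ {z} → ok' z → z ≢ (i , j) → ok z) →
      (∀ {x y} → (x , y) ≢ (i , j) → (y < μ' x → y < μ x) × (μ' x ≤ y → μ x ≤ y)) →
      (∀ {y} → ok' (i , y) → y < j → G i y ≤ H i j) →
      (∀ {y} → ok' (i , y) → j < y → H i j ≤ G i y) →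
      (∀ {x y} → ok' (x , y) → x < i → y ≤ j → G x y < H i j) →
      (∀ {x y} → ok' (x , y) → i < x → j ≤ y → H i j < G x y) →
      2 * i ≤ H i j →
      (j < μ' i → H i j < 2 * n) →
      (μ' i ≤ j → H i j ≡ out i) →
      SemiStd ok' μ' H
    refill {ok} {ok'} {μ} {μ'} {G} {H} i j S ag ok⇒ shp lf rt ab bl lo ins outs = record
      { row = rw ; col = cl ; low = lw ; inside = is ; outside = os }
      where
      rw : ∀ {x y y'} → ok' (x , y) → ok' (x , y') → y ≤ y' → H x y ≤ H x y'
      rw {x} {y} {y'} o o' y≤y' with (x , y) ≟ᶜ (i , j) | (x , y') ≟ᶜ (i , j)
      ... | yes refl | yes refl = ≤-refl
      ... | yes refl | no ¬q = subst (H i j ≤_) (ag o' ¬q) (rt o' (≤∧≢⇒< y≤y' (λ { refl → ¬q refl })))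
      ... | no ¬p | yes refl = subst (_≤ H i j) (ag o ¬p) (lf o (≤∧≢⇒< y≤y' (λ { refl → ¬p refl })))
      ... | no ¬p | no ¬q = subst₂ _≤_ (ag o ¬p) (ag o' ¬q) (row S (ok⇒ o ¬p) (ok⇒ o' ¬q) y≤y')
      cl : ∀ {x x' y y'} → ok' (x , y) → ok' (x' , y') → x < x' → y ≤ y' → H x y < H x' y'
      cl {x} {x'} {y} {y'} o o' x<x' y≤y' with (x , y) ≟ᶜ (i , j) | (x' , y') ≟ᶜ (i , j)
      ... | yes refl | yes refl = ⊥-elim (<-irrefl refl x<x')
      ... | yes refl | no ¬q = subst (H i j <_) (ag o' ¬q) (bl o' x<x' y≤y')
      ... | no ¬p | yes refl = subst (_< H i j) (ag o ¬p) (ab o x<x' y≤y')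
      ... | no ¬p | no ¬q = subst₂ _<_ (ag o ¬p) (ag o' ¬q) (col S (ok⇒ o ¬p) (ok⇒ o' ¬q) x<x' y≤y')
      lw : ∀ {x y} → ok' (x , y) → 2 * x ≤ H x y
      lw {x} {y} o with (x , y) ≟ᶜ (i , j)
      ... | yes refl = lo
      ... | no ¬p = subst (2 * x ≤_) (ag o ¬p) (low S (ok⇒ o ¬p))
      is : ∀ {x y} → ok' (x , y) → y < μ' x → H x y < 2 * n
      is {x} {y} o p with (x , y) ≟ᶜ (i , j)
      ... | yes refl = ins p
      ... | no ¬p = subst (_< 2 * n) (ag o ¬p) (inside S (ok⇒ o ¬p) (proj₁ (shp ¬p) p))
      os : ∀ {x y} → ok' (x , y) → μ' x ≤ y → H x y ≡ out x
      os {x} {y} o p with (x , y) ≟ᶜ (i , j)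
      ... | yes refl = outs p
      ... | no ¬p = trans (sym (ag o ¬p)) (outside S (ok⇒ o ¬p) (proj₂ (shp ¬p) p))

    transport : ∀ {ok ok' μ μ' G H} →
      SemiStd ok μ G →
      (∀ {z} → ok' z → ok z) →
      (∀ {x y} → ok' (x , y) → G x y ≡ H x y) →
      (∀ {x y} → ok' (x , y) → (y < μ' x → y < μ x) × (μ' x ≤ y → μ x ≤ y)) →
      SemiStd ok' μ' H
    transport S ok⇒ eq shp = record
      { row = λ o o' p → subst₂ _≤_ (eq o) (eq o') (row S (ok⇒ o) (ok⇒ o') p)
      ; col = λ o o' p q → subst₂ _<_ (eq o) (eq o') (col S (ok⇒ o) (ok⇒ o') p q)
      ; low = λ o → subst (_ ≤_) (eq o) (low S (ok⇒ o))
      ; inside = λ o p → subst (_< 2 * n) (eq o) (inside S (ok⇒ o) (proj₁ (shp o) p))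
      ; outside = λ o p → trans (sym (eq o)) (outside S (ok⇒ o) (proj₂ (shp o) p))
      }

    -- States and elementary steps

    -- The value of G at the hole of a state "hole i j G" is irrelevant; "fin k G" is the
    -- end of an insertion that added a box to row k.
    data State : Set where
      bump : (k c : ℕ) → Grid → State
      hole : (i j : ℕ) → Grid → State
      fin  : (k : ℕ) → Grid → State

    data _≈ˢ_ : State → State → Set where
      bump≈ : ∀ {k c G H} → (∀ x y → G x y ≡ H x y) → bump k c G ≈ˢ bump k c H
      hole≈ : ∀ {i j G H} → AgreeOff i j G H → hole i j G ≈ˢ hole i j H
      fin≈  : ∀ {k G H} → (∀ x y → G x y ≡ H x y) → fin k G ≈ˢ fin k H

    NotGreaterBefore : ℕ → ℕ → ℕ → Grid → Set
    NotGreaterBefore k q c G = ∀ y → y < q → G k y ≤ c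

    -- With one neighbour missing, its value `out` loses every comparison with a letter and the
    -- slide goes to the other one. With both missing, `out i < out (suc i)` would point to the
    -- right; the bound `2 * n` in `rights` stops the slide there, and the same inequality rules out
    -- `downs`.
    data Step : State → State → Set where
      bumps : ∀ {k c b q G H} → NotGreaterBefore k q c G → G k q ≡ b → c < b → b < 2 * n →
        ¬ (c ≡ 2 * k × b ≡ suc (2 * k)) → H k q ≡ c → AgreeOff k q G H →
        Step (bump k c G) (bump (suc k) b H)
      appends : ∀ {k c q G H} → NotGreaterBefore k q c G → 2 * n ≤ G k q →
        H k q ≡ c → AgreeOff k q G H → Step (bump k c G) (fin k H)
      cancels : ∀ {k c q G H} → NotGreaterBefore k q c G → c ≡ 2 * k → G k q ≡ suc (2 * k) →
        AgreeOff k q G H → Step (bump k c G) (hole k q H)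
      rights : ∀ {i j G H} → G i (suc j) < G (suc i) j → G i (suc j) < 2 * n →
        H i j ≡ G i (suc j) → AgreeOff₂ (i , j) (i , suc j) G H →
        Step (hole i j G) (hole i (suc j) H)
      downs : ∀ {i j G H} → G (suc i) j ≤ G i (suc j) →
        H i j ≡ G (suc i) j → AgreeOff₂ (i , j) (suc i , j) G H →
        Step (hole i j G) (hole (suc i) j H)

    -- The letter c about to enter row k + 1 was bumped out of row k at some column p.
    Above : ℕ → ℕ → Grid → Set
    Above zero    c G = ⊤
    Above (suc k) c G = ∃ λ p → G k p < c × c < G (suc k) p

    -- The bound 2 * i < G i (suc j) says that a rightward slide leaves behind a letter
    -- greater than i, so that it cannot be mistaken for the start of the slide.
    Valid : (ℕ → ℕ) → State → Set
    Valid μ (bump k c G) = SemiStd Anywhere μ G × c < 2 * n × 2 * k ≤ c × Above k c G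
    Valid μ (hole i j G) = SemiStd (Off i j) μ G × j < μ i × i < n × 2 * i < G i (suc j)
    Valid μ (fin k G)    = ∃ λ ν → AddBox k μ ν × SemiStd Anywhere ν G

    -- Steps preserve validity

    2*-suc : ∀ i → 2 * suc i ≡ suc (suc (2 * i))
    2*-suc i = *-suc 2 i

    sucLow : ∀ i → 2 * i < 2 * suc i
    sucLow i = *-monoʳ-< 2 (n<1+n i)

    right≢ : ∀ {i j : ℕ} → (i , suc j) ≢ (i , j)
    right≢ = col≢ (λ e → 1+n≢n e)

    down≢ : ∀ {i j : ℕ} → (suc i , j) ≢ (i , j)
    down≢ = row≢ (λ e → 1+n≢n e)

    down≢' : ∀ {i j y : ℕ} → (suc i , y) ≢ (i , j)
    down≢' = row≢ (λ e → 1+n≢n e)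

    right≢' : ∀ {i j x : ℕ} → (x , suc j) ≢ (i , j)
    right≢' = col≢ (λ e → 1+n≢n e)

    2+n≢n : ∀ {j} → suc (suc j) ≢ j
    2+n≢n {j} e = <-irrefl (sym e) (<-trans (n<1+n j) (n<1+n (suc j)))

    left≢ : ∀ {i j : ℕ} → (i , j) ≢ (i , suc j)
    left≢ e = right≢ (sym e)

    up≢ : ∀ {i j : ℕ} → (i , j) ≢ (suc i , j)
    up≢ e = down≢ (sym e)

    -- Bumping paths move weakly to the left: `c` came from column `p` of the row above, and
    -- `c < G (suc k) p` forces `q ≤ p`. All cells above and weakly left of the new place are
    -- therefore dominated by `G k p < c`.
    bump-col : ∀ {μ k c q G} → Valid μ (bump k c G) → c < G k q → NotGreaterBefore k q c G →
      ∀ {x y} → x < k → y ≤ q → G x y < c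
    bump-col {k = suc k} {c} {q} {G} (S , c< , lc , p , Gkp< , <Gp) c<b fst {x} {y} x<k y≤q with q ≤? p
    ... | yes q≤p with m≤n⇒m<n∨m≡n (s≤s⁻¹ x<k)
    ...   | inj₁ x<k' = <-trans (col S tt tt x<k' (≤-trans y≤q q≤p)) Gkp<
    ...   | inj₂ refl = ≤-<-trans (row S tt tt (≤-trans y≤q q≤p)) Gkp<
    bump-col {k = suc k} (S , c< , lc , p , Gkp< , <Gp) c<b fst x<k y≤q | no q≰p =
      ⊥-elim (<⇒≱ <Gp (fst p (≰⇒> q≰p)))

    bump-refill : ∀ {μ μ' k c q G H} → Valid μ (bump k c G) → c < G k q → NotGreaterBefore k q c G →
      H k q ≡ c → AgreeOff k q G H →
      (∀ {x y} → (x , y) ≢ (k , q) → (y < μ' x → y < μ x) × (μ' x ≤ y → μ x ≤ y)) →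
      q < μ' k → SemiStd Anywhere μ' H
    bump-refill {k = k} {q = q} v@(S , c< , lc , _) c<b fst refl ag shp q< =
      refill k q S (λ _ → ag _ _) (λ _ _ → tt) shp
        (λ _ y<q → fst _ y<q)
        (λ _ q<y → <⇒≤ (<-≤-trans c<b (row S tt tt (<⇒≤ q<y))))
        (λ _ x<k y≤q → bump-col v c<b fst x<k y≤q)
        (λ _ k<x q≤y → <-trans c<b (col S tt tt k<x q≤y))
        lc (λ _ → c<) (λ p → ⊥-elim (<⇒≱ q< p))

    -- The shape stays `μ` during all bumps and slides, with the hole counted as one of its cells.
    -- Only `appends` enlarges it, and a deleted box is subtracted after the run has ended.
    step-valid : ∀ {μ s t} → (∀ {x x'} → x ≤ x' → μ x' ≤ μ x) → Valid μ s → Step s t → Valid μ t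
    step-valid {μ} anti v@(S , c< , lc , _) (bumps {k} {c} {b} {q} {G} {H} fst refl c<b b< ¬can Hq ag) =
      bump-refill v c<b fst Hq ag (λ _ → id , id) (inside⁻¹ S tt b<) , b< , lowb ,
      q , subst (_< b) (sym Hq) c<b , subst (b <_) (ag _ _ down≢) (col S tt tt (n<1+n k) ≤-refl)
      where
      -- From `2 * k ≤ c < b` only `b = suc (2 * k)` could be too small for the next row, and then
      -- `c = 2 * k`: this is exactly the cancelling pair.
      lowb : 2 * suc k ≤ b
      lowb with m≤n⇒m<n∨m≡n (≤-trans (s≤s lc) c<b)
      ... | inj₁ p = subst (_≤ b) (sym (2*-suc k)) p
      ... | inj₂ p = ⊥-elim (¬can (≤-antisym (s≤s⁻¹ (subst (c <_) (sym p) c<b)) lc , sym p))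
    step-valid {μ} anti v@(S , c< , lc , _) (appends {k} {c} {q} {G} {H} fst N≤ Hq ag) =
      ν , (νk , λ x x≢k → νx x≢k) ,
      bump-refill v (<-≤-trans c< N≤) fst Hq ag shp (subst₂ _<_ (sym q≡) (sym νk) (n<1+n (μ k)))
      where
      ν : ℕ → ℕ
      ν x with x ≟ k
      ... | yes _ = suc (μ x)
      ... | no _  = μ x
      νk : ν k ≡ suc (μ k)
      νk with k ≟ k
      ... | yes _ = refl
      ... | no ¬p = ⊥-elim (¬p refl)
      νx : ∀ {x} → x ≢ k → ν x ≡ μ x
      νx {x} x≢k with x ≟ k
      ... | yes p = ⊥-elim (x≢k p)
      ... | no _ = refl
      -- The insertion column cannot pass the first outside cell, whose value exceeds `c`, and it
      -- cannot lie inside, where values are below `2 * n`.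
      q≡ : q ≡ μ k
      q≡ = ≤-antisym
        (≮⇒≥ λ μ<q → <⇒≱ c< (≤-trans (subst (2 * n ≤_) (sym (outside S tt ≤-refl)) (2n≤out k)) (fst (μ k) μ<q)))
        (outside⁻¹ S tt N≤)
      shp : ∀ {x y} → (x , y) ≢ (k , q) → (y < ν x → y < μ x) × (ν x ≤ y → μ x ≤ y)
      shp {x} {y} z≢ with x ≟ k
      ... | no _ = id , id
      ... | yes refl = (λ p → ≤∧≢⇒< (s≤s⁻¹ p) (λ e → z≢ (cong (x ,_) (trans e (sym q≡))))) , <⇒≤
    step-valid {μ} anti v@(S , c< , lc , _) (cancels {k} {c} {q} {G} {H} fst refl Gq ag) =
      transport S (λ _ → tt) (λ o → ag _ _ o) (λ _ → id , id) , q< , *-cancelˡ-< 2 k n c< ,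
      subst (c <_) (ag _ _ right≢) (≤-trans (≤-reflexive (sym Gq)) (row S tt tt (n≤1+n q)))
      where
      q< : q < μ k
      q< = inside⁻¹ S tt (subst (_< 2 * n) (sym Gq)
             (≤-trans (≤-reflexive (sym (2*-suc k))) (*-monoʳ-≤ 2 (*-cancelˡ-< 2 k n c<))))
    step-valid {μ} anti (S , j< , i<n , J) (rights {i} {j} {G} {H} r<d r< Hij ag) =
      refill i j S (λ o z≢ → ag _ _ z≢ o) (λ _ z≢ → z≢) (λ _ → id , id)
        (λ _ y<j → subst (_ ≤_) (sym Hij) (row S (col≢ (<⇒≢ y<j)) right≢ (≤-trans (<⇒≤ y<j) (n≤1+n j))))
        (λ _ j<y → subst (_≤ _) (sym Hij) (row S right≢ (col≢ (>⇒≢ j<y)) j<y))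
        (λ _ x<i y≤j → subst (_ <_) (sym Hij) (col S (row≢ (<⇒≢ x<i)) right≢ x<i (≤-trans y≤j (n≤1+n j))))
        (λ _ i<x j≤y → subst (_< _) (sym Hij) (<-≤-trans r<d (below i<x j≤y)))
        (subst (2 * i ≤_) (sym Hij) (<⇒≤ J))
        (λ _ → subst (_< 2 * n) (sym Hij) r<)
        (λ p → ⊥-elim (<⇒≱ j< p)) ,
      j'< , i<n ,
      subst (2 * i <_) (ag _ _ (col≢ 2+n≢n) right≢) (<-≤-trans J (row S right≢ (col≢ 2+n≢n) (n≤1+n (suc j))))
      where
      j'< : suc j < μ i
      j'< = inside⁻¹ S right≢ r<
      below : ∀ {x y} → i < x → j ≤ y → G (suc i) j ≤ G x y
      below i<x j≤y with m≤n⇒m<n∨m≡n i<x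
      ... | inj₁ p = <⇒≤ (col S down≢ (row≢ (>⇒≢ i<x)) p j≤y)
      ... | inj₂ refl = row S down≢ down≢' j≤y
    step-valid {μ} anti (S , j< , i<n , J) (downs {i} {j} {G} {H} d≤r Hij ag) =
      refill i j S (λ o z≢ → ag _ _ z≢ o) (λ _ z≢ → z≢) (λ _ → id , id)
        (λ _ y<j → subst (_ ≤_) (sym Hij) (<⇒≤ (col S (col≢ (<⇒≢ y<j)) down≢ (n<1+n i) (<⇒≤ y<j))))
        (λ _ j<y → subst (_≤ _) (sym Hij) (≤-trans d≤r (row S right≢ (col≢ (>⇒≢ j<y)) j<y)))
        (λ _ x<i y≤j → subst (_ <_) (sym Hij) (col S (row≢ (<⇒≢ x<i)) down≢ (<-trans x<i (n<1+n i)) y≤j))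
        (λ o i<x j≤y → subst (_< _) (sym Hij) (below o i<x j≤y))
        (subst (2 * i ≤_) (sym Hij) (≤-trans (<⇒≤ (sucLow i)) (low S down≢)))
        (λ _ → subst (_< 2 * n) (sym Hij) d<)
        (λ p → ⊥-elim (<⇒≱ j< p)) ,
      inside⁻¹ S down≢ d< , *-cancelˡ-< 2 (suc i) n (≤-<-trans (low S down≢) d<) ,
      -- The bound for the new row: `2 * suc i ≤ d ≤ r`, and `r` is smaller than the cell below it,
      -- which is the new right neighbour of the hole.
      subst (2 * suc i <_) (ag _ _ down≢' right≢')
        (≤-<-trans (≤-trans (low S down≢) d≤r) (col S right≢ down≢' (n<1+n i) ≤-refl))
      where
      -- The letter moving up is a genuine one: an outside value `out (suc i)` would exceed both
      -- every letter and `out i`, contradicting `d ≤ r`.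
      d< : G (suc i) j < 2 * n
      d< with j <? μ (suc i)
      ... | yes p = inside S down≢ p
      ... | no ¬p with suc j <? μ i
      ...   | yes q = ⊥-elim (<⇒≱ (inside S right≢ q) (≤-trans (≤-trans (2n≤out (suc i)) (≤-reflexive (sym (outside S down≢ (≮⇒≥ ¬p))))) d≤r))
      ...   | no ¬q = ⊥-elim (<⇒≱ (out-< (n<1+n i)) (subst₂ _≤_ (outside S down≢ (≮⇒≥ ¬p)) (outside S right≢ (≮⇒≥ ¬q)) d≤r))
      -- To the right of column j, row `suc i` gives only a weak inequality. Strictness comes from
      -- the detour `d ≤ r` followed by a strict column comparison.
      below : ∀ {x y} → Off (suc i) j (x , y) → i < x → j ≤ y → G (suc i) j < G x y
      below {x} {y} o i<x j≤y with m≤n⇒m<n∨m≡n j≤y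
      ... | inj₁ j<y = ≤-<-trans d≤r (col S right≢ (row≢ (>⇒≢ i<x)) i<x j<y)
      ... | inj₂ refl with m≤n⇒m<n∨m≡n i<x
      ...   | inj₁ p = col S down≢ (row≢ (>⇒≢ i<x)) p ≤-refl
      ...   | inj₂ refl = ⊥-elim (o refl)

    -- Uniqueness of the preceding state

    sym≈ : ∀ {s t} → s ≈ˢ t → t ≈ˢ s
    sym≈ (bump≈ e) = bump≈ λ x y → sym (e x y)
    sym≈ (hole≈ e) = hole≈ λ x y o → sym (e x y o)
    sym≈ (fin≈ e) = fin≈ λ x y → sym (e x y)

    restore : ∀ {i j G G' H H'} → AgreeOff i j G H → AgreeOff i j G' H' → AgreeOff i j H H' →
      G i j ≡ G' i j → ∀ x y → G x y ≡ G' x y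
    restore {i} {j} ag ag' e e₀ x y with (x , y) ≟ᶜ (i , j)
    ... | yes refl = e₀
    ... | no ¬p = trans (ag x y ¬p) (trans (e x y ¬p) (sym (ag' x y ¬p)))

    off : ∀ {i j} {G H : Grid} → (∀ x y → G x y ≡ H x y) → AgreeOff i j G H
    off e x y _ = e x y

    bumped-last : ∀ {k b q q'} {G H H' : Grid} → (∀ {y y'} → y ≤ y' → G k y ≤ G k y') → b ≤ G k q →
      AgreeOff k q G H → (∀ x y → H x y ≡ H' x y) → H' k q' < b → ¬ (q < q')
    bumped-last {k} {q' = q'} rw Gq ag e lt q<q' = <⇒≱ lt (≤-trans Gq (≤-trans (rw (<⇒≤ q<q'))
      (≤-reflexive (trans (ag k q' (col≢ (>⇒≢ q<q'))) (e k q')))))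

    -- In the new row, `q` is the last column with an entry below `b`: it holds a letter smaller
    -- than `b`, while the cells to its right were at least `b` and have not changed. So `b` and the
    -- new grid determine `q`, and with it the old grid.
    bumped-unique : ∀ {k b c c' q q'} {G G' H H' : Grid} →
      (∀ {y y'} → y ≤ y' → G k y ≤ G k y') → (∀ {y y'} → y ≤ y' → G' k y ≤ G' k y') →
      G k q ≡ b → G' k q' ≡ b → c < b → c' < b → H k q ≡ c → H' k q' ≡ c' →
      AgreeOff k q G H → AgreeOff k q' G' H' → (∀ x y → H x y ≡ H' x y) →
      c ≡ c' × (∀ x y → G x y ≡ G' x y)
    bumped-unique {k} {b} {q = q} {q'} rw rw' Gq Gq' c< c'< Hq Hq' ag ag' e with <-cmp q q'
    ... | tri< q<q' _ _ = ⊥-elim (bumped-last rw (≤-reflexive (sym Gq)) ag e (subst (_< b) (sym Hq') c'<) q<q')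
    ... | tri> _ _ q'<q = ⊥-elim (bumped-last rw' (≤-reflexive (sym Gq')) ag' (λ x y → sym (e x y)) (subst (_< b) (sym Hq) c<) q'<q)
    ... | tri≈ _ refl _ = trans (sym Hq) (trans (e k q) Hq') , restore ag ag' (off e) (trans Gq (sym Gq'))

    -- The left neighbour of the hole tells the two apart. After a rightward slide it is the letter
    -- just moved, greater than `2 * i` by `Valid`; after a cancellation it precedes the leftmost
    -- entry greater than `c = 2 * i`.
    ¬cancel-right : ∀ {μ c k q i j G H G' H'} → Valid μ (bump k c G) → Valid μ (hole i j G') →
      NotGreaterBefore k q c G → c ≡ 2 * k → AgreeOff k q G H →
      H' i j ≡ G' i (suc j) → AgreeOff₂ (i , j) (i , suc j) G' H' → ¬ (hole k q H ≈ˢ hole i (suc j) H')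
    ¬cancel-right {i = i} {j} V W fst refl ag Hij _ (hole≈ e) = <⇒≱ (proj₂ (proj₂ (proj₂ W)))
      (≤-trans (≤-reflexive (trans (sym Hij) (trans (sym (e i j left≢)) (sym (ag i j left≢))))) (fst j (n<1+n j)))

    -- Here the upper neighbour decides. A downward slide leaves there a letter that was allowed in
    -- the lower row, hence at least its unbarred letter; before a cancellation `bump-col` makes it
    -- smaller than that letter.
    ¬cancel-down : ∀ {μ c k q i j G H G' H'} → Valid μ (bump k c G) → Valid μ (hole i j G') →
      NotGreaterBefore k q c G → c ≡ 2 * k → G k q ≡ suc (2 * k) → AgreeOff k q G H →
      H' i j ≡ G' (suc i) j → AgreeOff₂ (i , j) (suc i , j) G' H' → ¬ (hole k q H ≈ˢ hole (suc i) j H')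
    ¬cancel-down {i = i} {j} V W fst refl Gq ag Hij _ (hole≈ e) = <⇒≱
      (bump-col V (subst (_ <_) (sym Gq) (n<1+n _)) fst (n<1+n i) ≤-refl)
      (≤-trans (low (proj₁ W) down≢) (≤-reflexive (trans (sym Hij) (trans (sym (e i j up≢)) (sym (ag i j up≢))))))

    -- After a rightward slide the left neighbour of the hole used to stand directly below the upper
    -- one, so it is strictly larger. After a downward slide the upper neighbour used to stand to
    -- the right of the left one, so it is at least as large.
    ¬right-down : ∀ {μ i j i' j' G H G' H'} → Valid μ (hole i j G) → Valid μ (hole i' j' G') →
      H i j ≡ G i (suc j) → AgreeOff₂ (i , j) (i , suc j) G H →
      H' i' j' ≡ G' (suc i') j' → AgreeOff₂ (i' , j') (suc i' , j') G' H' →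
      ¬ (hole i (suc j) H ≈ˢ hole (suc i') j' H')
    ¬right-down {i = suc i} {j} {G = G} {H} {G'} {H'} V W Hij ag Hij' ag' (hole≈ e) = <⇒≱ U<r d≥L
      where
      up≢' : ∀ {y} → (i , y) ≢ (suc i , j)
      up≢' = row≢ (λ eq → 1+n≢n (sym eq))
      U<r : H' i (suc j) < H' (suc i) j
      U<r = subst₂ _<_ (trans (ag i (suc j) up≢' up≢) (e i (suc j) up≢))
              (trans (sym Hij) (e (suc i) j left≢))
              (col (proj₁ V) up≢' right≢ (n<1+n i) ≤-refl)
      d≥L : H' (suc i) j ≤ H' i (suc j)
      d≥L = subst₂ _≤_ (ag' (suc i) j down≢' left≢) (sym Hij')
              (row (proj₁ W) down≢' down≢ (n≤1+n j))

    step-injective : ∀ {μ s t s' t'} → Valid μ s → Valid μ t → Step s s' → Step t t' →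
      s' ≈ˢ t' → s ≈ˢ t
    step-injective V W (bumps {k} {c} _ Gq c<b _ _ Hq ag) (bumps _ Gq' c'<b _ _ Hq' ag') (bump≈ e)
      with bumped-unique (row (proj₁ V) tt tt) (row (proj₁ W) tt tt) Gq Gq' c<b c'<b Hq Hq' ag ag' e
    ... | refl , eG = bump≈ eG
    -- An append counts as a bump that throws out the value `out k`, so reverse row insertion
    -- applies verbatim.
    step-injective V W (appends {k} _ ≤Gq Hq ag) (appends _ ≤Gq' Hq' ag') (fin≈ e)
      with bumped-unique {b = out k} (row (proj₁ V) tt tt) (row (proj₁ W) tt tt)
             (outside (proj₁ V) tt (outside⁻¹ (proj₁ V) tt ≤Gq))
             (outside (proj₁ W) tt (outside⁻¹ (proj₁ W) tt ≤Gq'))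
             (<-≤-trans (proj₁ (proj₂ V)) (2n≤out k)) (<-≤-trans (proj₁ (proj₂ W)) (2n≤out k))
             Hq Hq' ag ag' e
    ... | refl , eG = bump≈ eG
    step-injective V W (cancels _ refl Gq ag) (cancels _ refl Gq' ag') (hole≈ e) =
      bump≈ (restore ag ag' e (trans Gq (sym Gq')))
    step-injective V W (rights {i} {j} {G} _ _ Hij ag) (rights {G = G'} _ _ Hij' ag') (hole≈ e) = hole≈ eq
      where
      eq : AgreeOff i j G G'
      eq x y z≢ with (x , y) ≟ᶜ (i , suc j)
      ... | yes refl = trans (sym Hij) (trans (e i j (left≢)) Hij')
      ... | no ¬p = trans (ag x y z≢ ¬p) (trans (e x y ¬p) (sym (ag' x y z≢ ¬p)))
    step-injective V W (downs {i} {j} {G} _ Hij ag) (downs {G = G'} _ Hij' ag') (hole≈ e) = hole≈ eq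
      where
      eq : AgreeOff i j G G'
      eq x y z≢ with (x , y) ≟ᶜ (suc i , j)
      ... | yes refl = trans (sym Hij) (trans (e i j (up≢)) Hij')
      ... | no ¬p = trans (ag x y z≢ ¬p) (trans (e x y ¬p) (sym (ag' x y z≢ ¬p)))
    step-injective V W (cancels fst c≡ Gq ag) (rights r<d r< Hij ag') e = ⊥-elim (¬cancel-right V W fst c≡ ag Hij ag' e)
    step-injective V W (rights r<d r< Hij ag') (cancels fst c≡ Gq ag) e = ⊥-elim (¬cancel-right W V fst c≡ ag Hij ag' (sym≈ e))
    step-injective V W (cancels fst c≡ Gq ag) (downs d≤r Hij ag') e = ⊥-elim (¬cancel-down V W fst c≡ Gq ag Hij ag' e)
    step-injective V W (downs d≤r Hij ag') (cancels fst c≡ Gq ag) e = ⊥-elim (¬cancel-down W V fst c≡ Gq ag Hij ag' (sym≈ e))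
    step-injective V W (rights r<d r< Hij ag) (downs d≤r Hij' ag') e = ⊥-elim (¬right-down V W Hij ag Hij' ag' e)
    step-injective V W (downs d≤r Hij' ag') (rights r<d r< Hij ag) e = ⊥-elim (¬right-down W V Hij ag Hij' ag' (sym≈ e))

    -- These states have no predecessor, so two runs traced back from a common end must stop
    -- together.
    Initial : State → Set
    Initial (bump zero c G) = ⊤
    Initial _ = ⊥

    no-step-to-initial : ∀ {s t} → Step s t → ¬ Initial t
    no-step-to-initial (bumps _ _ _ _ _ _ _) ()
    no-step-to-initial (appends _ _ _ _) ()
    no-step-to-initial (cancels _ _ _ _) ()
    no-step-to-initial (rights _ _ _ _) ()
    no-step-to-initial (downs _ _ _) ()

    initial-≈ : ∀ {s t} → s ≈ˢ t → Initial s → Initial t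
    initial-≈ {bump zero _ _} (bump≈ _) p = p

    -- Unlike `Star`, these runs grow at their end: injectivity peels off the last step first.
    data Run : State → State → Set where
      []   : ∀ {s} → Run s s
      _∷ʳ_ : ∀ {s t u} → Run s t → Step t u → Run s u

    _⊳_ : ∀ {s t u} → Run s t → Star (Step) t u → Run s u
    r ⊳ ε = r
    r ⊳ (st ◅ sts) = (r ∷ʳ st) ⊳ sts

    module _ {μ : ℕ → ℕ} (anti : ∀ {x x'} → x ≤ x' → μ x' ≤ μ x) where

      run-valid : ∀ {s t} → Valid μ s → Run s t → Valid μ t
      run-valid V [] = V
      run-valid V (r ∷ʳ st) = step-valid anti (run-valid V r) st

      run-injective : ∀ {s t s' t'} → Valid μ s → Valid μ t → Initial s → Initial t →
        Run s s' → Run t t' → s' ≈ˢ t' → s ≈ˢ t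
      run-injective V W i j [] [] e = e
      run-injective V W i j [] (_ ∷ʳ st) e = ⊥-elim (no-step-to-initial st (initial-≈ e i))
      run-injective V W i j (_ ∷ʳ st) [] e = ⊥-elim (no-step-to-initial st (initial-≈ (sym≈ e) j))
      run-injective V W i j (r ∷ʳ st) (r' ∷ʳ st') e =
        run-injective V W i j r r' (step-injective (run-valid V r) (run-valid W r') st st' e)

      star-injective : ∀ {s t s' t'} → Valid μ s → Valid μ t → Initial s → Initial t →
        Star (Step) s s' → Star (Step) t t' → s' ≈ˢ t' → s ≈ˢ t
      star-injective V W i j r r' = run-injective V W i j ([] ⊳ r) ([] ⊳ r')

    -- Determinism of forward runs

    first-unique : ∀ {k c q q'} {G G' : Grid} → (∀ x y → G x y ≡ G' x y) →
      NotGreaterBefore k q c G → NotGreaterBefore k q' c G' → c < G k q → c < G' k q' → q ≡ q'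
    first-unique {k} {c} {q} {q'} e fst fst' lt lt' with <-cmp q q'
    ... | tri< q<q' _ _ = ⊥-elim (<⇒≱ lt (≤-trans (≤-reflexive (e k q)) (fst' q q<q')))
    ... | tri≈ _ q≡ _ = q≡
    ... | tri> _ _ q'<q = ⊥-elim (<⇒≱ lt' (≤-trans (≤-reflexive (sym (e k q'))) (fst q' q'<q)))

    replace : ∀ {i j G G' H H'} → AgreeOff i j G H → AgreeOff i j G' H' → (∀ x y → G x y ≡ G' x y) →
      AgreeOff i j H H'
    replace ag ag' e x y z≢ = trans (sym (ag x y z≢)) (trans (e x y) (ag' x y z≢))

    replace-all : ∀ {i j G G' H H'} → AgreeOff i j G H → AgreeOff i j G' H' → (∀ x y → G x y ≡ G' x y) →
      H i j ≡ H' i j → ∀ x y → H x y ≡ H' x y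
    replace-all {i} {j} ag ag' e e₀ x y with (x , y) ≟ᶜ (i , j)
    ... | yes refl = e₀
    ... | no ¬p = replace ag ag' e x y ¬p

    suc-2k : ∀ {c b : ℕ} k → c ≡ 2 * k → b ≡ suc (2 * k) → c < b
    suc-2k k refl refl = n<1+n _

    odd<even : ∀ k → 2 * k < 2 * n → suc (2 * k) < 2 * n
    odd<even k lt = ≤-trans (≤-reflexive (sym (2*-suc k))) (*-monoʳ-≤ 2 (*-cancelˡ-< 2 k n lt))

    -- The leftmost entry greater than `c` is unique, and its value decides between bump, append and
    -- cancellation; a slide is decided by comparing the two neighbours. Surjectivity rests on this:
    -- a run built backwards has to be the one that insertion follows.
    step-deterministic : ∀ {μ s t s' t'} → Valid μ s → Step s s' → Step t t' →
      s ≈ˢ t → s' ≈ˢ t'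
    step-deterministic V (bumps {k} {q = q} fst refl c<b _ _ Hq ag) (bumps fst' refl c<b' _ _ Hq' ag') (bump≈ e)
      with first-unique e fst fst' c<b c<b'
    ... | refl rewrite e k q = bump≈ (replace-all ag ag' e (trans Hq (sym Hq')))
    step-deterministic (S , c< , _) (appends fst ≤G Hq ag) (appends fst' ≤G' Hq' ag') (bump≈ e)
      with first-unique e fst fst' (<-≤-trans c< ≤G) (<-≤-trans c< ≤G')
    ... | refl = fin≈ (replace-all ag ag' e (trans Hq (sym Hq')))
    step-deterministic V (cancels {k} fst c≡ Gq ag) (cancels fst' _ Gq' ag') (bump≈ e)
      with first-unique e fst fst' (suc-2k k c≡ Gq) (suc-2k k c≡ Gq')
    ... | refl = hole≈ (replace ag ag' e)
    step-deterministic (S , c< , _) (bumps {k} {q = q} fst refl c<b b< _ Hq ag) (appends fst' ≤G' Hq' ag') (bump≈ e)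
      with first-unique e fst fst' c<b (<-≤-trans c< ≤G')
    ... | refl = ⊥-elim (<⇒≱ b< (subst (2 * n ≤_) (sym (e k q)) ≤G'))
    step-deterministic (S , c< , _) (appends {k} {q = q} fst ≤G Hq ag) (bumps fst' refl c<b b< _ Hq' ag') (bump≈ e)
      with first-unique e fst fst' (<-≤-trans c< ≤G) c<b
    ... | refl = ⊥-elim (<⇒≱ b< (subst (2 * n ≤_) (e k q) ≤G))
    step-deterministic V (bumps {k} {q = q} fst refl c<b _ ¬can _ _) (cancels fst' c≡ Gq' _) (bump≈ e)
      with first-unique e fst fst' c<b (suc-2k k c≡ Gq')
    ... | refl = ⊥-elim (¬can (c≡ , trans (e k q) Gq'))
    step-deterministic V (cancels {k} {q = q} fst c≡ Gq _) (bumps fst' refl c<b _ ¬can _ _) (bump≈ e)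
      with first-unique e fst fst' (suc-2k k c≡ Gq) c<b
    ... | refl = ⊥-elim (¬can (c≡ , trans (sym (e k q)) Gq))
    step-deterministic (S , c< , _) (appends {k} {q = q} fst ≤G _ _) (cancels fst' refl Gq' _) (bump≈ e)
      with first-unique e fst fst' (<-≤-trans c< ≤G) (suc-2k k refl Gq')
    ... | refl = ⊥-elim (<⇒≱ (odd<even k c<) (subst (2 * n ≤_) (trans (e k q) Gq') ≤G))
    step-deterministic (S , c< , _) (cancels {k} {q = q} fst refl Gq _) (appends fst' ≤G' _ _) (bump≈ e)
      with first-unique e fst fst' (suc-2k k refl Gq) (<-≤-trans c< ≤G')
    ... | refl = ⊥-elim (<⇒≱ (odd<even k c<) (subst (2 * n ≤_) (trans (sym (e k q)) Gq) ≤G'))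
    step-deterministic V (rights {i} {j} {H = H} _ _ Hij ag) (rights {H = H'} _ _ Hij' ag') (hole≈ e) = hole≈ eq
      where
      eq : AgreeOff i (suc j) H H'
      eq x y z≢ with (x , y) ≟ᶜ (i , j)
      ... | yes refl = trans Hij (trans (e _ _ (right≢)) (sym Hij'))
      ... | no ¬p = trans (sym (ag x y ¬p z≢)) (trans (e x y ¬p) (ag' x y ¬p z≢))
    step-deterministic V (downs {i} {j} {H = H} _ Hij ag) (downs {H = H'} _ Hij' ag') (hole≈ e) = hole≈ eq
      where
      eq : AgreeOff (suc i) j H H'
      eq x y z≢ with (x , y) ≟ᶜ (i , j)
      ... | yes refl = trans Hij (trans (e _ _ (down≢)) (sym Hij'))
      ... | no ¬p = trans (sym (ag x y ¬p z≢)) (trans (e x y ¬p) (ag' x y ¬p z≢))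
    step-deterministic V (rights r<d _ _ _) (downs d≤r _ _) (hole≈ e) =
      ⊥-elim (<⇒≱ r<d (subst₂ _≤_ (sym (e _ _ (down≢))) (sym (e _ _ (right≢))) d≤r))
    step-deterministic V (downs d≤r _ _) (rights r<d _ _ _) (hole≈ e) =
      ⊥-elim (<⇒≱ r<d (subst₂ _≤_ (e _ _ (down≢)) (e _ _ (right≢)) d≤r))

    Final : State → Set
    Final (bump k c G) = ⊥
    Final (hole i j G) = 2 * n ≤ G i (suc j) × 2 * n ≤ G (suc i) j
    Final (fin k G)    = ⊤

    final-no-step : ∀ {μ s t} → Valid μ s → Final s → ¬ Step s t
    final-no-step V (r≥ , d≥) (rights r<d r< _ _) = <⇒≱ r< r≥
    final-no-step V@(S , _) (r≥ , d≥) (downs {i} {j} d≤r _ _) =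
      <⇒≱ (out-< (n<1+n i)) (subst₂ _≤_ (outside S (down≢) (outside⁻¹ S (down≢) d≥))
        (outside S (right≢) (outside⁻¹ S (right≢) r≥)) d≤r)

    final-stuck : ∀ {μ s t u} → s ≈ˢ t → Final s → Valid μ t → ¬ Step t u
    final-stuck (hole≈ e) (r≥ , d≥) W = final-no-step W
      (subst (2 * n ≤_) (e _ _ (right≢)) r≥ , subst (2 * n ≤_) (e _ _ (down≢)) d≥)
    final-stuck (fin≈ e) _ W = final-no-step W tt

    module _ {μ : ℕ → ℕ} (anti : ∀ {x x'} → x ≤ x' → μ x' ≤ μ x) where

      star-deterministic : ∀ {s t s' t'} → Valid μ s → Valid μ t → Star (Step) s s' → Star (Step) t t' →
        Final s' → Final t' → s ≈ˢ t → s' ≈ˢ t'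
      star-deterministic V W ε ε F F' e = e
      star-deterministic V W (st ◅ r) (st' ◅ r') F F' e =
        star-deterministic (step-valid anti V st) (step-valid anti W st') r r' F F' (step-deterministic V st st' e)
      star-deterministic V W ε (st ◅ _) F F' e = ⊥-elim (final-stuck e F W st)
      star-deterministic V W (st ◅ _) ε F F' e = ⊥-elim (final-stuck (sym≈ e) F' V st)

    -- Existence of predecessors

    module _ {μ : ℕ → ℕ} (anti : ∀ {x x'} → x ≤ x' → μ x' ≤ μ x) where

      -- This column is where reverse row insertion puts `b` back. It exists because the row
      -- eventually reaches `out k`, and `p ≤ q` is what later makes `b` smaller than the cells
      -- below it.
      last-< : ∀ {ν k b p H} → SemiStd Anywhere ν H → b ≤ out k → H k p < b →
        ∃ λ q → H k q < b × b ≤ H k (suc q) × p ≤ q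
      last-< {ν} {k} {b} {p} {H} S b≤ lt
        with first-≥ (H k) (ν k) (subst (b ≤_) (sym (outside S tt ≤-refl)) b≤)
      ... | zero , b≤H , before = ⊥-elim (<⇒≱ lt (≤-trans b≤H (row S tt tt z≤n)))
      ... | suc q , b≤H , before = q , before (n<1+n q) , b≤H ,
        s≤s⁻¹ (≰⇒> λ q<p → <⇒≱ lt (≤-trans b≤H (row S tt tt q<p)))

      -- Bumps and appends are undone together: either `b` is a letter returning to a cell of `μ`,
      -- or it is `out k` returning to a cell outside the smaller shape. The hypotheses on `q < μ k`
      -- and `μ k ≤ q` separate the two.
      unbump : ∀ {ν k b p q H} → SemiStd Anywhere ν H → b < H (suc k) p → H k q < b → b ≤ H k (suc q) → p ≤ q →
        (∀ {x y} → (x , y) ≢ (k , q) → (y < μ x → y < ν x) × (μ x ≤ y → ν x ≤ y)) →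
        (q < μ k → b < 2 * n) → (μ k ≤ q → b ≡ out k) → H k q < 2 * n →
        let G = update k q b H in
        Valid μ (bump k (H k q) G) × NotGreaterBefore k q (H k q) G
      unbump {ν} {k} {b} {p} {q} {H} S b<d c<b b≤r p≤q shp ins outs c< =
        (refill k q S (λ _ z≢ → sym (update-other k q b H _ _ z≢)) (λ _ _ → tt) shp
          (λ _ y<q → ≤-trans (row S tt tt (<⇒≤ y<q)) (≤-trans (<⇒≤ c<b) (≤-reflexive (sym same))))
          (λ _ q<y → ≤-trans (≤-reflexive same) (≤-trans b≤r (row S tt tt q<y)))
          (λ _ x<k y≤q → subst (_ <_) (sym same) (<-trans (col S tt tt x<k y≤q) c<b))
          (λ _ k<x q≤y → subst (_< _) (sym same) (<-≤-trans b<d (below k<x (≤-trans p≤q q≤y))))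
          (subst (2 * k ≤_) (sym same) (≤-trans (low S tt) (<⇒≤ c<b)))
          (λ lt → subst (_< 2 * n) (sym same) (ins lt))
          (λ le → trans same (outs le)) ,
         c< , low S tt , above k refl) ,
        λ y y<q → ≤-trans (≤-reflexive (update-other k q b H k y (col≢ (<⇒≢ y<q)))) (row S tt tt (<⇒≤ y<q))
        where
        same = update-same k q b H
        below : ∀ {x y} → k < x → p ≤ y → H (suc k) p ≤ H x y
        below k<x p≤y with m≤n⇒m<n∨m≡n k<x
        ... | inj₁ lt = <⇒≤ (col S tt tt lt p≤y)
        ... | inj₂ refl = row S tt tt p≤y
        above : ∀ m → m ≡ k → Above m (H k q) (update k q b H)
        above zero e = tt
        above (suc m) refl = q ,
          ≤-<-trans (≤-reflexive (update-other k q b H m q up≢)) (col S tt tt (n<1+n m) ≤-refl) ,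
          subst (H k q <_) (sym same) c<b

      unappend : ∀ {k ν H} → AddBox k μ ν → SemiStd Anywhere ν H →
        ∃ λ c → ∃ λ G → Valid μ (bump k c G) × Step (bump k c G) (fin k H)
      unappend {k} {ν} {H} (νk , νx) S with last-< {p = μ k} S ≤-refl (<-≤-trans Hμ< (2n≤out k))
        where
        Hμ< : H k (μ k) < 2 * n
        Hμ< = inside S tt (subst (μ k <_) (sym νk) (n<1+n (μ k)))
      ... | q , c<b , b≤r , p≤q = H k q , update k q (out k) H , proj₁ core ,
            appends (proj₂ core) (≤-trans (2n≤out k) (≤-reflexive (sym (update-same k q (out k) H)))) refl (update-other k q (out k) H)
        where
        c< : H k q < 2 * n
        c< with q <? ν k
        ... | yes p = inside S tt p
        ... | no ¬p = ⊥-elim (<-irrefl (outside S tt (≮⇒≥ ¬p)) c<b)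
        q≡ : q ≡ μ k
        q≡ = ≤-antisym (s≤s⁻¹ (subst (q <_) νk (inside⁻¹ S tt c<))) p≤q
        shp : ∀ {x y} → (x , y) ≢ (k , q) → (y < μ x → y < ν x) × (μ x ≤ y → ν x ≤ y)
        shp {x} {y} z≢ with x ≟ k
        ... | yes refl = (λ lt → subst (y <_) (sym νk) (<-trans lt (n<1+n _))) ,
                         (λ le → subst (_≤ y) (sym νk) (≤∧≢⇒< le (λ e → z≢ (cong (x ,_) (trans (sym e) (sym q≡))))))
        ... | no x≢k = subst (y <_) (sym (νx x x≢k)) , subst (_≤ y) (sym (νx x x≢k))
        -- The cell below the new box is outside: row `suc k` has the same length in both shapes, at
        -- most `μ k`.
        b<d : out k < H (suc k) (μ k)
        b<d = subst (out k <_) (sym (outside S tt (≤-trans (≤-reflexive (νx (suc k) 1+n≢n)) (anti (n≤1+n k))))) (out-< (n<1+n k))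
        core = unbump {p = μ k} S b<d c<b b≤r p≤q shp (λ lt → ⊥-elim (<⇒≱ lt p≤q)) (λ _ → refl) c<

      bump-back : ∀ {t} k c G → Valid μ (bump k c G) → Star Step (bump k c G) t →
        ∃ λ c₀ → ∃ λ G₀ → Valid μ (bump 0 c₀ G₀) × Star Step (bump 0 c₀ G₀) t
      bump-back zero c G V r = c , G , V , r
      bump-back (suc k) b H (S , b< , lb , p , lt , gt) r with last-< S (<⇒≤ (<-≤-trans b< (2n≤out k))) lt
      ... | q , c<b , b≤r , p≤q =
        bump-back k (H k q) (update k q b H) (proj₁ core)
          (bumps (proj₂ core) (update-same k q b H) c<b b<
            -- The undone step is not a cancellation, since `b` was allowed in row `suc k` and so
            -- exceeds the barred letter of row k.
            (λ { (_ , refl) → <⇒≱ (n<1+n _) (subst (_≤ b) (2*-suc k) lb) })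
            refl (update-other k q b H) ◅ r)
        where
        c< = <-trans c<b b<
        core = unbump S gt c<b b≤r p≤q (λ _ → id , id) (λ _ → b<)
          (λ le → ⊥-elim (<⇒≱ (inside⁻¹ S tt c<) le)) c<

      LowAbove : ℕ → ℕ → Grid → Set
      LowAbove zero j G = ⊤
      LowAbove (suc i) j G = G i j < 2 * suc i

      -- The barred letter `suc (2 * i)` fits into the hole on all four sides: at most `2 * i` on
      -- the left by hypothesis, greater than `2 * i` on the right by `Valid`, smaller than `2 * i`
      -- above by `LowAbove`, and at least `2 * suc i` below by the row condition. Inserting `2 * i`
      -- then cancels it.
      uncancel : ∀ i j H → Valid μ (hole i j H) → (∀ {y} → y < j → H i y ≤ 2 * i) → LowAbove i j H →
        let G = update i j (suc (2 * i)) H in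
        Valid μ (bump i (2 * i) G) × Step (bump i (2 * i) G) (hole i j H)
      uncancel i j H (S , j< , i<n , J) lf ab =
        (refill i j S (λ _ z≢ → sym (update-other i j _ H _ _ z≢)) (λ _ z≢ → z≢) (λ _ → id , id)
          (λ _ y<j → ≤-trans (lf y<j) (≤-trans (n≤1+n _) (≤-reflexive (sym same))))
          (λ _ j<y → ≤-trans (≤-reflexive same) (≤-trans J (row S right≢ (col≢ (>⇒≢ j<y)) j<y)))
          (λ _ x<i y≤j → ≤-trans (above i refl ab x<i y≤j) (≤-trans (n≤1+n _) (≤-reflexive (sym same))))
          (λ _ i<x j≤y → ≤-trans (≤-reflexive (trans (cong suc same) (sym (2*-suc i))))
            (≤-trans (*-monoʳ-≤ 2 i<x) (low S (row≢ (>⇒≢ i<x)))))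
          (≤-trans (n≤1+n _) (≤-reflexive (sym same)))
          (λ _ → subst (_< 2 * n) (sym same) (≤-trans (≤-reflexive (sym (2*-suc i))) (*-monoʳ-≤ 2 i<n)))
          (λ le → ⊥-elim (<⇒≱ j< le)) ,
         *-monoʳ-< 2 i<n , ≤-refl , above' i refl ab) ,
        cancels (λ y y<j → ≤-trans (≤-reflexive (update-other i j _ H i y (col≢ (<⇒≢ y<j)))) (lf y<j))
          refl same (update-other i j _ H)
        where
        same = update-same i j (suc (2 * i)) H
        above : ∀ m → m ≡ i → LowAbove m j H → ∀ {x y} → x < m → y ≤ j → H x y < 2 * m
        above (suc m) refl U< x<i y≤j with m≤n⇒m<n∨m≡n (s≤s⁻¹ x<i)
        ... | inj₁ x<m = <-trans (col S (row≢ (<⇒≢ x<i)) up≢ x<m y≤j) U<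
        ... | inj₂ refl = ≤-<-trans (row S (row≢ (<⇒≢ x<i)) up≢ y≤j) U<
        above' : ∀ m → m ≡ i → LowAbove m j H → Above m (2 * i) (update i j (suc (2 * i)) H)
        above' zero e _ = tt
        above' (suc m) refl U< = j , subst (_< 2 * suc m) (sym (update-other i j _ H m j up≢)) U< ,
          subst (2 * i <_) (sym same) (n<1+n _)

      -- The condition `2 * i < H i j` is precisely the bound that `Valid` requires of the earlier
      -- hole, whose right neighbour this letter becomes again.
      unright : ∀ i j H → Valid μ (hole i (suc j) H) → 2 * i < H i j → (∀ {x} → x < i → H x (suc j) < H i j) →
        let G = update i (suc j) (H i j) H in
        Valid μ (hole i j G) × Step (hole i j G) (hole i (suc j) H)
      unright i j H (S , j< , i<n , J) lf ab =
        (refill i (suc j) S (λ _ z≢ → sym (update-other i (suc j) _ H _ _ z≢)) (λ _ z≢ → z≢) (λ _ → id , id)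
          (λ _ y<j → ≤-trans (row S (col≢ (<⇒≢ y<j)) left≢ (s≤s⁻¹ y<j)) (≤-reflexive (sym same)))
          (λ _ j<y → ≤-trans (≤-reflexive same) (row S left≢ (col≢ (>⇒≢ j<y)) (<⇒≤ (<-trans (n<1+n j) j<y))))
          (λ _ x<i y≤j → subst (_ <_) (sym same) (≤-<-trans (row S (row≢ (<⇒≢ x<i)) (row≢ (<⇒≢ x<i)) y≤j) (ab x<i)))
          (λ _ i<x j≤y → subst (_< _) (sym same) (col S left≢ (row≢ (>⇒≢ i<x)) i<x (≤-trans (n≤1+n j) j≤y)))
          (subst (2 * i ≤_) (sym same) (<⇒≤ lf))
          (λ _ → subst (_< 2 * n) (sym same) L<)
          (λ le → ⊥-elim (<⇒≱ j< le)) ,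
         ≤-trans (n≤1+n (suc j)) j< , i<n , subst (2 * i <_) (sym same) lf) ,
        rights
          (subst₂ _<_ (sym same) (sym (update-other i (suc j) _ H (suc i) j down≢')) (col S left≢ down≢' (n<1+n i) ≤-refl))
          (subst (_< 2 * n) (sym same) L<) (sym same)
          (λ x y _ z≢ → update-other i (suc j) _ H x y z≢)
        where
        same = update-same i (suc j) (H i j) H
        L< : H i j < 2 * n
        L< = inside S left≢ (≤-trans (n≤1+n (suc j)) j<)

      -- The upper letter returns to row `suc i`, so it must be at least `2 * suc i` there;
      -- otherwise the hole was created by a cancellation.
      undown : ∀ i j H → Valid μ (hole (suc i) j H) → 2 * suc i ≤ H i j → (∀ {y} → y < j → H (suc i) y ≤ H i j) →
        let G = update (suc i) j (H i j) H in
        Valid μ (hole i j G) × Step (hole i j G) (hole (suc i) j H)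
      undown i j H (S , j< , i<n , J) lo lf =
        (refill (suc i) j S (λ _ z≢ → sym (update-other (suc i) j _ H _ _ z≢)) (λ _ z≢ → z≢) (λ _ → id , id)
          (λ _ y<j → subst (_ ≤_) (sym same) (lf y<j))
          (λ _ j<y → ≤-trans (≤-reflexive same) (<⇒≤ (col S up≢ (col≢ (>⇒≢ j<y)) (n<1+n i) (<⇒≤ j<y))))
          above
          (λ _ i<x j≤y → subst (_< _) (sym same) (col S up≢ (row≢ (>⇒≢ i<x)) (<-trans (n<1+n i) i<x) j≤y))
          (subst (2 * suc i ≤_) (sym same) lo)
          (λ _ → subst (_< 2 * n) (sym same) U<)
          (λ le → ⊥-elim (<⇒≱ j< le)) ,
         ≤-trans j< (anti (n≤1+n i)) , <-trans (n<1+n i) i<n ,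
         subst (2 * i <_) (sym (update-other (suc i) j _ H i (suc j) right≢'))
           (<-≤-trans (sucLow i) (≤-trans lo (row S up≢ right≢' (n≤1+n j))))) ,
        downs
          (subst₂ _≤_ (sym same) (sym (update-other (suc i) j _ H i (suc j) right≢')) (row S up≢ right≢' (n≤1+n j)))
          (sym same) (λ x y _ z≢ → update-other (suc i) j _ H x y z≢)
        where
        same = update-same (suc i) j (H i j) H
        U< : H i j < 2 * n
        U< = inside S up≢ (≤-trans j< (anti (n≤1+n i)))
        -- Mirror image of the forward case: in row i itself strictness comes from stepping down to
        -- row `suc i` and comparing there with the letter through `lf`.
        above : ∀ {x y} → Off i j (x , y) → x < suc i → y ≤ j → H x y < update (suc i) j (H i j) H (suc i) j
        above {x} {y} o x<i y≤j with m≤n⇒m<n∨m≡n y≤j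
        ... | inj₁ y<j = subst (_ <_) (sym same) (<-≤-trans (col S (row≢ (<⇒≢ x<i)) (col≢ (<⇒≢ y<j)) x<i ≤-refl) (lf y<j))
        ... | inj₂ refl = subst (_ <_) (sym same)
          (col S (row≢ (<⇒≢ x<i)) up≢ (≤∧≢⇒< (s≤s⁻¹ x<i) (λ e → o (cong (_, y) e))) ≤-refl)

      BumpRun : State → Set
      BumpRun t = ∃ λ k → ∃ λ c → ∃ λ G → Valid μ (bump k c G) × Star Step (bump k c G) t

      -- The slide is undone towards the larger of the left and upper neighbours,
      -- until the letter ī fits into the hole of row i and all letters to its left are i.
      hole-case : ∀ {t} i j H → Valid μ (hole (suc i) (suc j) H) → Star Step (hole (suc i) (suc j) H) t →
        (∀ G → Valid μ (hole (suc i) j G) → Star Step (hole (suc i) j G) t → BumpRun t) →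
        (∀ G → Valid μ (hole i (suc j) G) → Star Step (hole i (suc j) G) t → BumpRun t) → BumpRun t
      hole-case i j H V r left up with direction (H (suc i) j) (H i (suc j)) (2 * suc i)
      ... | inj₁ (L≤ , U<) with uncancel (suc i) (suc j) H V
                      (λ y< → ≤-trans (row (proj₁ V) (col≢ (<⇒≢ y<)) left≢ (s≤s⁻¹ y<)) L≤) U<
      ...   | W , st = _ , _ , _ , W , st ◅ r
      hole-case i j H V r left up | inj₂ (inj₁ (L> , U<L)) with unright (suc i) j H V L> (λ x< → ≤-<-trans (weak x<) U<L)
        where
        weak : ∀ {x} → x < suc i → H x (suc j) ≤ H i (suc j)
        weak x< with m≤n⇒m<n∨m≡n (s≤s⁻¹ x<)
        ... | inj₁ x<i = <⇒≤ (col (proj₁ V) (row≢ (<⇒≢ x<)) up≢ x<i ≤-refl)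
        ... | inj₂ refl = ≤-refl
      ... | W , st = left _ W (st ◅ r)
      hole-case i j H V r left up | inj₂ (inj₂ (U≥ , L≤U))
        with undown i (suc j) H V U≥ (λ y< → ≤-trans (row (proj₁ V) (col≢ (<⇒≢ y<)) left≢ (s≤s⁻¹ y<)) L≤U)
      ... | W , st = up _ W (st ◅ r)

      -- Row 0 has no origin from above and column 0 none from the left; at the corner only a
      -- cancellation remains. Every undone slide lowers `i + j`, so the search ends at a bump.
      hole-back : ∀ {t} i j H → Valid μ (hole i j H) → Star Step (hole i j H) t → BumpRun t
      hole-back zero zero H V r with uncancel 0 0 H V (λ ()) tt
      ... | W , st = _ , _ , _ , W , st ◅ r
      hole-back zero (suc j) H V r with 0 <? H 0 j
      ... | yes L> with unright 0 j H V L> (λ ())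
      ...   | W , st = hole-back zero j _ W (st ◅ r)
      hole-back zero (suc j) H V r | no L≯ with uncancel 0 (suc j) H V
                      (λ y< → ≤-trans (row (proj₁ V) (col≢ (<⇒≢ y<)) left≢ (s≤s⁻¹ y<)) (≮⇒≥ L≯)) tt
      ...   | W , st = _ , _ , _ , W , st ◅ r
      hole-back (suc i) zero H V r with H i 0 <? 2 * suc i
      ... | no U≮ with undown i 0 H V (≮⇒≥ U≮) (λ ())
      ...   | W , st = hole-back i zero _ W (st ◅ r)
      hole-back (suc i) zero H V r | yes U< with uncancel (suc i) 0 H V (λ ()) U<
      ...   | W , st = _ , _ , _ , W , st ◅ r
      hole-back (suc i) (suc j) H V r = hole-case i j H V r (hole-back (suc i) j) (hole-back i (suc j))

      back : ∀ {t} → BumpRun t → ∃ λ c₀ → ∃ λ G₀ → Valid μ (bump 0 c₀ G₀) × Star Step (bump 0 c₀ G₀) t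
      back (k , c , G , V , r) = bump-back k c G V r

  -- Rows as lists continued by a default value

  entry : ℕ → List ℕ → ℕ → ℕ
  entry d []       j       = d
  entry d (x ∷ xs) zero    = x
  entry d (x ∷ xs) (suc j) = entry d xs j

  entry-out : ∀ d r {j} → length r ≤ j → entry d r j ≡ d
  entry-out d [] _ = refl
  entry-out d (x ∷ r) {suc j} le = entry-out d r (s≤s⁻¹ le)

  entry-in : ∀ d d' r {j} → j < length r → entry d r j ≡ entry d' r j
  entry-in d d' (x ∷ r) {zero} _ = refl
  entry-in d d' (x ∷ r) {suc j} lt = entry-in d d' r (s≤s⁻¹ lt)

  lookupL-just : ∀ d r j {v} → lookupL r j ≡ just v → j < length r × entry d r j ≡ v
  lookupL-just d (x ∷ r) zero refl = z<s , refl
  lookupL-just d (x ∷ r) (suc j) e with lookupL-just d r j e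
  ... | lt , eq = s<s lt , eq

  lookupL-nothing : ∀ r j → lookupL r j ≡ nothing → length r ≤ j
  lookupL-nothing [] j _ = z≤n
  lookupL-nothing (x ∷ r) (suc j) e = s≤s (lookupL-nothing r j e)

  length-setL : ∀ r j v → length (setL r j v) ≡ length r
  length-setL [] j v = refl
  length-setL (x ∷ r) zero v = refl
  length-setL (x ∷ r) (suc j) v = cong suc (length-setL r j v)

  entry-setL-same : ∀ d r {j} v → j < length r → entry d (setL r j v) j ≡ v
  entry-setL-same d (x ∷ r) {zero} v _ = refl
  entry-setL-same d (x ∷ r) {suc j} v lt = entry-setL-same d r v (s≤s⁻¹ lt)

  entry-setL-other : ∀ d r {j} v {y} → y ≢ j → entry d r y ≡ entry d (setL r j v) y
  entry-setL-other d [] v _ = refl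
  entry-setL-other d (x ∷ r) {zero} v {zero} ne = ⊥-elim (ne refl)
  entry-setL-other d (x ∷ r) {zero} v {suc y} ne = refl
  entry-setL-other d (x ∷ r) {suc j} v {zero} ne = refl
  entry-setL-other d (x ∷ r) {suc j} v {suc y} ne = entry-setL-other d r v (ne ∘ cong suc)

  entry-append : ∀ d r c → entry d (r ++ c ∷ []) (length r) ≡ c
  entry-append d [] c = refl
  entry-append d (x ∷ r) c = entry-append d r c

  entry-append-other : ∀ d r c {y} → y ≢ length r → entry d r y ≡ entry d (r ++ c ∷ []) y
  entry-append-other d [] c {zero} ne = ⊥-elim (ne refl)
  entry-append-other d [] c {suc y} ne = refl
  entry-append-other d (x ∷ r) c {zero} ne = refl
  entry-append-other d (x ∷ r) c {suc y} ne = entry-append-other d r c (ne ∘ cong suc)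

  length-dropLastL : ∀ x r → length (dropLastL (x ∷ r)) ≡ length r
  length-dropLastL x [] = refl
  length-dropLastL x (y ∷ r) = cong suc (length-dropLastL y r)

  entry-dropLastL : ∀ d x r {y} → y ≢ length r → entry d (x ∷ r) y ≡ entry d (dropLastL (x ∷ r)) y
  entry-dropLastL d x [] {zero} ne = ⊥-elim (ne refl)
  entry-dropLastL d x [] {suc y} ne = refl
  entry-dropLastL d x (z ∷ r) {zero} ne = refl
  entry-dropLastL d x (z ∷ r) {suc y} ne = entry-dropLastL d z r (ne ∘ cong suc)

  entry-injective : ∀ {d} r r' → length r ≡ length r' → (∀ j → entry d r j ≡ entry d r' j) → r ≡ r'
  entry-injective [] [] _ _ = refl
  entry-injective (x ∷ r) (y ∷ r') e eq = cong₂ _∷_ (eq 0) (entry-injective r r' (suc-injective e) (eq ∘ suc))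

  rowAt-setRow-same : ∀ T {k} r → k ≤ length T → rowAt (setRow T k r) k ≡ r
  rowAt-setRow-same [] {zero} r _ = refl
  rowAt-setRow-same (s ∷ T) {zero} r _ = refl
  rowAt-setRow-same (s ∷ T) {suc k} r le = rowAt-setRow-same T r (s≤s⁻¹ le)

  rowAt-setRow-other : ∀ T {k x} r → k ≤ length T → x ≢ k → rowAt (setRow T k r) x ≡ rowAt T x
  rowAt-setRow-other [] {zero} {zero} r _ ne = ⊥-elim (ne refl)
  rowAt-setRow-other [] {zero} {suc x} r _ ne = refl
  rowAt-setRow-other (s ∷ T) {zero} {zero} r _ ne = ⊥-elim (ne refl)
  rowAt-setRow-other (s ∷ T) {zero} {suc x} r _ ne = refl
  rowAt-setRow-other (s ∷ T) {suc k} {zero} r _ ne = refl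
  rowAt-setRow-other (s ∷ T) {suc k} {suc x} r le ne = rowAt-setRow-other T r (s≤s⁻¹ le) (ne ∘ cong suc)

  partAt-shape : ∀ T x → partAt (shape T) x ≡ length (rowAt T x)
  partAt-shape [] x = refl
  partAt-shape (r ∷ T) zero = refl
  partAt-shape (r ∷ T) (suc x) = partAt-shape T x

  nonempty-row : ∀ T {x y} → y < length (rowAt T x) → x < length T
  nonempty-row (r ∷ T) {zero} _ = z<s
  nonempty-row (r ∷ T) {suc x} lt = s<s (nonempty-row T lt)

  shape-setRow : ∀ T {k} r → k < length T → length r ≡ length (rowAt T k) → shape (setRow T k r) ≡ shape T
  shape-setRow (s ∷ T) {zero} r _ e = cong (_∷ shape T) e
  shape-setRow (s ∷ T) {suc k} r lt e = cong (length s ∷_) (shape-setRow T r (s≤s⁻¹ lt) e)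

  -- Boolean tests and the inequalities they decide

  ∧-true : ∀ {a b} → a ∧ b ≡ true → a ≡ true × b ≡ true
  ∧-true {true} {true} _ = refl , refl

  ≤ᵇ-true : ∀ {m k} → (m ≤ᵇ k) ≡ true → m ≤ k
  ≤ᵇ-true {m} {k} e = ≤ᵇ⇒≤ m k (subst T (sym e) tt)

  <ᵇ-true : ∀ {m k} → (m <ᵇ k) ≡ true → m < k
  <ᵇ-true {m} {k} e = <ᵇ⇒< m k (subst T (sym e) tt)

  T-true : ∀ {b} → T b → b ≡ true
  T-true {true} _ = refl

  true-≤ᵇ : ∀ {m k} → m ≤ k → (m ≤ᵇ k) ≡ true
  true-≤ᵇ le = T-true (≤⇒≤ᵇ le)

  true-<ᵇ : ∀ {m k} → m < k → (m <ᵇ k) ≡ true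
  true-<ᵇ lt = T-true (<⇒<ᵇ lt)

  partAt-antitone-suc : ∀ μ → decreasingB μ ≡ true → ∀ x → partAt μ (suc x) ≤ partAt μ x
  partAt-antitone-suc [] _ x = z≤n
  partAt-antitone-suc (p ∷ []) _ x = z≤n
  partAt-antitone-suc (p ∷ q ∷ μ) e zero = ≤ᵇ-true (proj₁ (∧-true e))
  partAt-antitone-suc (p ∷ q ∷ μ) e (suc x) = partAt-antitone-suc (q ∷ μ) (proj₂ (∧-true {q ≤ᵇ p} e)) x

  antitone : ∀ (f : ℕ → ℕ) → (∀ x → f (suc x) ≤ f x) → ∀ {x x'} → x ≤ x' → f x' ≤ f x
  antitone f st {x} {x'} le with m≤n⇒m<n∨m≡n le
  ... | inj₂ refl = ≤-refl
  antitone f st {x} {suc x'} le | inj₁ lt = ≤-trans (st x') (antitone f st (s≤s⁻¹ lt))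

  monotone : ∀ (f : ℕ → ℕ) → (∀ x → f x ≤ f (suc x)) → ∀ {x x'} → x ≤ x' → f x ≤ f x'
  monotone f st {x} {x'} le with m≤n⇒m<n∨m≡n le
  ... | inj₂ refl = ≤-refl
  monotone f st {x} {suc x'} le | inj₁ lt = ≤-trans (monotone f st (s≤s⁻¹ lt)) (st x')

  partition-antitone : ∀ μ → isPartition μ ≡ true → ∀ {x x'} → x ≤ x' → partAt μ x' ≤ partAt μ x
  partition-antitone μ e = antitone (partAt μ) (partAt-antitone-suc μ (proj₁ (∧-true e)))

  RowIncr : List ℕ → Set
  RowIncr r = ∀ y → suc y < length r → entry 0 r y ≤ entry 0 r (suc y)

  ColIncr : List ℕ → List ℕ → Set
  ColIncr r s = ∀ y → y < length r → y < length s → entry 0 r y < entry 0 s y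

  rowIncr⇒ : ∀ r → rowIncrB r ≡ true → RowIncr r
  rowIncr⇒ (a ∷ []) e y (s≤s ())
  rowIncr⇒ (a ∷ b ∷ r) e zero _ = ≤ᵇ-true (proj₁ (∧-true e))
  rowIncr⇒ (a ∷ b ∷ r) e (suc y) lt = rowIncr⇒ (b ∷ r) (proj₂ (∧-true {a ≤ᵇ b} e)) y (s≤s⁻¹ lt)

  rowIncr⇐ : ∀ r → RowIncr r → rowIncrB r ≡ true
  rowIncr⇐ [] f = refl
  rowIncr⇐ (a ∷ []) f = refl
  rowIncr⇐ (a ∷ b ∷ r) f = cong₂ _∧_ (true-≤ᵇ (f 0 (s<s z<s))) (rowIncr⇐ (b ∷ r) λ y lt → f (suc y) (s<s lt))

  colIncr⇒ : ∀ r s → colPairB r s ≡ true → ColIncr r s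
  colIncr⇒ (a ∷ r) (b ∷ s) e zero _ _ = <ᵇ-true (proj₁ (∧-true e))
  colIncr⇒ (a ∷ r) (b ∷ s) e (suc y) lt lt' = colIncr⇒ r s (proj₂ (∧-true {a <ᵇ b} e)) y (s≤s⁻¹ lt) (s≤s⁻¹ lt')

  colIncr⇐ : ∀ r s → ColIncr r s → colPairB r s ≡ true
  colIncr⇐ [] s f = refl
  colIncr⇐ (a ∷ r) [] f = refl
  colIncr⇐ (a ∷ r) (b ∷ s) f = cong₂ _∧_ (true-<ᵇ (f 0 z<s z<s)) (colIncr⇐ r s λ y lt lt' → f (suc y) (s<s lt) (s<s lt'))

  allRows⇒ : ∀ U → allB rowIncrB U ≡ true → ∀ x → RowIncr (rowAt U x)
  allRows⇒ [] e x y ()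
  allRows⇒ (r ∷ U) e zero = rowIncr⇒ r (proj₁ (∧-true e))
  allRows⇒ (r ∷ U) e (suc x) = allRows⇒ U (proj₂ (∧-true {rowIncrB r} e)) x

  allRows⇐ : ∀ U → (∀ x → RowIncr (rowAt U x)) → allB rowIncrB U ≡ true
  allRows⇐ [] f = refl
  allRows⇐ (r ∷ U) f = cong₂ _∧_ (rowIncr⇐ r (f 0)) (allRows⇐ U (f ∘ suc))

  allCols⇒ : ∀ U → colStrictB U ≡ true → ∀ x → ColIncr (rowAt U x) (rowAt U (suc x))
  allCols⇒ [] e x y ()
  allCols⇒ (r ∷ []) e zero y _ ()
  allCols⇒ (r ∷ s ∷ U) e zero = colIncr⇒ r s (proj₁ (∧-true e))
  allCols⇒ (r ∷ []) e (suc x) y _ ()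
  allCols⇒ (r ∷ s ∷ U) e (suc x) = allCols⇒ (s ∷ U) (proj₂ (∧-true {colPairB r s} e)) x

  allCols⇐ : ∀ U → (∀ x → ColIncr (rowAt U x) (rowAt U (suc x))) → colStrictB U ≡ true
  allCols⇐ [] f = refl
  allCols⇐ (r ∷ []) f = refl
  allCols⇐ (r ∷ s ∷ U) f = cong₂ _∧_ (colIncr⇐ r s (f 0)) (allCols⇐ (s ∷ U) (f ∘ suc))

  Range : ℕ → ℕ → List ℕ → Set
  Range n k r = ∀ y → y < length r → 2 * k ≤ entry 0 r y × entry 0 r y < 2 * n

  range⇒ : ∀ n k r → allB (λ e → (2 * k ≤ᵇ e) ∧ (e <ᵇ 2 * n)) r ≡ true → Range n k r
  range⇒ n k (a ∷ r) e zero _ with ∧-true (proj₁ (∧-true {(2 * k ≤ᵇ a) ∧ (a <ᵇ 2 * n)} e))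
  ... | p , q = ≤ᵇ-true p , <ᵇ-true q
  range⇒ n k (a ∷ r) e (suc y) lt = range⇒ n k r (proj₂ (∧-true {(2 * k ≤ᵇ a) ∧ (a <ᵇ 2 * n)} e)) y (s≤s⁻¹ lt)

  range⇐ : ∀ n k r → Range n k r → allB (λ e → (2 * k ≤ᵇ e) ∧ (e <ᵇ 2 * n)) r ≡ true
  range⇐ n k [] f = refl
  range⇐ n k (a ∷ r) f = cong₂ _∧_ (cong₂ _∧_ (true-≤ᵇ (proj₁ (f 0 z<s))) (true-<ᵇ (proj₂ (f 0 z<s))))
    (range⇐ n k r λ y lt → f (suc y) (s<s lt))

  allRange⇒ : ∀ n k U → rowCondFrom n k U ≡ true → ∀ x → Range n (k + x) (rowAt U x)
  allRange⇒ n k [] e x y ()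
  allRange⇒ n k (r ∷ U) e zero = subst (λ m → Range n m r) (sym (+-identityʳ k)) (range⇒ n k r (proj₁ (∧-true e)))
  allRange⇒ n k (r ∷ U) e (suc x) = subst (λ m → Range n m (rowAt U x)) (sym (+-suc k x))
    (allRange⇒ n (suc k) U (proj₂ (∧-true {allB (λ e → (2 * k ≤ᵇ e) ∧ (e <ᵇ 2 * n)) r} e)) x)

  allRange⇐ : ∀ n k U → (∀ x → Range n (k + x) (rowAt U x)) → rowCondFrom n k U ≡ true
  allRange⇐ n k [] f = refl
  allRange⇐ n k (r ∷ U) f = cong₂ _∧_
    (range⇐ n k r (subst (λ m → Range n m r) (+-identityʳ k) (f 0)))
    (allRange⇐ n (suc k) U λ x → subst (λ m → Range n m (rowAt U x)) (+-suc k x) (f (suc x)))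

  -- Passage between tableaux and grids

  module _ (n : ℕ) where
    open Insertion n

    ext : Tableau → Grid
    ext U x y = entry (out x) (rowAt U x) y

    SemiStdᵗ : Tableau → Set
    SemiStdᵗ U = SemiStd Anywhere (partAt (shape U)) (ext U)

    ext-in : ∀ U {x y} → y < length (rowAt U x) → ext U x y ≡ entry 0 (rowAt U x) y
    ext-in U {x} lt = entry-in _ 0 (rowAt U x) lt

    ext-out : ∀ U {x y} → length (rowAt U x) ≤ y → ext U x y ≡ out x
    ext-out U {x} le = entry-out _ (rowAt U x) le

    symplectic⇒semiStd : ∀ U → isPartition (shape U) ≡ true → isSymplectic n U ≡ true → SemiStdᵗ U
    symplectic⇒semiStd U part e = record
      { row = λ {x} _ _ → monotone (ext U x) (rw x)
      ; col = λ {x} {x'} {y} {y'} _ _ lt le → ≤-trans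
          (≤-trans (cl x y) (monotone (λ z → ext U z y) (λ z → <⇒≤ (cl z y)) lt)) (monotone (ext U x') (rw x') le)
      ; low = λ {x} {y} _ → lo x y
      ; inside = λ {x} {y} _ lt → ins x y (subst (y <_) (partAt-shape U x) lt)
      ; outside = λ {x} {y} _ le → ext-out U (subst (_≤ y) (partAt-shape U x) le)
      }
      where
      rows = ∧-true {allB rowIncrB U} e
      cols = ∧-true {colStrictB U} (proj₂ rows)
      rng : ∀ x → Range n x (rowAt U x)
      rng = allRange⇒ n 0 U (proj₂ cols)
      ins : ∀ x y → y < length (rowAt U x) → ext U x y < 2 * n
      ins x y lt = subst (_< 2 * n) (sym (ext-in U lt)) (proj₂ (rng x y lt))
      lo : ∀ x y → 2 * x ≤ ext U x y
      lo x y with y <? length (rowAt U x)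
      ... | yes lt = subst (2 * x ≤_) (sym (ext-in U lt)) (proj₁ (rng x y lt))
      ... | no ge = subst (2 * x ≤_) (sym (ext-out U (≮⇒≥ ge))) (2x≤out x)
      rw : ∀ x y → ext U x y ≤ ext U x (suc y)
      rw x y with suc y <? length (rowAt U x)
      ... | yes lt = subst₂ _≤_ (sym (ext-in U (<-trans (n<1+n y) lt))) (sym (ext-in U lt))
                       (allRows⇒ U (proj₁ rows) x y lt)
      ... | no ge with y <? length (rowAt U x)
      ...   | yes lt = ≤-trans (<⇒≤ (ins x y lt)) (≤-trans (2n≤out x) (≤-reflexive (sym (ext-out U (≮⇒≥ ge)))))
      ...   | no ge' = ≤-reflexive (trans (ext-out U (≮⇒≥ ge')) (sym (ext-out U (≮⇒≥ ge))))
      cl : ∀ x y → ext U x y < ext U (suc x) y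
      cl x y with y <? length (rowAt U x) | y <? length (rowAt U (suc x))
      ... | yes lt | yes lt' = subst₂ _<_ (sym (ext-in U lt)) (sym (ext-in U lt')) (allCols⇒ U (proj₁ cols) x y lt lt')
      ... | yes lt | no ge' = <-≤-trans (ins x y lt) (≤-trans (2n≤out (suc x)) (≤-reflexive (sym (ext-out U (≮⇒≥ ge')))))
      ... | no ge | no ge' = subst₂ _<_ (sym (ext-out U (≮⇒≥ ge))) (sym (ext-out U (≮⇒≥ ge'))) (out-< (n<1+n x))
      -- A cell with nothing above it would make the lower row longer; the shape being a partition
      -- excludes this.
      ... | no ge | yes lt' = ⊥-elim (ge (≤-trans lt' (subst₂ _≤_ (partAt-shape U (suc x)) (partAt-shape U x)
                                (partition-antitone (shape U) part (n≤1+n x)))))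

    semiStd⇒symplectic : ∀ U → SemiStdᵗ U → isSymplectic n U ≡ true
    semiStd⇒symplectic U S = cong₂ _∧_
      (allRows⇐ U λ x y lt → subst₂ _≤_ (ext-in U (<-trans (n<1+n y) lt)) (ext-in U lt) (row S tt tt (n≤1+n y)))
      (cong₂ _∧_
        (allCols⇐ U λ x y lt lt' → subst₂ _<_ (ext-in U lt) (ext-in U lt') (col S tt tt (n<1+n x) ≤-refl))
        (allRange⇐ n 0 U λ x y lt → subst (2 * x ≤_) (ext-in U lt) (low S tt) ,
          subst (_< 2 * n) (ext-in U lt) (inside S tt (subst (y <_) (sym (partAt-shape U x)) lt))))

    ext-injective : ∀ U V → shape U ≡ shape V → (∀ x y → ext U x y ≡ ext V x y) → U ≡ V
    ext-injective U V = go out U V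
      where
      go : ∀ d U V → shape U ≡ shape V → (∀ x y → entry (d x) (rowAt U x) y ≡ entry (d x) (rowAt V x) y) → U ≡ V
      go d [] [] _ _ = refl
      go d (r ∷ U) (s ∷ V) e eq = cong₂ _∷_ (entry-injective r s (∷-injectiveˡ e) (eq 0))
        (go (d ∘ suc) U V (∷-injectiveʳ e) (eq ∘ suc))

    fill : Partition → Grid → Tableau
    fill [] G = []
    fill (p ∷ μ) G = map (G 0) (upTo p) ∷ fill μ (G ∘ suc)

    shape-fill : ∀ μ G → shape (fill μ G) ≡ μ
    shape-fill [] G = refl
    shape-fill (p ∷ μ) G = cong₂ _∷_ (trans (length-map (G 0) (upTo p)) (length-upTo p)) (shape-fill μ (G ∘ suc))

    entry-map-upTo : ∀ d (f : ℕ → ℕ) p → (∀ y → p ≤ y → f y ≡ d) → ∀ y → entry d (map f (upTo p)) y ≡ f y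
    entry-map-upTo d f zero o y = sym (o y z≤n)
    entry-map-upTo d f (suc p) o zero = refl
    entry-map-upTo d f (suc p) o (suc y) = trans
      (cong (λ r → entry d r y) (map-upTo-suc f p)) (entry-map-upTo d (f ∘ suc) p (λ y le → o (suc y) (s≤s le)) y)
      where
      map-upTo-suc : ∀ f p → map f (applyUpTo suc p) ≡ map (f ∘ suc) (upTo p)
      map-upTo-suc f p = trans (map-applyUpTo suc f p) (sym (map-upTo (f ∘ suc) p))

    ext-fill : ∀ μ G → SemiStd Anywhere (partAt μ) G → ∀ x y → ext (fill μ G) x y ≡ G x y
    ext-fill μ G S = go out μ G (λ x y → outside S tt)
      where
      go : ∀ d μ G → (∀ x y → partAt μ x ≤ y → G x y ≡ d x) → ∀ x y → entry (d x) (rowAt (fill μ G) x) y ≡ G x y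
      go d [] G o x y = sym (o x y z≤n)
      go d (p ∷ μ) G o zero y = entry-map-upTo (d 0) (G 0) p (o 0) y
      go d (p ∷ μ) G o (suc x) y = go (d ∘ suc) μ (G ∘ suc) (λ x → o (suc x)) x y

  -- Partitions and adjacency

  eqList⇒≡ : ∀ xs ys → eqList xs ys ≡ true → xs ≡ ys
  eqList⇒≡ [] [] _ = refl
  eqList⇒≡ (x ∷ xs) (y ∷ ys) e with ∧-true {x ≡ᵇ y} e
  ... | p , q = cong₂ _∷_ (≡ᵇ⇒≡ x y (subst T (sym p) tt)) (eqList⇒≡ xs ys q)

  eqList-refl : ∀ xs → eqList xs xs ≡ true
  eqList-refl [] = refl
  eqList-refl (x ∷ xs) = cong₂ _∧_ (T-true (≡⇒≡ᵇ x x refl)) (eqList-refl xs)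

  partAt-injective : ∀ μ ν → positiveB μ ≡ true → positiveB ν ≡ true → (∀ x → partAt μ x ≡ partAt ν x) → μ ≡ ν
  partAt-injective [] [] _ _ _ = refl
  partAt-injective [] (suc q ∷ ν) _ _ e with () ← e 0
  partAt-injective (suc p ∷ μ) [] _ _ e with () ← e 0
  partAt-injective (p ∷ μ) (q ∷ ν) pos pos' e =
    cong₂ _∷_ (e 0) (partAt-injective μ ν (proj₂ (∧-true {0 <ᵇ p} pos)) (proj₂ (∧-true {0 <ᵇ q} pos')) (e ∘ suc))

  partAt-drop : ∀ μ x → partAt (drop 1 μ) x ≡ partAt μ (suc x)
  partAt-drop [] x = refl
  partAt-drop (p ∷ μ) x = refl

  sum-drop : ∀ μ → sumℕ μ ≡ partAt μ 0 + sumℕ (drop 1 μ)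
  sum-drop [] = refl
  sum-drop (p ∷ μ) = refl

  _⊆_ : Partition → Partition → Set
  μ ⊆ ν = ∀ x → partAt μ x ≤ partAt ν x

  drop-⊆ˡ : ∀ μ {q ν} → μ ⊆ (q ∷ ν) → drop 1 μ ⊆ ν
  drop-⊆ˡ μ con x = subst (_≤ _) (sym (partAt-drop μ x)) (con (suc x))

  sum-mono : ∀ μ ν → μ ⊆ ν → sumℕ μ ≤ sumℕ ν
  sum-mono [] ν con = z≤n
  sum-mono (p ∷ μ) ν con = subst (p + sumℕ μ ≤_) (sym (sum-drop ν))
    (+-mono-≤ (con 0) (sum-mono μ (drop 1 ν) λ x → subst (_ ≤_) (sym (partAt-drop ν x)) (con (suc x))))

  ⊆-sum≥⇒≡ : ∀ μ ν → μ ⊆ ν → sumℕ ν ≤ sumℕ μ → ∀ x → partAt ν x ≡ partAt μ x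
  ⊆-sum≥⇒≡ μ [] con le x = sym (n≤0⇒n≡0 (con x))
  ⊆-sum≥⇒≡ μ (q ∷ ν) con le = λ
    { zero → q≡
    ; (suc x) → trans (⊆-sum≥⇒≡ (drop 1 μ) ν (drop-⊆ˡ μ con) tail≤ x) (partAt-drop μ x)
    }
    where
    le' : q + sumℕ ν ≤ partAt μ 0 + sumℕ (drop 1 μ)
    le' = subst (q + sumℕ ν ≤_) (sum-drop μ) le
    tail≤ : sumℕ ν ≤ sumℕ (drop 1 μ)
    tail≤ = +-cancelˡ-≤ q _ _ (≤-trans le' (+-monoˡ-≤ _ (con 0)))
    q≡ : q ≡ partAt μ 0
    q≡ = ≤-antisym (+-cancelʳ-≤ (sumℕ ν) _ _ (≤-trans le' (+-monoʳ-≤ (partAt μ 0) (sum-mono (drop 1 μ) ν (drop-⊆ˡ μ con))))) (con 0)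

  -- If the first parts differ, they already absorb the surplus of one, and the tails, contained
  -- with no sum left over, coincide. If they agree, the surplus lies in the tails.
  ⊆-sum-suc⇒AddBox : ∀ μ ν → μ ⊆ ν → sumℕ ν ≡ suc (sumℕ μ) → ∃ λ k → AddBox k (partAt μ) (partAt ν)
  ⊆-sum-suc⇒AddBox μ (q ∷ ν) con e with m≤n⇒m<n∨m≡n (con 0)
  ... | inj₁ p<q = 0 , q≡ , λ
    { zero ne → ⊥-elim (ne refl)
    ; (suc x) _ → trans (⊆-sum≥⇒≡ (drop 1 μ) ν (drop-⊆ˡ μ con) tail≤ x) (partAt-drop μ x)
    }
    where
    e' : q + sumℕ ν ≡ suc (partAt μ 0 + sumℕ (drop 1 μ))
    e' = trans e (cong suc (sum-drop μ))
    tail≤ : sumℕ ν ≤ sumℕ (drop 1 μ)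
    tail≤ = +-cancelˡ-≤ q _ _ (≤-trans (≤-reflexive e') (+-monoˡ-≤ _ p<q))
    q≡ : q ≡ suc (partAt μ 0)
    q≡ = ≤-antisym (+-cancelʳ-≤ (sumℕ ν) _ _ (≤-trans (≤-reflexive e') (+-monoʳ-≤ (suc (partAt μ 0)) (sum-mono (drop 1 μ) ν (drop-⊆ˡ μ con))))) p<q
  ... | inj₂ p≡q with ⊆-sum-suc⇒AddBox (drop 1 μ) ν (drop-⊆ˡ μ con)
                       (+-cancelˡ-≡ q _ _ (trans (trans e (cong suc (trans (sum-drop μ) (cong (_+ _) p≡q)))) (sym (+-suc q _))))
  ...   | k , νk , other = suc k , trans νk (cong suc (partAt-drop μ k)) ,
            λ { zero _ → sym p≡q ; (suc x) ne → trans (other x (ne ∘ cong suc)) (partAt-drop μ x) }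

  AddBox⇒⊆ : ∀ {k} μ ν → AddBox k (partAt μ) (partAt ν) → μ ⊆ ν
  AddBox⇒⊆ {k} μ ν (νk , other) x with x ≟ k
  ... | yes refl = ≤-trans (n≤1+n _) (≤-reflexive (sym νk))
  ... | no x≢ = ≤-reflexive (sym (other x x≢))

  sum-AddBox : ∀ k μ ν → AddBox k (partAt μ) (partAt ν) → sumℕ ν ≡ suc (sumℕ μ)
  sum-AddBox zero μ ν (νk , other) = trans (sum-drop ν) (trans (cong₂ _+_ νk sums) (cong suc (sym (sum-drop μ))))
    where
    tails : ∀ x → partAt (drop 1 ν) x ≡ partAt (drop 1 μ) x
    tails x = trans (partAt-drop ν x) (trans (other (suc x) λ ()) (sym (partAt-drop μ x)))
    sums : sumℕ (drop 1 ν) ≡ sumℕ (drop 1 μ)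
    sums = ≤-antisym (sum-mono (drop 1 ν) (drop 1 μ) (λ x → ≤-reflexive (tails x)))
             (sum-mono (drop 1 μ) (drop 1 ν) (λ x → ≤-reflexive (sym (tails x))))
  sum-AddBox (suc k) μ ν (νk , other) = trans (sum-drop ν) (trans (cong₂ _+_ (other 0 λ ())
    (sum-AddBox k (drop 1 μ) (drop 1 ν) (trans (partAt-drop ν k) (trans νk (cong suc (sym (partAt-drop μ k)))) ,
      λ x ne → trans (partAt-drop ν x) (trans (other (suc x) (ne ∘ suc-injective)) (sym (partAt-drop μ x))))))
    (trans (+-suc (partAt μ 0) _) (cong suc (sym (sum-drop μ)))))

  allB⇒ : ∀ {A : Set} (p : A → Bool) xs → allB p xs ≡ true → ∀ {x} → x ∈ xs → p x ≡ true
  allB⇒ p (x ∷ xs) e (here refl) = proj₁ (∧-true {p x} e)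
  allB⇒ p (x ∷ xs) e (there x∈) = allB⇒ p xs (proj₂ (∧-true {p x} e)) x∈

  allB⇐ : ∀ {A : Set} (p : A → Bool) xs → (∀ {x} → x ∈ xs → p x ≡ true) → allB p xs ≡ true
  allB⇐ p [] f = refl
  allB⇐ p (x ∷ xs) f = cong₂ _∧_ (f (here refl)) (allB⇐ p xs (f ∘ there))

  partAt-beyond : ∀ μ {x} → length μ ≤ x → partAt μ x ≡ 0
  partAt-beyond [] _ = refl
  partAt-beyond (p ∷ μ) {suc x} le = partAt-beyond μ (s≤s⁻¹ le)

  containedB⇒⊆ : ∀ μ ν → containedB μ ν ≡ true → μ ⊆ ν
  containedB⇒⊆ μ ν e x with x <? length μ
  ... | yes lt = ≤ᵇ-true (allB⇒ (λ i → partAt μ i ≤ᵇ partAt ν i) (upTo (length μ)) e (∈-upTo⁺ lt))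
  ... | no ge = subst (_≤ _) (sym (partAt-beyond μ (≮⇒≥ ge))) z≤n

  ⊆⇒containedB : ∀ μ ν → μ ⊆ ν → containedB μ ν ≡ true
  ⊆⇒containedB μ ν con = allB⇐ (λ i → partAt μ i ≤ᵇ partAt ν i) (upTo (length μ)) λ {x} _ → true-≤ᵇ (con x)

  Adjacent : Partition → Partition → Set
  Adjacent μ ν = (∃ λ k → AddBox k (partAt μ) (partAt ν)) ⊎ (∃ λ k → AddBox k (partAt ν) (partAt μ))

  adjacentB⇒ : ∀ μ ν → adjacentB μ ν ≡ true → Adjacent μ ν
  adjacentB⇒ μ ν e with containedB μ ν ∧ (sumℕ ν ≡ᵇ suc (sumℕ μ)) in p
  ... | true = inj₁ (⊆-sum-suc⇒AddBox μ ν (containedB⇒⊆ μ ν (proj₁ (∧-true p)))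
                 (≡ᵇ⇒≡ _ _ (subst T (sym (proj₂ (∧-true {containedB μ ν} p))) tt)))
  ... | false = inj₂ (⊆-sum-suc⇒AddBox ν μ (containedB⇒⊆ ν μ (proj₁ (∧-true e)))
                 (≡ᵇ⇒≡ _ _ (subst T (sym (proj₂ (∧-true {containedB ν μ} e))) tt)))

  AddBox⇒B : ∀ {k} μ ν → AddBox k (partAt μ) (partAt ν) → containedB μ ν ∧ (sumℕ ν ≡ᵇ suc (sumℕ μ)) ≡ true
  AddBox⇒B {k} μ ν box = cong₂ _∧_ (⊆⇒containedB μ ν (AddBox⇒⊆ μ ν box)) (T-true (≡⇒≡ᵇ _ _ (sum-AddBox k μ ν box)))

  adjacentB⇐ : ∀ μ ν → Adjacent μ ν → adjacentB μ ν ≡ true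
  adjacentB⇐ μ ν (inj₁ (k , box)) rewrite AddBox⇒B μ ν box = refl
  adjacentB⇐ μ ν (inj₂ (k , box)) rewrite AddBox⇒B ν μ box = ∨-zeroʳ (containedB μ ν ∧ (sumℕ ν ≡ᵇ suc (sumℕ μ)))

  -- Enumerations without repetition

  words-suc : ∀ L k → words L (suc k) ≡ cartesianProductWith _∷_ L (words L k)
  words-suc L k = go L
    where
    go : ∀ M → concatMap (λ x → map (x ∷_) (words L k)) M ≡ cartesianProductWith _∷_ M (words L k)
    go [] = refl
    go (x ∷ M) = cong (map (x ∷_) (words L k) ++_) (go M)

  fillings-∷ : ∀ n p μ → fillings n (p ∷ μ) ≡ cartesianProductWith _∷_ (words (alphabet n) p) (fillings n μ)
  fillings-∷ n p μ = go (words (alphabet n) p)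
    where
    go : ∀ M → concatMap (λ r → map (r ∷_) (fillings n μ)) M ≡ cartesianProductWith _∷_ M (fillings n μ)
    go [] = refl
    go (x ∷ M) = cong (map (x ∷_) (fillings n μ) ++_) (go M)

  words-unique : ∀ {L} → Unique L → ∀ k → Unique (words L k)
  words-unique u zero = [] ∷ []
  words-unique {L} u (suc k) = subst Unique (sym (words-suc L k)) (cartesianProductWith⁺ _∷_ ∷-injective u (words-unique u k))

  fillings-unique : ∀ n μ → Unique (fillings n μ)
  fillings-unique n [] = [] ∷ []
  fillings-unique n (p ∷ μ) = subst Unique (sym (fillings-∷ n p μ))
    (cartesianProductWith⁺ _∷_ ∷-injective (words-unique (upTo⁺ (2 * n)) p) (fillings-unique n μ))

  words-length : ∀ L k {v} → v ∈ words L k → length v ≡ k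
  words-length L zero (here refl) = refl
  words-length L (suc k) {v} v∈ with ∈-cartesianProductWith⁻ _∷_ L (words L k) (subst (v ∈_) (words-suc L k) v∈)
  ... | x , u , _ , u∈ , refl = cong suc (words-length L k u∈)

  ∈-words : ∀ n v → (∀ y → y < length v → entry 0 v y < 2 * n) → v ∈ words (alphabet n) (length v)
  ∈-words n [] f = here refl
  ∈-words n (x ∷ v) f = subst (x ∷ v ∈_) (sym (words-suc (alphabet n) (length v)))
    (∈-cartesianProductWith⁺ _∷_ (∈-upTo⁺ (f 0 z<s)) (∈-words n v λ y lt → f (suc y) (s<s lt)))

  fillings-shape : ∀ n μ {U} → U ∈ fillings n μ → shape U ≡ μ
  fillings-shape n [] (here refl) = refl
  fillings-shape n (p ∷ μ) {U} U∈ with ∈-cartesianProductWith⁻ _∷_ (words (alphabet n) p) (fillings n μ) (subst (U ∈_) (fillings-∷ n p μ) U∈)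
  ... | r , V , r∈ , V∈ , refl = cong₂ _∷_ (words-length (alphabet n) p r∈) (fillings-shape n μ V∈)

  ∈-fillings : ∀ n U → (∀ x y → y < length (rowAt U x) → entry 0 (rowAt U x) y < 2 * n) → U ∈ fillings n (shape U)
  ∈-fillings n [] f = here refl
  ∈-fillings n (r ∷ U) f = subst (r ∷ U ∈_) (sym (fillings-∷ n (length r) (shape U)))
    (∈-cartesianProductWith⁺ _∷_ (∈-words n r (f 0)) (∈-fillings n U (f ∘ suc)))

  ∈-filterB⁺ : ∀ {A : Set} (p : A → Bool) xs {x} → x ∈ xs → p x ≡ true → x ∈ filterB p xs
  ∈-filterB⁺ p (x ∷ xs) (here refl) e rewrite e = here refl
  ∈-filterB⁺ p (y ∷ xs) (there x∈) e with p y
  ... | true = there (∈-filterB⁺ p xs x∈ e)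
  ... | false = ∈-filterB⁺ p xs x∈ e

  ∈-filterB⁻ : ∀ {A : Set} (p : A → Bool) xs {x} → x ∈ filterB p xs → x ∈ xs × p x ≡ true
  ∈-filterB⁻ p (y ∷ xs) x∈ with p y in eq
  ∈-filterB⁻ p (y ∷ xs) (here refl) | true = here refl , eq
  ∈-filterB⁻ p (y ∷ xs) (there x∈) | true with ∈-filterB⁻ p xs x∈
  ... | x∈' , e = there x∈' , e
  ∈-filterB⁻ p (y ∷ xs) x∈ | false with ∈-filterB⁻ p xs x∈
  ... | x∈' , e = there x∈' , e

  filterB-unique : ∀ {A : Set} (p : A → Bool) {xs} → Unique xs → Unique (filterB p xs)
  filterB-unique p [] = []
  filterB-unique p {x ∷ xs} (x∉ ∷ u) with p x
  ... | true = All.tabulate (λ y∈ → All.lookup x∉ (proj₁ (∈-filterB⁻ p xs y∈))) ∷ filterB-unique p u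
  ... | false = filterB-unique p u

  -- Injectivity is asked on the list only, because `berele` is injective just for a fixed shape:
  -- inserting the letter 1 into the empty tableau or into the row 1, 1̄ gives the same result.
  map-unique : ∀ {A B : Set} (f : A → B) {xs} → (∀ {x y} → x ∈ xs → y ∈ xs → f x ≡ f y → x ≡ y) → Unique xs → Unique (map f xs)
  map-unique f inj [] = []
  map-unique f inj (x∉ ∷ u) =
    All.map⁺ (All.tabulate λ y∈ e → All.lookup x∉ y∈ (inj (here refl) (there y∈) e)) ∷
    map-unique f (λ x∈ y∈ → inj (there x∈) (there y∈)) u

  module _ (n : ℕ) where
    open Insertion n

    ∈-sympTableaux⁻ : ∀ μ {U} → isPartition μ ≡ true → U ∈ sympTableaux n μ → shape U ≡ μ × SemiStdᵗ n U
    ∈-sympTableaux⁻ μ {U} part U∈ with ∈-filterB⁻ (isSymplectic n) (fillings n μ) U∈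
    ... | U∈' , e with fillings-shape n μ U∈'
    ...   | refl = refl , symplectic⇒semiStd n U part e

    ∈-sympTableaux⁺ : ∀ U → SemiStdᵗ n U → U ∈ sympTableaux n (shape U)
    ∈-sympTableaux⁺ U S = ∈-filterB⁺ (isSymplectic n) (fillings n (shape U))
      (∈-fillings n U λ x y lt → subst (_< 2 * n) (ext-in n U lt) (inside S tt (subst (y <_) (sym (partAt-shape U x)) lt)))
      (semiStd⇒symplectic n U S)

    sympTableaux-unique : ∀ μ → Unique (sympTableaux n μ)
    sympTableaux-unique μ = filterB-unique (isSymplectic n) (fillings-unique n μ)

module Berele {c ℓ : Level} (R : CommutativeRing c ℓ) {n : ℕ} (a ainv : Fin n → CommutativeRing.Carrier R)
  (a*ainv : ∀ i → CommutativeRing._≈_ R (CommutativeRing._*_ R (a i) (ainv i)) (CommutativeRing.1# R)) where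

  open Combinatorics
  module R = CommutativeRing R

  -- Weights of letters, rows and tableaux

  module Weights where

    open import Algebra.Properties.CommutativeSemigroup R.*-commutativeSemigroup using (xy∙z≈xz∙y; xy∙z≈zy∙x)
    open import Data.Bool using (false)
    import Data.Fin as F
    open import Data.List using (List; []; _∷_; _++_; map; concat)
    open import Data.Nat using (zero; suc; _<_; s≤s⁻¹; _%_; _/_; _≡ᵇ_) renaming (_+_ to _ℕ+_; _*_ to _ℕ*_)
    open import Data.Nat.DivMod using ([m+kn]%n≡m%n; m*n%n≡0; m*n/n≡m; +-distrib-/)
    import Data.Nat.Properties as ℕ
    import Relation.Binary.PropositionalEquality as ≡
    open import Relation.Binary.Reasoning.Setoid R.setoid
    open R hiding (zero)
    open Sym R

    w : ℕ → Carrier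
    w = wt a ainv

    w⁻¹ : ℕ → Carrier
    w⁻¹ = wt ainv a

    atN-inverse : ∀ {m} (f g : Fin m → Carrier) → (∀ i → f i * g i ≈ 1#) → ∀ i → atN f i * atN g i ≈ 1#
    atN-inverse {zero} f g e i = *-identityˡ 1#
    atN-inverse {suc m} f g e zero = e F.zero
    atN-inverse {suc m} f g e (suc i) = atN-inverse (λ x → f (F.suc x)) (λ x → g (F.suc x)) (λ x → e (F.suc x)) i

    w*w⁻¹ : ∀ e → w e * w⁻¹ e ≈ 1#
    w*w⁻¹ e with (e % 2) ≡ᵇ 0
    ... | true  = atN-inverse a ainv a*ainv (e / 2)
    ... | false = atN-inverse ainv a (λ i → trans (*-comm _ _) (a*ainv i)) (e / 2)

    -- Each letter weight has the inverse obtained by exchanging `a` and `ainv`. This cancellation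
    -- replaces division by the weight of a stale letter.
    w-cancel : ∀ e {x y} → x * w e ≈ y * w e → x ≈ y
    w-cancel e {x} {y} eq = begin
      x                   ≈⟨ unit x ⟨
      x * w e * w⁻¹ e     ≈⟨ *-congʳ eq ⟩
      y * w e * w⁻¹ e     ≈⟨ unit y ⟩
      y                   ∎
      where
      unit : ∀ z → z * w e * w⁻¹ e ≈ z
      unit z = trans (*-assoc _ _ _) (trans (*-congˡ (w*w⁻¹ e)) (*-identityʳ z))

    odd/2 : ∀ k → suc (k ℕ* 2) / 2 ≡ k
    odd/2 k = ≡.trans (+-distrib-/ 1 (k ℕ* 2) (≡.subst (λ z → 1 ℕ+ z < 2) (≡.sym (m*n%n≡0 k 2)) (ℕ.n<1+n 1)))
      (m*n/n≡m k 2)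

    w-even : ∀ k → w (2 ℕ* k) ≡ atN a k
    w-even k rewrite ℕ.*-comm 2 k | m*n%n≡0 k 2 ⦃ _ ⦄ | m*n/n≡m k 2 ⦃ _ ⦄ = ≡.refl

    w-odd : ∀ k → w (suc (2 ℕ* k)) ≡ atN ainv k
    w-odd k rewrite ℕ.*-comm 2 k | [m+kn]%n≡m%n 1 k 2 ⦃ _ ⦄ | odd/2 k = ≡.refl

    w-pair : ∀ k → w (2 ℕ* k) * w (suc (2 ℕ* k)) ≈ 1#
    w-pair k rewrite w-even k | w-odd k = atN-inverse a ainv a*ainv k

    rowW : List ℕ → Carrier
    rowW r = prodR (map w r)

    W : Tableau → Carrier
    W = weightT a ainv

    rowW-++ : ∀ r s → rowW (r ++ s) ≈ rowW r * rowW s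
    rowW-++ [] s = sym (*-identityˡ _)
    rowW-++ (x ∷ r) s = trans (*-congˡ (rowW-++ r s)) (sym (*-assoc _ _ _))

    W-∷ : ∀ r U → W (r ∷ U) ≈ rowW r * W U
    W-∷ r U = rowW-++ r (concat U)

    -- Stated crosswise, with the old letter multiplying the new weight, so that no quotient of
    -- weights appears.
    rowW-setL : ∀ d r {j} v → j < length r → rowW (setL r j v) * w (entry d r j) ≈ rowW r * w v
    rowW-setL d (x ∷ r) {zero} v lt = xy∙z≈zy∙x (w v) (rowW r) (w x)
    rowW-setL d (x ∷ r) {suc j} v lt = trans (*-assoc _ _ _) (trans (*-congˡ (rowW-setL d r v (s≤s⁻¹ lt))) (sym (*-assoc _ _ _)))

    W-setT : ∀ d U {i j} v → j < length (rowAt U i) → W (setT U i j v) * w (entry d (rowAt U i) j) ≈ W U * w v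
    W-setT d (r ∷ U) {zero} {j} v lt = begin
      W (setL r j v ∷ U) * w (entry d r j)          ≈⟨ *-congʳ (W-∷ (setL r j v) U) ⟩
      rowW (setL r j v) * W U * w (entry d r j)     ≈⟨ xy∙z≈xz∙y _ _ _ ⟩
      rowW (setL r j v) * w (entry d r j) * W U     ≈⟨ *-congʳ (rowW-setL d r v lt) ⟩
      rowW r * w v * W U                         ≈⟨ xy∙z≈xz∙y _ _ _ ⟩
      rowW r * W U * w v                         ≈⟨ *-congʳ (W-∷ r U) ⟨
      W (r ∷ U) * w v                            ∎
    W-setT d (r ∷ U) {suc i} {j} v lt = begin
      W (r ∷ setT U i j v) * w (entry d (rowAt U i) j)       ≈⟨ *-congʳ (W-∷ r (setT U i j v)) ⟩
      rowW r * W (setT U i j v) * w (entry d (rowAt U i) j)  ≈⟨ *-assoc _ _ _ ⟩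
      rowW r * (W (setT U i j v) * w (entry d (rowAt U i) j)) ≈⟨ *-congˡ (W-setT d U v lt) ⟩
      rowW r * (W U * w v)                                ≈⟨ *-assoc _ _ _ ⟨
      rowW r * W U * w v                                  ≈⟨ *-congʳ (W-∷ r U) ⟨
      W (r ∷ U) * w v                                     ∎

    W-append : ∀ U {k} c → k ≤ length U → W (setRow U k (rowAt U k ++ c ∷ [])) ≈ W U * w c
    W-append [] {zero} c le = trans (*-comm _ _) refl
    W-append (r ∷ U) {zero} c le = begin
      W ((r ++ c ∷ []) ∷ U)           ≈⟨ W-∷ (r ++ c ∷ []) U ⟩
      rowW (r ++ c ∷ []) * W U        ≈⟨ *-congʳ (rowW-++ r (c ∷ [])) ⟩
      rowW r * (w c * 1#) * W U       ≈⟨ *-congʳ (*-congˡ (*-identityʳ _)) ⟩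
      rowW r * w c * W U              ≈⟨ xy∙z≈xz∙y _ _ _ ⟩
      rowW r * W U * w c              ≈⟨ *-congʳ (W-∷ r U) ⟨
      W (r ∷ U) * w c                 ∎
    W-append (r ∷ U) {suc k} c le = begin
      W (r ∷ setRow U k (rowAt U k ++ c ∷ []))            ≈⟨ W-∷ r (setRow U k (rowAt U k ++ c ∷ [])) ⟩
      rowW r * W (setRow U k (rowAt U k ++ c ∷ []))       ≈⟨ *-congˡ (W-append U c (s≤s⁻¹ le)) ⟩
      rowW r * (W U * w c)                                ≈⟨ *-assoc _ _ _ ⟨
      rowW r * W U * w c                                  ≈⟨ *-congʳ (W-∷ r U) ⟨
      W (r ∷ U) * w c                                     ∎

    rowW-dropLastL : ∀ d x r → rowW (dropLastL (x ∷ r)) * w (entry d (x ∷ r) (length r)) ≈ rowW (x ∷ r)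
    rowW-dropLastL d x [] = *-comm _ _
    rowW-dropLastL d x (y ∷ r) = trans (*-assoc _ _ _) (*-congˡ (rowW-dropLastL d y r))

    W-dropLastL : ∀ d U {i j} → length (rowAt U i) ≡ suc j →
      W (setRow U i (dropLastL (rowAt U i))) * w (entry d (rowAt U i) j) ≈ W U
    W-dropLastL d ((x ∷ r) ∷ U) {zero} ≡.refl = begin
      W (dropLastL (x ∷ r) ∷ U) * w (entry d (x ∷ r) (length r))          ≈⟨ *-congʳ (W-∷ (dropLastL (x ∷ r)) U) ⟩
      rowW (dropLastL (x ∷ r)) * W U * w (entry d (x ∷ r) (length r))     ≈⟨ xy∙z≈xz∙y _ _ _ ⟩
      rowW (dropLastL (x ∷ r)) * w (entry d (x ∷ r) (length r)) * W U     ≈⟨ *-congʳ (rowW-dropLastL d x r) ⟩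
      rowW (x ∷ r) * W U                                               ≈⟨ W-∷ (x ∷ r) U ⟨
      W ((x ∷ r) ∷ U)                                                  ∎
    W-dropLastL d (r ∷ U) {suc i} {j} e = begin
      W (r ∷ setRow U i (dropLastL (rowAt U i))) * w (entry d (rowAt U i) j)         ≈⟨ *-congʳ (W-∷ r (setRow U i (dropLastL (rowAt U i)))) ⟩
      rowW r * W (setRow U i (dropLastL (rowAt U i))) * w (entry d (rowAt U i) j)    ≈⟨ *-assoc _ _ _ ⟩
      rowW r * (W (setRow U i (dropLastL (rowAt U i))) * w (entry d (rowAt U i) j))  ≈⟨ *-congˡ (W-dropLastL d U e) ⟩
      rowW r * W U                                                                ≈⟨ W-∷ r U ⟨
      W (r ∷ U)                                                                   ∎

    concat-removeEmpty : ∀ U → concat (removeEmpty U) ≡ concat U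
    concat-removeEmpty [] = ≡.refl
    concat-removeEmpty ([] ∷ U) = concat-removeEmpty U
    concat-removeEmpty ((x ∷ r) ∷ U) = ≡.cong ((x ∷ r) ++_) (concat-removeEmpty U)

    W-removeEmpty : ∀ U → W (removeEmpty U) ≈ W U
    W-removeEmpty U = reflexive (≡.cong rowW (concat-removeEmpty U))

  -- Berele insertion on lists follows the elementary steps

  module Runs where

    open import Algebra.Properties.CommutativeSemigroup R.*-commutativeSemigroup using (xy∙z≈xz∙y; x∙yz≈xz∙y)
    open import Data.Bool using (Bool; false; _∧_; T)
    open import Data.Empty using (⊥-elim)
    open import Data.List using (List; []; _∷_; _++_; map; cartesianProduct)
    open import Data.List.Membership.Propositional using (_∈_)
    open import Data.List.Membership.Propositional.Properties using (∈-cartesianProduct⁺; ∈-cartesianProduct⁻; ∈-upTo⁺; ∈-upTo⁻; ∈-map⁺; ∈-map⁻)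
    open import Data.List.Membership.Propositional.Properties.WithK using (unique∧set⇒bag)
    open import Data.List.Properties using (length-++; length-map)
    open import Data.List.Relation.Binary.BagAndSetEquality using (∼bag⇒↭)
    open import Data.List.Relation.Binary.Permutation.Propositional using (_↭_)
    open import Data.List.Relation.Unary.Unique.Propositional.Properties using (cartesianProduct⁺; upTo⁺)
    open import Data.Maybe using (just; nothing)
    open import Data.Nat
    open import Data.Nat.Properties
    open import Data.Product using (_×_; _,_; proj₁; proj₂; ∃; ∃₂)
    open import Data.Sum using (inj₁; inj₂)
    open import Data.Unit using (tt)
    open import Function using (id; _∘_)
    open import Function.Bundles using (mk⇔)
    open import Relation.Binary.Construct.Closure.ReflexiveTransitive using (Star; ε; _◅_)
    open import Relation.Binary.PropositionalEquality using (_≢_; refl; sym; trans; cong; cong₂; subst; subst₂)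
    open import Relation.Binary.Reasoning.Setoid R.setoid
    open import Relation.Nullary using (¬_; yes; no; contradiction)
    open Insertion n
    open Weights

    positive-removeEmpty : ∀ U → positiveB (shape (removeEmpty U)) ≡ true
    positive-removeEmpty [] = refl
    positive-removeEmpty ([] ∷ U) = positive-removeEmpty U
    positive-removeEmpty ((x ∷ r) ∷ U) = positive-removeEmpty U

    empty-rows : ∀ U → (∀ x → length (rowAt U (suc x)) ≤ length (rowAt U x)) → length (rowAt U 0) ≤ 0 → ∀ x → rowAt U x ≡ []
    empty-rows U anti z x = empty (≤-trans (antitone (λ x → length (rowAt U x)) anti z≤n) z)
      where
      empty : ∀ {r : List ℕ} → length r ≤ 0 → r ≡ []
      empty {[]} _ = refl

    -- When row lengths decrease weakly, the empty rows are all at the bottom, so deleting them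
    -- shifts no other row.
    rowAt-removeEmpty : ∀ U → (∀ x → length (rowAt U (suc x)) ≤ length (rowAt U x)) →
      ∀ x → rowAt (removeEmpty U) x ≡ rowAt U x
    rowAt-removeEmpty [] anti x = refl
    rowAt-removeEmpty ([] ∷ U) anti zero = trans (rowAt-removeEmpty U (anti ∘ suc) 0) (empty-rows U (anti ∘ suc) (anti 0) 0)
    rowAt-removeEmpty ([] ∷ U) anti (suc x) = trans (rowAt-removeEmpty U (anti ∘ suc) (suc x))
      (trans (empty-rows U (anti ∘ suc) (anti 0) (suc x)) (sym (empty-rows U (anti ∘ suc) (anti 0) x)))
    rowAt-removeEmpty ((z ∷ r) ∷ U) anti zero = refl
    rowAt-removeEmpty ((z ∷ r) ∷ U) anti (suc x) = rowAt-removeEmpty U (anti ∘ suc) x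

    positive-append : ∀ U {k} r c → positiveB (shape U) ≡ true → positiveB (shape (setRow U k (r ++ c ∷ []))) ≡ true
    positive-append [] [] c _ = refl
    positive-append [] (_ ∷ _) c _ = refl
    positive-append ((_ ∷ _) ∷ U) {zero} [] c p = p
    positive-append ((_ ∷ _) ∷ U) {zero} (_ ∷ _) c p = p
    positive-append ((_ ∷ _) ∷ U) {suc k} r c p = positive-append U {k} r c p

    -- Each of the i rows above contributes at least one box, and row i contributes more than j.
    -- This bounds the number of slides.
    cell-bound : ∀ μ {i j} → positiveB μ ≡ true → j < partAt μ i → i + j < sumℕ μ
    cell-bound (p ∷ μ) {zero} pos lt = ≤-trans lt (m≤m+n p (sumℕ μ))
    cell-bound (p ∷ μ) {suc i} pos lt with ∧-true {0 <ᵇ p} pos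
    ... | p> , pos' = ≤-trans (s≤s (cell-bound μ pos' lt)) (+-monoˡ-≤ (sumℕ μ) (<ᵇ-true p>))

    firstGreaterFrom-nothing : ∀ d {c j} r → firstGreaterFrom c j r ≡ nothing → ∀ y → y < length r → entry d r y ≤ c
    firstGreaterFrom-nothing d {c} (x ∷ r) e y lt with c <ᵇ x in eq
    firstGreaterFrom-nothing d {c} (x ∷ r) e zero lt | false = ≮⇒≥ λ c<x → contradiction (trans (sym eq) (true-<ᵇ c<x)) λ ()
    firstGreaterFrom-nothing d {c} (x ∷ r) e (suc y) lt | false = firstGreaterFrom-nothing d r e y (s≤s⁻¹ lt)

    firstGreaterFrom-just : ∀ d {c j q b} r → firstGreaterFrom c j r ≡ just (q , b) →
      ∃ λ q' → q ≡ j + q' × q' < length r × entry d r q' ≡ b × c < b × (∀ y → y < q' → entry d r y ≤ c)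
    firstGreaterFrom-just d {c} {j} (x ∷ r) e with c <ᵇ x in eq
    firstGreaterFrom-just d {c} {j} (x ∷ r) refl | true = 0 , sym (+-identityʳ j) , z<s , refl , <ᵇ-true eq , λ _ ()
    ... | false with firstGreaterFrom-just d {c} {suc j} r e
    ...   | q' , e₁ , lt , e₂ , c<b , before = suc q' , trans e₁ (sym (+-suc j q')) , s<s lt , e₂ , c<b ,
            λ { zero _ → ≮⇒≥ λ c<x → contradiction (trans (sym eq) (true-<ᵇ c<x)) λ ()
              ; (suc y) y< → before y (s≤s⁻¹ y<) }

    Ext : Tableau → Grid
    Ext = ext n

    setT-agree : ∀ U {i j} v → i < length U → AgreeOff i j (Ext U) (Ext (setT U i j v))
    setT-agree U {i} {j} v i< x y z≢ with x ≟ i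
    ... | yes refl = trans (entry-setL-other (out i) (rowAt U i) v (λ e → z≢ (cong (i ,_) e)))
                       (cong (λ r → entry (out i) r y) (sym (rowAt-setRow-same U _ (<⇒≤ i<))))
    ... | no x≢i = cong (λ r → entry (out x) r y) (sym (rowAt-setRow-other U _ (<⇒≤ i<) x≢i))

    setT-same : ∀ U {i j} v → j < length (rowAt U i) → Ext (setT U i j v) i j ≡ v
    setT-same U {i} {j} v lt = trans (cong (λ r → entry (out i) r j) (rowAt-setRow-same U _ (<⇒≤ (nonempty-row U lt))))
      (entry-setL-same (out i) (rowAt U i) v lt)

    setT-shape : ∀ U {i j} v → j < length (rowAt U i) → shape (setT U i j v) ≡ shape U
    setT-shape U {i} {j} v lt = shape-setRow U _ (nonempty-row U lt) (length-setL (rowAt U i) j v)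

    -- The stored tableau still counts the stale letter in the hole. The invariant of a slide is
    -- therefore that its weight equals the true weight `total` times the weight of that letter.
    hole-weight : ∀ U i j v {x y total} → i < length U → j < length (rowAt U i) → (x , y) ≢ (i , j) →
      W U R.≈ total R.* w (Ext U i j) → v ≡ Ext U x y →
      W (setT U i j v) R.≈ total R.* w (Ext (setT U i j v) x y)
    hole-weight U i j v {x} {y} {total} i< j∈ z≢ wt≈ refl = w-cancel (Ext U i j) (begin
      W (setT U i j v) R.* w (Ext U i j)                        ≈⟨ W-setT (out i) U v j∈ ⟩
      W U R.* w v                                               ≈⟨ R.*-congʳ wt≈ ⟩
      total R.* w (Ext U i j) R.* w v                           ≈⟨ xy∙z≈xz∙y _ _ _ ⟩
      total R.* w v R.* w (Ext U i j)                           ≡⟨ cong (λ e → total R.* w e R.* w (Ext U i j)) (setT-agree U v i< x y z≢) ⟩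
      total R.* w (Ext (setT U i j v) x y) R.* w (Ext U i j)    ∎)

    -- Reads a final state as the tableau returned by the algorithm. In `removed` the state still
    -- lives on the larger shape `μ`, so the grids agree only off the deleted corner.
    data Result (μ : Partition) (total : R.Carrier) (U : Tableau) : State → Set ℓ where
      removed : ∀ {i j G} → 2 * n ≤ G i (suc j) → 2 * n ≤ G (suc i) j → AgreeOff i j G (Ext U) →
        AddBox i (partAt (shape U)) (partAt μ) → partAt (shape U) i ≡ j →
        positiveB (shape U) ≡ true → W U R.≈ total → Result μ total U (hole i j G)
      added : ∀ {k G} → (∀ x y → G x y ≡ Ext U x y) → AddBox k (partAt μ) (partAt (shape U)) →
        positiveB (shape U) ≡ true → W U R.≈ total → Result μ total U (fin k G)

    Outcome : Partition → R.Carrier → Tableau → State → Set ℓ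
    Outcome μ total U s = ∃ λ t → Star Step s t × Result μ total U t

    module _ {μ : Partition} (part : isPartition μ ≡ true) where

      anti : ∀ {x x'} → x ≤ x' → partAt μ x' ≤ partAt μ x
      anti = partition-antitone μ part

      rowLength : ∀ U → shape U ≡ μ → ∀ x → partAt μ x ≡ length (rowAt U x)
      rowLength U refl = partAt-shape U

      remove-corner : ∀ U i j {total G} → shape U ≡ μ → j < partAt μ i →
        length (rowAt U i) ≤ suc j → length (rowAt U (suc i)) ≤ j → W U R.≈ total R.* w (Ext U i j) →
        (∀ x y → G x y ≡ Ext U x y) →
        Result μ total (removeEmpty (setRow U i (dropLastL (rowAt U i)))) (hole i j G)
      remove-corner U i j {total} {G} sh j< r≤ d≤ wt≈ eG = removed
        (subst (2 * n ≤_) (sym (trans (eG i (suc j)) (entry-out _ (rowAt U i) r≤))) (2n≤out i))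
        (subst (2 * n ≤_) (sym (trans (eG (suc i) j) (entry-out _ (rowAt U (suc i)) d≤))) (2n≤out (suc i)))
        agree
        (trans (rowLength U sh i) (trans len (cong suc (sym lenV'))) ,
         λ x x≢i → trans (rowLength U sh x) (trans (cong length (sym (rowV-other x≢i))) (sym (lenV x))))
        lenV' (positive-removeEmpty V)
        (R.trans (W-removeEmpty V) (w-cancel (Ext U i j) (R.trans (W-dropLastL (out i) U len) wt≈)))
        where
        len : length (rowAt U i) ≡ suc j
        len = ≤-antisym r≤ (subst (j <_) (rowLength U sh i) j<)
        i< : i < length U
        i< = nonempty-row U (≤-reflexive (sym len))
        V = setRow U i (dropLastL (rowAt U i))
        rowV : rowAt V i ≡ dropLastL (rowAt U i)
        rowV = rowAt-setRow-same U _ (<⇒≤ i<)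
        rowV-other : ∀ {x} → x ≢ i → rowAt V x ≡ rowAt U x
        rowV-other = rowAt-setRow-other U _ (<⇒≤ i<)
        length-drop : ∀ r → length r ≡ suc j → length (dropLastL r) ≡ j
        length-drop (x ∷ r) e = trans (length-dropLastL x r) (suc-injective e)
        entry-drop : ∀ d r {y} → length r ≡ suc j → y ≢ j → entry d r y ≡ entry d (dropLastL r) y
        entry-drop d (x ∷ r) refl ne = entry-dropLastL d x r ne
        lenVi : length (rowAt V i) ≡ j
        lenVi = trans (cong length rowV) (length-drop (rowAt U i) len)
        antiU : ∀ x → length (rowAt U (suc x)) ≤ length (rowAt U x)
        antiU x = subst₂ _≤_ (rowLength U sh (suc x)) (rowLength U sh x) (anti (n≤1+n x))
        -- Only row i loses a box, and the row below has at most j boxes, so the lengths still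
        -- decrease weakly as `rowAt-removeEmpty` demands.
        antiV : ∀ x → length (rowAt V (suc x)) ≤ length (rowAt V x)
        antiV x with suc x ≟ i | x ≟ i
        ... | yes refl | yes e = ⊥-elim (1+n≢n (sym e))
        ... | yes refl | no x≢ = subst₂ _≤_ (sym lenVi) (cong length (sym (rowV-other x≢)))
                                   (≤-trans (n≤1+n j) (≤-trans (≤-reflexive (sym len)) (antiU x)))
        ... | no s≢ | yes refl = subst₂ _≤_ (cong length (sym (rowV-other s≢))) (sym lenVi) d≤
        ... | no s≢ | no x≢ = subst₂ _≤_ (cong length (sym (rowV-other s≢))) (cong length (sym (rowV-other x≢))) (antiU x)
        same : ∀ x → rowAt (removeEmpty V) x ≡ rowAt V x
        same = rowAt-removeEmpty V antiV
        lenV : ∀ x → partAt (shape (removeEmpty V)) x ≡ length (rowAt V x)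
        lenV x = trans (partAt-shape (removeEmpty V) x) (cong length (same x))
        lenV' : partAt (shape (removeEmpty V)) i ≡ j
        lenV' = trans (lenV i) lenVi
        agree : AgreeOff i j G (Ext (removeEmpty V))
        agree x y z≢ = trans (eG x y) (trans agreeV (cong (λ r → entry (out x) r y) (sym (same x))))
          where
          agreeV : Ext U x y ≡ Ext V x y
          agreeV with x ≟ i
          ... | yes refl = trans (entry-drop (out x) (rowAt U x) len (λ e → z≢ (cong (x ,_) e)))
                             (cong (λ r → entry (out x) r y) (sym rowV))
          ... | no x≢ = cong (λ r → entry (out x) r y) (sym (rowV-other x≢))

      right-run : ∀ U i j {total} → shape U ≡ μ → Valid (partAt μ) (hole i j (Ext U)) → suc j < length (rowAt U i) →
        Ext U i (suc j) < Ext U (suc i) j → W U R.≈ total R.* w (Ext U i j) →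
        let U' = setT U i j (Ext U i (suc j)) in
        Step (hole i j (Ext U)) (hole i (suc j) (Ext U')) × shape U' ≡ μ × W U' R.≈ total R.* w (Ext U' i (suc j))
      right-run U i j {total} sh V@(S , _) r∈ r<d wt≈ =
        rights r<d (inside S right≢ (subst (suc j <_) (sym (rowLength U sh i)) r∈)) (setT-same U r j∈)
          (λ x y z≢ _ → setT-agree U r (nonempty-row U j∈) x y z≢) ,
        trans (setT-shape U r j∈) sh ,
        hole-weight U i j r (nonempty-row U j∈) j∈ right≢ wt≈ refl
        where
        r = Ext U i (suc j)
        j∈ : j < length (rowAt U i)
        j∈ = <-trans (n<1+n j) r∈

      down-run : ∀ U i j {total} → shape U ≡ μ → Valid (partAt μ) (hole i j (Ext U)) →
        Ext U (suc i) j ≤ Ext U i (suc j) → W U R.≈ total R.* w (Ext U i j) →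
        let U' = setT U i j (Ext U (suc i) j) in
        Step (hole i j (Ext U)) (hole (suc i) j (Ext U')) × shape U' ≡ μ × W U' R.≈ total R.* w (Ext U' (suc i) j)
      down-run U i j {total} sh V@(S , j< , _) d≤r wt≈ =
        downs d≤r (setT-same U d j∈) (λ x y z≢ _ → setT-agree U d (nonempty-row U j∈) x y z≢) ,
        trans (setT-shape U d j∈) sh ,
        hole-weight U i j d (nonempty-row U j∈) j∈ down≢ wt≈ refl
        where
        d = Ext U (suc i) j
        j∈ : j < length (rowAt U i)
        j∈ = subst (j <_) (rowLength U sh i) j<

      -- Each slide trades one unit of fuel for one unit of `i + j`, which keeps the fuel bound.
      -- Running out would put the hole at a cell with `i + j` above the number of boxes, against
      -- `cell-bound`.
      jdt-run : ∀ f i j U {total} → shape U ≡ μ → Valid (partAt μ) (hole i j (Ext U)) → sumℕ μ < f + (i + j) →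
        W U R.≈ total R.* w (Ext U i j) → Outcome μ total (jdtF f i j U) (hole i j (Ext U))
      jdt-run zero i j U sh (S , j< , _) fuel _ = ⊥-elim (<⇒≱ fuel (<⇒≤
        (cell-bound μ (proj₂ (∧-true {decreasingB μ} part)) j<)))
      jdt-run (suc f) i j U {total} sh V@(S , j< , i<n , _) fuel wt≈ = slide
        where
        fuel-right : sumℕ μ < f + (i + suc j)
        fuel-right = subst (sumℕ μ <_) (trans (sym (+-suc f (i + j))) (cong (f +_) (sym (+-suc i j)))) fuel
        fuel-down : sumℕ μ < f + (suc i + j)
        fuel-down = subst (sumℕ μ <_) (sym (+-suc f (i + j))) fuel
        right : suc j < length (rowAt U i) → Ext U i (suc j) < Ext U (suc i) j →
          Outcome μ total (jdtF f i (suc j) (setT U i j (Ext U i (suc j)))) (hole i j (Ext U))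
        right r∈ r<d =
          let st , sh' , wt≈' = right-run U i j sh V r∈ r<d wt≈
              t , sts , res = jdt-run f i (suc j) _ sh' (step-valid anti V st) fuel-right wt≈'
          in t , st ◅ sts , res
        down : Ext U (suc i) j ≤ Ext U i (suc j) →
          Outcome μ total (jdtF f (suc i) j (setT U i j (Ext U (suc i) j))) (hole i j (Ext U))
        down d≤r =
          let st , sh' , wt≈' = down-run U i j sh V d≤r wt≈
              t , sts , res = jdt-run f (suc i) j _ sh' (step-valid anti V st) fuel-down wt≈'
          in t , st ◅ sts , res
        slide : Outcome μ total (jdtF (suc f) i j U) (hole i j (Ext U))
        slide with get U i (suc j) in er | get U (suc i) j in ed
        ... | just r | just d with lookupL-just (out i) (rowAt U i) (suc j) er | lookupL-just (out (suc i)) (rowAt U (suc i)) j ed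
        ...   | r∈ , refl | d∈ , refl with Ext U i (suc j) <ᵇ Ext U (suc i) j in cmp
        ...     | true  = right r∈ (<ᵇ-true cmp)
        ...     | false = down (≮⇒≥ λ r<d → contradiction (trans (sym cmp) (true-<ᵇ r<d)) λ ())
        slide | just r | nothing with lookupL-just (out i) (rowAt U i) (suc j) er
        ...   | r∈ , refl = right r∈ (<-≤-trans (inside S right≢ (subst (suc j <_) (sym (rowLength U sh i)) r∈))
                              (≤-trans (2n≤out (suc i)) (≤-reflexive (sym (entry-out _ (rowAt U (suc i)) (lookupL-nothing (rowAt U (suc i)) j ed))))))
        slide | nothing | just d with lookupL-just (out (suc i)) (rowAt U (suc i)) j ed
        ...   | d∈ , refl = down (≤-trans (<⇒≤ (inside S down≢ (subst (j <_) (sym (rowLength U sh (suc i))) d∈)))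
                              (≤-trans (2n≤out i) (≤-reflexive (sym (entry-out _ (rowAt U i) (lookupL-nothing (rowAt U i) (suc j) er))))))
        slide | nothing | nothing = hole i j (Ext U) , ε ,
          remove-corner U i j sh j< (lookupL-nothing (rowAt U i) (suc j) er) (lookupL-nothing (rowAt U (suc i)) j ed) wt≈ (λ _ _ → refl)

      -- The letter in flight counts towards `total`; a bump merely exchanges it with a letter of
      -- the tableau.
      ins-run : ∀ f k c U {total} → shape U ≡ μ → Valid (partAt μ) (bump k c (Ext U)) → length U < f + k →
        W U R.* w c R.≈ total → Outcome μ total (insF f k c U) (bump k c (Ext U))
      ins-run f k c U {total} sh V@(S , c< , lc , ab) fuel wt≈ = insert f fuel
        where
        -- The row above contains the place from which `c` was bumped, so the insertion row exists
        -- or is the first new one.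
        k≤ : k ≤ length U
        k≤ = go k ab
          where
          go : ∀ k → Above k c (Ext U) → k ≤ length U
          go zero _ = z≤n
          go (suc k) (p , lt , _) = nonempty-row U (subst (p <_) (rowLength U sh k) (inside⁻¹ S tt (<-trans lt c<)))
        insert : ∀ f → length U < f + k → Outcome μ total (insF f k c U) (bump k c (Ext U))
        insert zero fuel = ⊥-elim (<⇒≱ fuel k≤)
        insert (suc f) fuel with firstGreater c (rowAt U k) in eq
        ... | nothing = fin k (Ext U') , appends
                  (λ y y< → firstGreaterFrom-nothing (out k) (rowAt U k) eq y y<)
                  (subst (2 * n ≤_) (sym (entry-out _ (rowAt U k) ≤-refl)) (2n≤out k))
                  (trans (cong (λ r → entry (out k) r (length (rowAt U k))) row') (entry-append (out k) (rowAt U k) c))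
                  agree ◅ ε ,
              added (λ _ _ → refl)
                (trans (partAt-shape U' k) (trans (cong length row') (trans (length-++ (rowAt U k))
                   (trans (+-comm _ 1) (cong suc (sym (rowLength U sh k)))))) ,
                 λ x x≢ → trans (partAt-shape U' x) (trans (cong length (row-other x≢)) (sym (rowLength U sh x))))
                (positive-append U {k} (rowAt U k) c (subst (λ ν → positiveB ν ≡ true) (sym sh) (proj₂ (∧-true {decreasingB μ} part))))
                (R.trans (W-append U c k≤) wt≈)
          where
          U' = setRow U k (rowAt U k ++ c ∷ [])
          row' : rowAt U' k ≡ rowAt U k ++ c ∷ []
          row' = rowAt-setRow-same U _ k≤
          row-other : ∀ {x} → x ≢ k → rowAt U' x ≡ rowAt U x
          row-other = rowAt-setRow-other U _ k≤
          agree : AgreeOff k (length (rowAt U k)) (Ext U) (Ext U')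
          agree x y z≢ with x ≟ k
          ... | yes refl = trans (entry-append-other (out x) (rowAt U x) c (λ e → z≢ (cong (x ,_) e)))
                             (cong (λ r → entry (out x) r y) (sym row'))
          ... | no x≢ = cong (λ r → entry (out x) r y) (sym (row-other x≢))
        insert (suc f) fuel | just (j , b) with firstGreaterFrom-just (out k) {j = 0} (rowAt U k) eq
        ... | .j , refl , j∈ , Uj , c<b , before with (c ≡ᵇ 2 * k) ∧ (b ≡ᵇ suc (2 * k)) in cond
        ...   | true = cancelled
          where
          c≡ : c ≡ 2 * k
          c≡ = ≡ᵇ⇒≡ c (2 * k) (subst T (sym (proj₁ (∧-true cond))) tt)
          b≡ : b ≡ suc (2 * k)
          b≡ = ≡ᵇ⇒≡ b (suc (2 * k)) (subst T (sym (proj₂ (∧-true {c ≡ᵇ 2 * k} cond))) tt)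
          sh' : shape (setT U k j c) ≡ μ
          sh' = trans (setT-shape U c j∈) sh
          st : Step (bump k c (Ext U)) (hole k j (Ext (setT U k j c)))
          st = cancels before c≡ (trans Uj b≡) (setT-agree U c (nonempty-row U j∈))
          pair : w c R.* w b R.≈ R.1#
          pair = subst₂ (λ x y → w x R.* w y R.≈ R.1#) (sym c≡) (sym b≡) (w-pair k)
          U' = setT U k j c
          -- `U'` keeps `c` as the stale letter in place of `b`. Replacing gives
          -- `W U' * w b ≈ total`, and multiplying by `w c` removes the pair `w c * w b ≈ 1`.
          weight : W U' R.≈ total R.* w (Ext U' k j)
          weight = begin
            W U'                          ≈⟨ R.*-identityʳ _ ⟨
            W U' R.* R.1#                 ≈⟨ R.*-congˡ pair ⟨
            W U' R.* (w c R.* w b)        ≈⟨ x∙yz≈xz∙y _ _ _ ⟩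
            W U' R.* w b R.* w c          ≈⟨ R.*-congʳ (R.*-congˡ (R.reflexive (cong w Uj))) ⟨
            W U' R.* w (entry (out k) (rowAt U k) j) R.* w c ≈⟨ R.*-congʳ (W-setT (out k) U c j∈) ⟩
            W U R.* w c R.* w c           ≈⟨ R.*-cong wt≈ (R.reflexive (cong w (sym (setT-same U c j∈)))) ⟩
            total R.* w (Ext U' k j)      ∎
          cancelled : Outcome μ total (jdt k j U') (bump k c (Ext U))
          cancelled =
            let t , sts , res = jdt-run (2 * size U' + 2) k j U' sh' (step-valid anti V st)
                  (subst (λ m → sumℕ m < 2 * size U' + 2 + (k + j)) sh'
                    (≤-trans (≤-trans (s≤s (m≤m+n (size U') _)) (≤-trans (≤-reflexive (+-comm 1 _)) (+-monoʳ-≤ (2 * size U') (s≤s z≤n)))) (m≤m+n _ (k + j))))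
                  weight
            in t , st ◅ sts , res
        ...   | false = 
            let t , sts , res = ins-run f (suc k) b (setT U k j c) (trans (setT-shape U c j∈) sh) (step-valid anti V st)
                  (subst₂ _<_ (trans (sym (length-map length U)) (trans (cong length (sym (setT-shape U c j∈))) (length-map length (setT U k j c)))) (sym (+-suc f k)) fuel)
                  (R.trans (R.*-congˡ (R.reflexive (cong w (sym Uj)))) (R.trans (W-setT (out k) U c j∈) wt≈))
            in t , st ◅ sts , res
          where
          b< : b < 2 * n
          b< = subst (_< 2 * n) Uj (inside S tt (subst (j <_) (sym (rowLength U sh k)) j∈))
          st : Step (bump k c (Ext U)) (bump (suc k) b (Ext (setT U k j c)))
          st = bumps before Uj c<b b<
            (λ { (refl , refl) → contradiction (trans (sym cond) (cong₂ _∧_ (T-true (≡⇒≡ᵇ (2 * k) _ refl)) (T-true (≡⇒≡ᵇ (suc (2 * k)) _ refl)))) λ () })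
            (setT-same U c j∈) (setT-agree U c (nonempty-row U j∈))

    -- From final states to the bijection

    AddBox-unique : ∀ {k k' μ ν} → AddBox k μ ν → AddBox k' μ ν → k ≡ k'
    AddBox-unique {k} {k'} (νk , other) (νk' , other') with k ≟ k'
    ... | yes e = e
    ... | no k≢ = ⊥-elim (1+n≢n (trans (sym νk) (other' k k≢)))

    AddBox-asym : ∀ {k k' μ ν} → AddBox k μ ν → ¬ AddBox k' ν μ
    AddBox-asym {k} {k'} {μ} {ν} (νk , other) (μk' , other') with k ≟ k'
    ... | yes refl = m≢1+m+n (ν k) {1} (trans νk (cong suc (trans μk' (+-comm 1 (ν k)))))
    ... | no k≢ = 1+n≢n (trans (sym νk) (sym (other' k k≢)))

    -- A box removed from row i of μ leaves the cell (i , ν i) just outside the new shape ν.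
    removed-shape : ∀ {i μ ν x y} → AddBox i ν μ → (x , y) ≢ (i , ν i) → (y < ν x → y < μ x) × (ν x ≤ y → μ x ≤ y)
    removed-shape {i} {μ} {ν} {x} {y} (μi , other) z≢ with x ≟ i
    ... | yes refl = (λ lt → ≤-trans lt (≤-trans (n≤1+n _) (≤-reflexive (sym μi)))) ,
                     (λ le → ≤-trans (≤-reflexive μi) (≤∧≢⇒< le λ e → z≢ (cong (x ,_) (sym e))))
    ... | no x≢ = subst (y <_) (sym (other x x≢)) , subst (_≤ y) (sym (other x x≢))

    removed-shape⁻ : ∀ {i μ ν x y} → AddBox i ν μ → (x , y) ≢ (i , ν i) → (y < μ x → y < ν x) × (μ x ≤ y → ν x ≤ y)
    removed-shape⁻ {i} {μ} {ν} {x} {y} (μi , other) z≢ with x ≟ i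
    ... | yes refl = (λ lt → ≤∧≢⇒< (s≤s⁻¹ (subst (y <_) μi lt)) λ e → z≢ (cong (x ,_) e)) ,
                     (λ le → ≤-trans (n≤1+n _) (≤-trans (≤-reflexive (sym μi)) le))
    ... | no x≢ = subst (y <_) (other x x≢) , subst (_≤ y) (other x x≢)

    result-final : ∀ {μ total U t} → Result μ total U t → Final t
    result-final (removed r≥ d≥ _ _ _ _ _) = r≥ , d≥
    result-final (added _ _ _ _) = tt

    result-adjacent : ∀ {μ total U t} → Result μ total U t → Adjacent μ (shape U)
    result-adjacent (removed _ _ _ box _ _ _) = inj₂ (_ , box)
    result-adjacent (added _ box _ _) = inj₁ (_ , box)

    result-weight : ∀ {μ total U t} → Result μ total U t → W U R.≈ total
    result-weight (removed _ _ _ _ _ _ e) = e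
    result-weight (added _ _ _ e) = e

    result-semiStd : ∀ {μ total U t} → Valid (partAt μ) t → Result μ total U t → SemiStdᵗ n U
    result-semiStd {μ} {U = U} (ν , (νk , other) , S) (added {k} eG (Uk , other') _ _) =
      transport S (λ _ → tt) (λ _ → eG _ _) (λ {x} {y} _ → subst (y <_) (sym (ν≡ x)) , subst (_≤ y) (sym (ν≡ x)))
      where
      ν≡ : ∀ x → ν x ≡ partAt (shape U) x
      ν≡ x with x ≟ k
      ... | yes refl = trans νk (sym Uk)
      ... | no x≢ = trans (other x x≢) (sym (other' x x≢))
    result-semiStd {μ} {U = U} (S , j< , i<n , J) (removed {i} {j} {G} r≥ d≥ ag box refl _ _) =
      refill i j S (λ _ z≢ → ag _ _ z≢) (λ _ z≢ → z≢) (removed-shape box)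
        (λ _ y<j → subst (_ ≤_) (sym hole-out) (<⇒≤ (<-≤-trans (inside S (col≢ (<⇒≢ y<j)) (<-trans y<j j<)) (2n≤out i))))
        (λ _ j<y → ≤-reflexive (trans hole-out (sym (outside S (col≢ (>⇒≢ j<y)) (≤-trans (≤-reflexive (proj₁ box)) j<y)))))
        (λ _ x<i y≤j → subst (_ <_) (sym hole-out) (above x<i))
        (λ _ i<x j≤y → subst (_< _) (sym hole-out) (below i<x j≤y))
        (subst (2 * i ≤_) (sym hole-out) (2x≤out i))
        (λ lt → ⊥-elim (<-irrefl refl lt))
        (λ _ → hole-out)
      where
      -- Once the corner is deleted, the hole is an outside cell; its value must still exceed
      -- everything above and stay below everything underneath.
      hole-out : Ext U i j ≡ out i
      hole-out = ext-out n U (≤-reflexive (sym (partAt-shape U i)))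
      above : ∀ {x y} → x < i → G x y < out i
      above {x} {y} x<i with y <? partAt μ x
      ... | yes lt = <-≤-trans (inside S (row≢ (<⇒≢ x<i)) lt) (2n≤out i)
      ... | no ge = subst (_< out i) (sym (outside S (row≢ (<⇒≢ x<i)) (≮⇒≥ ge))) (out-< x<i)
      d-out : G (suc i) j ≡ out (suc i)
      d-out = outside S down≢ (outside⁻¹ S down≢ d≥)
      below : ∀ {x y} → i < x → j ≤ y → out i < G x y
      below {x} {y} i<x j≤y with m≤n⇒m<n∨m≡n i<x
      ... | inj₁ lt = <-trans (out-< (n<1+n i)) (subst (_< G x y) d-out (col S down≢ (row≢ (>⇒≢ i<x)) lt j≤y))
      ... | inj₂ refl = <-≤-trans (out-< (n<1+n i)) (subst (_≤ G x y) d-out (row S down≢ down≢' j≤y))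

    -- The resulting shape alone tells whether a box was added or removed and in which row; the
    -- tableau supplies the rest of the final state. So equal results have equivalent last states.
    result-unique : ∀ {μ total total' U t t'} → Result μ total U t → Result μ total' U t' → t ≈ˢ t'
    result-unique (added eG box _ _) (added eG' box' _ _) with AddBox-unique box box'
    ... | refl = fin≈ λ x y → trans (eG x y) (sym (eG' x y))
    result-unique (removed _ _ ag box refl _ _) (removed _ _ ag' box' refl _ _) with AddBox-unique box box'
    ... | refl = hole≈ λ x y z≢ → trans (ag x y z≢) (sym (ag' x y z≢))
    result-unique (added _ box _ _) (removed _ _ _ box' _ _ _) = ⊥-elim (AddBox-asym box box')
    result-unique (removed _ _ _ box _ _ _) (added _ box' _ _) = ⊥-elim (AddBox-asym box' box)

    -- Positivity of the parts excludes trailing empty rows, so the row lengths determine the shape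
    -- as a list, and the grid then determines the letters.
    result-determines : ∀ {μ total total' U U' t t'} → Result μ total U t → Result μ total' U' t' → t ≈ˢ t' → U ≡ U'
    result-determines {U = U} {U'} (added {k} eG (Uk , other) pos _) (added eG' (Uk' , other') pos' _) (fin≈ e) =
      ext-injective n U U' (partAt-injective _ _ pos pos' shapes) λ x y → trans (sym (eG x y)) (trans (e x y) (eG' x y))
      where
      shapes : ∀ x → partAt (shape U) x ≡ partAt (shape U') x
      shapes x with x ≟ k
      ... | yes refl = trans Uk (sym Uk')
      ... | no x≢ = trans (other x x≢) (sym (other' x x≢))
    result-determines {U = U} {U'} (removed {i} {j} _ _ ag (_ , other) Ui pos _) (removed _ _ ag' (_ , other') Ui' pos' _) (hole≈ e) =
      ext-injective n U U' (partAt-injective _ _ pos pos' shapes) cells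
      where
      shapes : ∀ x → partAt (shape U) x ≡ partAt (shape U') x
      shapes x with x ≟ i
      ... | yes refl = trans Ui (sym Ui')
      ... | no x≢ = trans (sym (other x x≢)) (other' x x≢)
      cells : ∀ x y → Ext U x y ≡ Ext U' x y
      cells x y with (x , y) ≟ᶜ (i , j)
      ... | yes refl = trans (ext-out n U (≤-reflexive (trans (sym (partAt-shape U i)) Ui)))
                         (sym (ext-out n U' (≤-reflexive (trans (sym (partAt-shape U' i)) Ui'))))
      ... | no z≢ = trans (sym (ag x y z≢)) (trans (e x y z≢) (ag' x y z≢))

    -- If `V` has one box more than `μ`, the last append is undone. If it has one less, the hole is
    -- reopened at the missing corner; `length μ ≤ n` places it in a row `i < n`, whose two letters
    -- belong to the alphabet.
    target : ∀ {μ V} (part : isPartition μ ≡ true) → length μ ≤ n → isPartition (shape V) ≡ true →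
      Adjacent μ (shape V) → SemiStdᵗ n V →
      ∃ λ t → Result μ (W V) V t × BumpRun (partition-antitone μ part) t
    target {μ} {V} part len≤ part' (inj₁ (k , box)) S with unappend (partition-antitone μ part) box S
    ... | c , G , valid , st = fin k (Ext V) , added (λ _ _ → refl) box (proj₂ (∧-true {decreasingB (shape V)} part')) R.refl ,
      k , c , G , valid , st ◅ ε
    target {μ} {V} part len≤ part' (inj₂ (i , box)) S = hole i j (Ext V) ,
      removed (subst (2 * n ≤_) (sym r-out) (2n≤out i)) (subst (2 * n ≤_) (sym d-out) (2n≤out (suc i)))
        (λ _ _ _ → refl) box refl (proj₂ (∧-true {decreasingB (shape V)} part')) R.refl ,
      hole-back (partition-antitone μ part) i j (Ext V)
        (transport S (λ _ → tt) (λ _ → refl) (removed-shape⁻ box) , j< , i<n , bound) ε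
      where
      j = partAt (shape V) i
      j< : j < partAt μ i
      j< = ≤-reflexive (sym (proj₁ box))
      i<n : i < n
      i<n = ≤-trans (≰⇒> λ le → <⇒≱ j< (≤-trans (≤-reflexive (partAt-beyond μ le)) z≤n)) len≤
      r-out : Ext V i (suc j) ≡ out i
      r-out = outside S tt (n≤1+n j)
      d-out : Ext V (suc i) j ≡ out (suc i)
      d-out = outside S tt (partition-antitone (shape V) part' (n≤1+n i))
      -- The right neighbour of the reopened hole is outside and holds `2 * (n + i)`, with n
      -- positive because `i < n`.
      bound : 2 * i < Ext V i (suc j)
      bound = subst (2 * i <_) (sym r-out) (*-monoʳ-< 2 (m<n+m i (≤-trans z<s i<n)))

    module _ {μ : Partition} (part : isPartition μ ≡ true) where

      anti-μ : ∀ {x x'} → x ≤ x' → partAt μ x' ≤ partAt μ x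
      anti-μ = partition-antitone μ part

      start-valid : ∀ {U e} → U ∈ sympTableaux n μ → e ∈ alphabet n → Valid (partAt μ) (bump 0 e (Ext U))
      start-valid {U} U∈ e∈ with ∈-sympTableaux⁻ n μ part U∈
      ... | refl , S = S , ∈-upTo⁻ e∈ , z≤n , tt

      berele-run : ∀ {U e} → shape U ≡ μ → Valid (partAt μ) (bump 0 e (Ext U)) →
        Outcome μ (W U R.* w e) (berele e U) (bump 0 e (Ext U))
      berele-run {U} {e} sh V = ins-run part (suc (length U)) 0 e U sh V (s≤s (m≤m+n (length U) 0)) R.refl

      berele-outcome : ∀ {U e} → U ∈ sympTableaux n μ → e ∈ alphabet n →
        Outcome μ (W U R.* w e) (berele e U) (bump 0 e (Ext U))
      berele-outcome U∈ e∈ = berele-run (proj₁ (∈-sympTableaux⁻ n μ part U∈)) (start-valid U∈ e∈)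

      berele-adjacent : ∀ {U e} → U ∈ sympTableaux n μ → e ∈ alphabet n → Adjacent μ (shape (berele e U))
      berele-adjacent U∈ e∈ = result-adjacent (proj₂ (proj₂ (berele-outcome U∈ e∈)))

      berele-weight : ∀ {U e} → U ∈ sympTableaux n μ → e ∈ alphabet n → W (berele e U) R.≈ W U R.* w e
      berele-weight U∈ e∈ = result-weight (proj₂ (proj₂ (berele-outcome U∈ e∈)))

      berele-symplectic : ∀ {U e} → U ∈ sympTableaux n μ → e ∈ alphabet n → berele e U ∈ sympTableaux n (shape (berele e U))
      berele-symplectic {U} {e} U∈ e∈ with berele-outcome U∈ e∈
      ... | t , sts , res = ∈-sympTableaux⁺ n (berele e U)
              (result-semiStd (run-valid anti-μ (start-valid U∈ e∈) ([] ⊳ sts)) res)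

      berele-injective : ∀ {U U' e e'} → U ∈ sympTableaux n μ → U' ∈ sympTableaux n μ → e ∈ alphabet n → e' ∈ alphabet n →
        berele e U ≡ berele e' U' → U ≡ U' × e ≡ e'
      berele-injective {U} {U'} {e} {e'} U∈ U'∈ e∈ e'∈ eq with berele-outcome U∈ e∈ | berele-outcome U'∈ e'∈
      ... | t , sts , res | t' , sts' , res'
        with star-injective anti-μ (start-valid U∈ e∈) (start-valid U'∈ e'∈) tt tt sts sts'
               (result-unique res (subst (λ V → Result μ (W U' R.* w e') V t') (sym eq) res'))
      ...   | bump≈ eG = ext-injective n U U' (trans (proj₁ (∈-sympTableaux⁻ n μ part U∈)) (sym (proj₁ (∈-sympTableaux⁻ n μ part U'∈)))) eG , refl

      -- The backward run ends in a letter and a grid, and `fill` cuts a tableau out of that grid.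
      -- The actual insertion into this tableau reaches some final state too, and determinism
      -- identifies the two.
      berele-surjective : ∀ {ν V} → length μ ≤ n → isPartition ν ≡ true → Adjacent μ ν → V ∈ sympTableaux n ν →
        ∃₂ λ U e → U ∈ sympTableaux n μ × e ∈ alphabet n × berele e U ≡ V
      berele-surjective {ν} {V} len≤ part' adj V∈ with ∈-sympTableaux⁻ n ν part' V∈
      ... | refl , S with target part len≤ part' adj S
      ...   | t , res , runs with back anti-μ runs
      ...     | e , G , W@(SG , e< , _) , sts = U , e , U∈ , ∈-upTo⁺ e< , berele≡
        where
        U = fill n μ G
        shU : shape U ≡ μ
        shU = shape-fill n μ G
        eG : ∀ x y → Ext U x y ≡ G x y
        eG = ext-fill n μ G SG
        SU : SemiStd Anywhere (partAt μ) (Ext U)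
        SU = transport SG (λ _ → tt) (λ _ → sym (eG _ _)) (λ _ → id , id)
        U∈ : U ∈ sympTableaux n μ
        U∈ = subst (λ κ → U ∈ sympTableaux n κ) shU
          (∈-sympTableaux⁺ n U (subst (λ κ → SemiStd Anywhere (partAt κ) (Ext U)) (sym shU) SU))
        V' : Valid (partAt μ) (bump 0 e (Ext U))
        V' = SU , e< , z≤n , tt
        berele≡ : berele e U ≡ V
        berele≡ with berele-run shU V'
        ... | t' , sts' , res' = result-determines res' res
          (star-deterministic anti-μ V' W sts' sts (result-final res') (result-final res) (bump≈ eG))

      -- Both lists are free of repetitions and have the same members, hence are permutations of
      -- each other. In this form the bijection reindexes a finite sum.
      berele-permutes : ∀ {ν} → length μ ≤ n → isPartition ν ≡ true → adjacentB μ ν ≡ true →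
        map (λ (U , e) → berele e U)
          (filterB (λ (U , e) → eqList (shape (berele e U)) ν) (cartesianProduct (sympTableaux n μ) (alphabet n)))
        ↭ sympTableaux n ν
      berele-permutes {ν} len≤ part' adj = ∼bag⇒↭ (unique∧set⇒bag
        (map-unique f injective (filterB-unique hits (cartesianProduct⁺ (sympTableaux-unique n μ) (upTo⁺ (2 * n)))))
        (sympTableaux-unique n ν) (mk⇔ to from))
        where
        f : Tableau × ℕ → Tableau
        f (U , e) = berele e U
        hits : Tableau × ℕ → Bool
        hits (U , e) = eqList (shape (berele e U)) ν
        pairs = cartesianProduct (sympTableaux n μ) (alphabet n)
        split : ∀ {z} → z ∈ filterB hits pairs → proj₁ z ∈ sympTableaux n μ × proj₂ z ∈ alphabet n × hits z ≡ true
        split z∈ with ∈-filterB⁻ hits pairs z∈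
        ... | z∈' , h with ∈-cartesianProduct⁻ (sympTableaux n μ) (alphabet n) z∈'
        ...   | U∈ , e∈ = U∈ , e∈ , h
        injective : ∀ {z z'} → z ∈ filterB hits pairs → z' ∈ filterB hits pairs → f z ≡ f z' → z ≡ z'
        injective z∈ z'∈ eq with split z∈ | split z'∈
        ... | U∈ , e∈ , _ | U'∈ , e'∈ , _ with berele-injective U∈ U'∈ e∈ e'∈ eq
        ...   | refl , refl = refl
        to : ∀ {V} → V ∈ map f (filterB hits pairs) → V ∈ sympTableaux n ν
        to V∈ with ∈-map⁻ f V∈
        ... | (U , e) , z∈ , refl with split z∈
        ...   | U∈ , e∈ , h = subst (λ κ → berele e U ∈ sympTableaux n κ) (eqList⇒≡ (shape (berele e U)) ν h) (berele-symplectic U∈ e∈)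
        from : ∀ {V} → V ∈ sympTableaux n ν → V ∈ map f (filterB hits pairs)
        from {V} V∈ with berele-surjective {ν} len≤ part' (adjacentB⇒ μ ν adj) V∈
        ... | U , e , U∈ , e∈ , refl = ∈-map⁺ f (∈-filterB⁺ hits pairs (∈-cartesianProduct⁺ U∈ e∈)
                (subst (λ κ → eqList κ ν ≡ true) (sym (proj₁ (∈-sympTableaux⁻ n ν part' V∈))) (eqList-refl ν)))

      berele-misses : ∀ {ν U e} → adjacentB μ ν ≡ false → U ∈ sympTableaux n μ → e ∈ alphabet n →
        eqList (shape (berele e U)) ν ≡ false
      berele-misses {ν} {U} {e} nadj U∈ e∈ with eqList (shape (berele e U)) ν in eq
      ... | false = refl
      ... | true with eqList⇒≡ (shape (berele e U)) ν eq
      ...   | refl = trans (sym (adjacentB⇐ μ ν (berele-adjacent U∈ e∈))) nadj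

  -- Finite sums and the law of the shapes

  module Chain where

    open import Algebra.Properties.CommutativeSemigroup R.*-commutativeSemigroup using (x∙yz≈y∙xz; xy∙z≈x∙zy)
    open import Algebra.Properties.CommutativeSemigroup R.+-commutativeSemigroup using () renaming (x∙yz≈y∙xz to x+yz≈y+xz)
    open import Algebra.Solver.CommutativeMonoid R.*-commutativeMonoid using (solve; _⊜_; _⊕_)
    open import Data.Bool using (Bool; false; _∧_)
    open import Data.Bool.Properties using (∧-assoc; ∧-identityʳ)
    open import Data.Empty using (⊥; ⊥-elim)
    open import Data.List using (List; []; _∷_; _++_; _∷ʳ_; map; cartesianProduct; concatMap; upTo; take)
    open import Data.List.Membership.Propositional using (_∈_)
    open import Data.List.Membership.Propositional.Properties using (∈-upTo⁻)
    open import Data.List.Properties using (upTo-∷ʳ; map-++; foldl-++)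
    open import Data.List.Relation.Binary.Permutation.Propositional using (_↭_; refl; prep; swap; trans)
    open import Data.List.Relation.Unary.Any using (here; there)
    open import Data.Nat using (zero; suc; _<_; z≤n; s≤s⁻¹; _≤?_; _<ᵇ_)
    import Data.Nat.Properties as ℕ
    open import Data.Product using (_×_; _,_; proj₁; proj₂)
    open import Data.Unit using (tt)
    open import Function using (_∘_)
    import Relation.Binary.PropositionalEquality as ≡
    open import Relation.Binary.Reasoning.Setoid R.setoid
    open import Relation.Nullary using (yes; no)
    open R hiding (zero; refl; trans)
    open Sym R
    open Runs
    open Weights using (w; W)

    ∑ : {A : Set} → (A → Carrier) → List A → Carrier
    ∑ f xs = sumR (map f xs)

    ∑-cong : {A : Set} {f g : A → Carrier} (xs : List A) → (∀ {x} → x ∈ xs → f x ≈ g x) → ∑ f xs ≈ ∑ g xs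
    ∑-cong [] e = R.refl
    ∑-cong (x ∷ xs) e = +-cong (e (here ≡.refl)) (∑-cong xs (e ∘ there))

    ∑-zero : {A : Set} {f : A → Carrier} (xs : List A) → (∀ {x} → x ∈ xs → f x ≈ 0#) → ∑ f xs ≈ 0#
    ∑-zero [] e = R.refl
    ∑-zero (x ∷ xs) e = R.trans (+-cong (e (here ≡.refl)) (∑-zero xs (e ∘ there))) (+-identityˡ 0#)

    ∑-++ : {A : Set} (f : A → Carrier) (xs ys : List A) → ∑ f (xs ++ ys) ≈ ∑ f xs + ∑ f ys
    ∑-++ f [] ys = sym (+-identityˡ _)
    ∑-++ f (x ∷ xs) ys = R.trans (+-congˡ (∑-++ f xs ys)) (sym (+-assoc _ _ _))

    ∑-map : {A B : Set} (f : B → Carrier) (g : A → B) (xs : List A) → ∑ f (map g xs) ≡ ∑ (f ∘ g) xs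
    ∑-map f g [] = ≡.refl
    ∑-map f g (x ∷ xs) = ≡.cong (f (g x) +_) (∑-map f g xs)

    ∑-concatMap : {A B : Set} (f : B → Carrier) (g : A → List B) (xs : List A) →
      ∑ f (concatMap g xs) ≈ ∑ (λ x → ∑ f (g x)) xs
    ∑-concatMap f g [] = R.refl
    ∑-concatMap f g (x ∷ xs) = R.trans (∑-++ f (g x) (concatMap g xs)) (+-congˡ (∑-concatMap f g xs))

    ∑-distribˡ : {A : Set} (k : Carrier) (f : A → Carrier) (xs : List A) → k * ∑ f xs ≈ ∑ (λ x → k * f x) xs
    ∑-distribˡ k f [] = zeroʳ k
    ∑-distribˡ k f (x ∷ xs) = R.trans (distribˡ k (f x) (∑ f xs)) (+-congˡ (∑-distribˡ k f xs))

    ∑-cartesianProduct : {A B : Set} (f : A × B → Carrier) (xs : List A) (ys : List B) →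
      ∑ f (cartesianProduct xs ys) ≈ ∑ (λ x → ∑ (λ y → f (x , y)) ys) xs
    ∑-cartesianProduct f [] ys = R.refl
    ∑-cartesianProduct f (x ∷ xs) ys = R.trans (∑-++ f (map (x ,_) ys) (cartesianProduct xs ys))
      (+-cong (reflexive (∑-map f (x ,_) ys)) (∑-cartesianProduct f xs ys))

    ∑-filterB : {A : Set} (p : A → Bool) (f : A → Carrier) (xs : List A) →
      ∑ (λ x → indicator (p x) * f x) xs ≈ ∑ f (filterB p xs)
    ∑-filterB p f [] = R.refl
    ∑-filterB p f (x ∷ xs) with p x
    ... | true  = +-cong (*-identityˡ (f x)) (∑-filterB p f xs)
    ... | false = R.trans (+-cong (zeroˡ (f x)) (∑-filterB p f xs)) (+-identityˡ _)

    ∑-↭ : {A : Set} (f : A → Carrier) {xs ys : List A} → xs ↭ ys → ∑ f xs ≈ ∑ f ys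
    ∑-↭ f refl = R.refl
    ∑-↭ f (prep x p) = +-congˡ (∑-↭ f p)
    ∑-↭ f (swap x y p) = R.trans (x+yz≈y+xz (f x) (f y) _) (+-congˡ (+-congˡ (∑-↭ f p)))
    ∑-↭ f (trans p q) = R.trans (∑-↭ f p) (∑-↭ f q)

    indicator-∧ : ∀ b b' → indicator (b ∧ b') ≈ indicator b * indicator b'
    indicator-∧ true b' = sym (*-identityˡ _)
    indicator-∧ false b' = sym (zeroˡ _)

    prodR-∷ʳ : ∀ xs x → prodR (xs ∷ʳ x) ≈ prodR xs * x
    prodR-∷ʳ [] x = *-comm x 1#
    prodR-∷ʳ (y ∷ xs) x = R.trans (*-congˡ (prodR-∷ʳ xs x)) (sym (*-assoc y (prodR xs) x))

    ∑-words-∷ : (f : List ℕ → Carrier) (L : List ℕ) (m : ℕ) →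
      ∑ f (words L (suc m)) ≈ ∑ (λ x → ∑ (λ v → f (x ∷ v)) (words L m)) L
    ∑-words-∷ f L m = R.trans (∑-concatMap f (λ x → map (x ∷_) (words L m)) L)
      (∑-cong L λ {x} _ → reflexive (∑-map f (x ∷_) (words L m)))

    -- `words` branches on the first letter, whereas the recursion for P(m) inserts the last one.
    ∑-words-∷ʳ : (f : List ℕ → Carrier) (L : List ℕ) (m : ℕ) →
      ∑ f (words L (suc m)) ≈ ∑ (λ v → ∑ (λ x → f (v ∷ʳ x)) L) (words L m)
    ∑-words-∷ʳ f L zero = R.trans (∑-words-∷ f L 0)
      (R.trans (∑-cong L λ _ → +-identityʳ _) (sym (+-identityʳ _)))
    ∑-words-∷ʳ f L (suc m) = begin
      ∑ f (words L (suc (suc m)))                                          ≈⟨ ∑-words-∷ f L (suc m) ⟩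
      ∑ (λ y → ∑ (λ v → f (y ∷ v)) (words L (suc m))) L                    ≈⟨ ∑-cong L (λ {y} _ → ∑-words-∷ʳ (λ v → f (y ∷ v)) L m) ⟩
      ∑ (λ y → ∑ (λ v → ∑ (λ x → f (y ∷ (v ∷ʳ x))) L) (words L m)) L       ≈⟨ ∑-words-∷ (λ v → ∑ (λ x → f (v ∷ʳ x)) L) L m ⟨
      ∑ (λ v → ∑ (λ x → f (v ∷ʳ x)) L) (words L (suc m))                   ∎

    allB-∷ʳ : {A : Set} (p : A → Bool) (xs : List A) (x : A) → allB p (xs ∷ʳ x) ≡ allB p xs ∧ p x
    allB-∷ʳ p [] x = ∧-identityʳ (p x)
    allB-∷ʳ p (y ∷ xs) x = ≡.trans (≡.cong (p y ∧_) (allB-∷ʳ p xs x)) (≡.sym (∧-assoc (p y) (allB p xs) (p x)))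

    allB-cong : {A : Set} {p q : A → Bool} (xs : List A) → (∀ {x} → x ∈ xs → p x ≡ q x) → allB p xs ≡ allB q xs
    allB-cong [] e = ≡.refl
    allB-cong (x ∷ xs) e = ≡.cong₂ _∧_ (e (here ≡.refl)) (allB-cong xs (e ∘ there))

    take-∷ʳ : (v : List ℕ) (x : ℕ) {k : ℕ} → k ≤ length v → take k (v ∷ʳ x) ≡ take k v
    take-∷ʳ v x {zero} _ = ≡.refl
    take-∷ʳ (y ∷ v) x {suc k} le = ≡.cong (y ∷_) (take-∷ʳ v x (s≤s⁻¹ le))

    take-all-∷ʳ : (v : List ℕ) (x : ℕ) → take (suc (length v)) (v ∷ʳ x) ≡ v ∷ʳ x
    take-all-∷ʳ [] x = ≡.refl
    take-all-∷ʳ (y ∷ v) x = ≡.cong (y ∷_) (take-all-∷ʳ v x)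

    insertWord-∷ʳ : ∀ v x → insertWord (v ∷ʳ x) ≡ berele x (insertWord v)
    insertWord-∷ʳ v x = foldl-++ (λ U e → berele e U) [] v (x ∷ [])

    -- Prefixes of length at most m do not see the new letter, so only the last test involves it.
    pathMatches-∷ʳ : ∀ {m} (μ : ℕ → Partition) v x → length v ≡ m →
      pathMatches (suc m) μ (v ∷ʳ x) ≡ pathMatches m μ v ∧ eqList (shape (berele x (insertWord v))) (μ (suc m))
    pathMatches-∷ʳ μ v x ≡.refl = ≡.trans
      (≡.cong (allB matches) (≡.sym (upTo-∷ʳ (suc (length v)))))
      (≡.trans (allB-∷ʳ matches (upTo (suc (length v))) (suc (length v)))
        (≡.cong₂ _∧_
          (allB-cong (upTo (suc (length v))) λ {k} k∈ →
            ≡.cong (λ u → eqList (shape (insertWord u)) (μ k)) (take-∷ʳ v x (s≤s⁻¹ (∈-upTo⁻ k∈))))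
          (≡.cong (λ U → eqList (shape U) (μ (suc (length v))))
            (≡.trans (≡.cong insertWord (take-all-∷ʳ v x)) (insertWord-∷ʳ v x)))))
      where
      matches : ℕ → Bool
      matches k = eqList (shape (insertWord (take k (v ∷ʳ x)))) (μ k)

    ∑ᵀ : Partition → (Tableau → Carrier) → Carrier
    ∑ᵀ ν g = ∑ (λ U → W U * g U) (sympTableaux n ν)

    -- The intertwining relation of the process: averaging over the tableaux of shape `μ` by weight
    -- and then inserting a letter yields the weighted tableaux of shape `ν`. It follows from the
    -- bijection and `W (berele e U) ≈ W U * w e`.
    ∑-berele : ∀ {μ ν} → isPartition μ ≡ true → isPartition ν ≡ true → length μ ≤ n → (g : Tableau → Carrier) →
      ∑ᵀ μ (λ U → ∑ (λ e → w e * (indicator (eqList (shape (berele e U)) ν) * g (berele e U))) (alphabet n))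
        ≈ indicator (adjacentB μ ν) * ∑ᵀ ν g
    ∑-berele {μ} {ν} part part' len≤ g = R.trans to-pairs count
      where
      hit : Tableau × ℕ → Bool
      hit (U , e) = eqList (shape (berele e U)) ν
      inserted : Tableau × ℕ → Tableau
      inserted (U , e) = berele e U
      gain : Tableau → Carrier
      gain V = W V * g V
      pairs = cartesianProduct (sympTableaux n μ) (alphabet n)
      rearrange : ∀ {U e} → U ∈ sympTableaux n μ → e ∈ alphabet n →
        W U * (w e * (indicator (hit (U , e)) * g (berele e U))) ≈ indicator (hit (U , e)) * gain (berele e U)
      rearrange {U} {e} U∈ e∈ = begin
        W U * (w e * (indicator (hit (U , e)) * g (berele e U)))  ≈⟨ *-assoc _ _ _ ⟨
        W U * w e * (indicator (hit (U , e)) * g (berele e U))    ≈⟨ *-congʳ (berele-weight {μ} part U∈ e∈) ⟨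
        W (berele e U) * (indicator (hit (U , e)) * g (berele e U)) ≈⟨ x∙yz≈y∙xz _ _ _ ⟩
        indicator (hit (U , e)) * gain (berele e U)               ∎
      to-pairs : ∑ᵀ μ (λ U → ∑ (λ e → w e * (indicator (hit (U , e)) * g (berele e U))) (alphabet n))
        ≈ ∑ (λ U → ∑ (λ e → indicator (hit (U , e)) * gain (berele e U)) (alphabet n)) (sympTableaux n μ)
      to-pairs = ∑-cong (sympTableaux n μ) λ {U} U∈ →
        R.trans (∑-distribˡ (W U) _ (alphabet n)) (∑-cong (alphabet n) λ e∈ → rearrange U∈ e∈)
      count : ∑ (λ U → ∑ (λ e → indicator (hit (U , e)) * gain (berele e U)) (alphabet n)) (sympTableaux n μ)
        ≈ indicator (adjacentB μ ν) * ∑ᵀ ν g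
      count with adjacentB μ ν in adj
      ... | true = begin
        ∑ (λ U → ∑ (λ e → indicator (hit (U , e)) * gain (berele e U)) (alphabet n)) (sympTableaux n μ)
                                                   ≈⟨ ∑-cartesianProduct (λ z → indicator (hit z) * gain (inserted z)) (sympTableaux n μ) (alphabet n) ⟨
        ∑ (λ z → indicator (hit z) * gain (inserted z)) pairs   ≈⟨ ∑-filterB hit (gain ∘ inserted) pairs ⟩
        ∑ (gain ∘ inserted) (filterB hit pairs)    ≡⟨ ∑-map gain inserted (filterB hit pairs) ⟨
        ∑ gain (map inserted (filterB hit pairs))  ≈⟨ ∑-↭ gain (berele-permutes {μ} part {ν} len≤ part' adj) ⟩
        ∑ gain (sympTableaux n ν)                  ≈⟨ *-identityˡ _ ⟨
        1# * ∑ gain (sympTableaux n ν)             ∎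
      ... | false = R.trans (∑-zero (sympTableaux n μ) λ {U} U∈ → ∑-zero (alphabet n) λ {e} e∈ →
                      R.trans (*-congʳ (reflexive (≡.cong indicator (berele-misses {μ} part {ν} adj U∈ e∈)))) (zeroˡ _))
                      (sym (zeroˡ _))

    positive-part : ∀ ν {x} → positiveB ν ≡ true → x < length ν → 0 < partAt ν x
    positive-part (p ∷ ν) {zero} pos lt = <ᵇ-true (proj₁ (∧-true pos))
    positive-part (p ∷ ν) {suc x} pos lt = positive-part ν (proj₂ (∧-true {0 <ᵇ p} pos)) (s≤s⁻¹ lt)

    -- The first entry of internal row n would have to be at least `2 * n` and also below it.
    too-long : ∀ ν → isPartition ν ≡ true → n < length ν → ∀ {U} → U ∈ sympTableaux n ν → ⊥
    too-long ν part n< U∈ with ∈-sympTableaux⁻ n ν part U∈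
    ... | ≡.refl , S = ℕ.<⇒≱ (Insertion.inside S tt (positive-part ν (proj₂ (∧-true {decreasingB ν} part)) n<)) (Insertion.low S tt)

    module _ (Zinv : Carrier) (spinv : Partition → Carrier)
      (Sp*spinv : ∀ μ → isPartition μ ≡ true → length μ ≤ n → Sp n a ainv μ * spinv μ ≈ 1#)
      (μ : ℕ → Partition) where

      C : ℕ → Carrier
      C m = chainProb n a ainv Zinv spinv m μ

      C-suc : ∀ m → C (suc m) ≈ C m * Π n a ainv Zinv spinv (μ m) (μ (suc m))
      C-suc m = R.trans (*-congˡ prod) (sym (*-assoc _ _ _))
        where
        P : ℕ → Carrier
        P k = Π n a ainv Zinv spinv (μ k) (μ (suc k))
        prod : prodR (map P (upTo (suc m))) ≈ prodR (map P (upTo m)) * P m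
        prod = R.trans (reflexive (≡.cong prodR (≡.trans (≡.cong (map P) (≡.sym (upTo-∷ʳ m))) (map-++ P (upTo m) (m ∷ [])))))
          (prodR-∷ʳ (map P (upTo m)) (P m))

      -- The path is only assumed to consist of partitions, so it may leave Λ_n, where `spinv` is
      -- not known to invert anything. There the chain has probability 0: the start is not empty, or
      -- the last factor `Sp` is an empty sum.
      C-too-long : ∀ m → isPartition (μ m) ≡ true → n < length (μ m) → C m ≈ 0#
      C-too-long zero part n< with μ 0
      ... | _ ∷ _ = zeroˡ _
      C-too-long (suc m) part n< = begin
        C (suc m)  ≈⟨ C-suc m ⟩
        C m * (Zinv * Sp n a ainv (μ (suc m)) * spinv (μ m) * indicator (adjacentB (μ m) (μ (suc m))))
          ≈⟨ *-congˡ (*-congʳ (*-congʳ (*-congˡ (∑-zero (sympTableaux n (μ (suc m))) λ U∈ → ⊥-elim (too-long (μ (suc m)) part n< U∈))))) ⟩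
        C m * (Zinv * 0# * spinv (μ m) * indicator (adjacentB (μ m) (μ (suc m))))
          ≈⟨ *-congˡ (R.trans (*-congʳ (R.trans (*-congʳ (zeroʳ _)) (zeroˡ _))) (zeroˡ _)) ⟩
        C m * 0#   ≈⟨ zeroʳ _ ⟩
        0#         ∎

      -- The expectation of g(P(m)) on the event that sh P(k) = μ k for all k ≤ m.
      A : ℕ → (Tableau → Carrier) → Carrier
      A m g = ∑ (λ v → prodR (map (ρ a ainv Zinv) v) * indicator (pathMatches m μ v) * g (insertWord v)) (words (alphabet n) m)

      -- The one-step operator of the tableau process, without the factor `Zinv` and restricted to
      -- moves into the prescribed shape.
      onward : ℕ → (Tableau → Carrier) → Tableau → Carrier
      onward m g U = ∑ (λ e → w e * (indicator (eqList (shape (berele e U)) (μ (suc m))) * g (berele e U))) (alphabet n)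

      A-suc : ∀ m g → A (suc m) g ≈ Zinv * A m (onward m g)
      A-suc m g = begin
        A (suc m) g   ≈⟨ ∑-words-∷ʳ _ (alphabet n) m ⟩
        ∑ (λ v → ∑ (λ e → prodR (map (ρ a ainv Zinv) (v ∷ʳ e)) * indicator (pathMatches (suc m) μ (v ∷ʳ e)) * g (insertWord (v ∷ʳ e)))
          (alphabet n)) (words (alphabet n) m)
          ≈⟨ ∑-cong (words (alphabet n) m) (λ {v} v∈ → R.trans
               (∑-cong (alphabet n) (λ {e} _ → extend v e (words-length (alphabet n) m v∈)))
               (R.trans (sym (∑-distribˡ _ _ (alphabet n))) (*-assoc _ _ _))) ⟩
        ∑ (λ v → Zinv * (prodR (map (ρ a ainv Zinv) v) * indicator (pathMatches m μ v) * onward m g (insertWord v))) (words (alphabet n) m)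
          ≈⟨ ∑-distribˡ Zinv _ (words (alphabet n) m) ⟨
        Zinv * A m (onward m g) ∎
        where
        extend : ∀ v e → length v ≡ m →
          prodR (map (ρ a ainv Zinv) (v ∷ʳ e)) * indicator (pathMatches (suc m) μ (v ∷ʳ e)) * g (insertWord (v ∷ʳ e)) ≈
          Zinv * (prodR (map (ρ a ainv Zinv) v) * indicator (pathMatches m μ v)) *
            (w e * (indicator (eqList (shape (berele e (insertWord v))) (μ (suc m))) * g (berele e (insertWord v))))
        extend v e len = begin
          prodR (map (ρ a ainv Zinv) (v ∷ʳ e)) * indicator (pathMatches (suc m) μ (v ∷ʳ e)) * g (insertWord (v ∷ʳ e))
            ≈⟨ *-cong (*-cong prod ind) (reflexive (≡.cong g (insertWord-∷ʳ v e))) ⟩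
          p * (w e * Zinv) * (i * h) * G
            ≈⟨ solve 6 (λ p we z i h G → (((p ⊕ (we ⊕ z)) ⊕ (i ⊕ h)) ⊕ G) ⊜ ((z ⊕ (p ⊕ i)) ⊕ (we ⊕ (h ⊕ G)))) R.refl p (w e) Zinv i h G ⟩
          Zinv * (p * i) * (w e * (h * G)) ∎
          where
          p = prodR (map (ρ a ainv Zinv) v)
          i = indicator (pathMatches m μ v)
          h = indicator (eqList (shape (berele e (insertWord v))) (μ (suc m)))
          G = g (berele e (insertWord v))
          prod : prodR (map (ρ a ainv Zinv) (v ∷ʳ e)) ≈ p * (w e * Zinv)
          prod = R.trans (reflexive (≡.cong prodR (map-++ (ρ a ainv Zinv) v (e ∷ [])))) (prodR-∷ʳ (map (ρ a ainv Zinv) v) (w e * Zinv))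
          ind : indicator (pathMatches (suc m) μ (v ∷ʳ e)) ≈ i * h
          ind = R.trans (reflexive (≡.cong indicator (pathMatches-∷ʳ μ v e len))) (indicator-∧ (pathMatches m μ v) _)

      -- Given the shapes up to time m, P(m) is distributed over the tableaux of the last shape in
      -- proportion to their weights. The arbitrary `g` makes the induction close, since the next
      -- shape depends on the whole tableau and not only on its shape.
      conditional-law : ∀ m → (∀ k → k ≤ m → isPartition (μ k) ≡ true) → ∀ g →
        A m g ≈ C m * spinv (μ m) * ∑ᵀ (μ m) g
      conditional-law zero parts g with μ 0
      ... | [] = begin
        1# * 1# * g [] + 0#                     ≈⟨ +-identityʳ _ ⟩
        1# * 1# * g []                          ≈⟨ *-cong (*-identityʳ _) (R.trans (+-identityʳ _) (*-identityˡ _)) ⟨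
        1# * 1# * 1# * (1# * g [] + 0#)         ≈⟨ *-congʳ (*-congˡ spinv[]) ⟨
        1# * 1# * spinv [] * (1# * g [] + 0#)   ∎
        where
        -- The empty partition has a single tableau, of weight 1, so its symplectic Schur function
        -- is 1.
        spinv[] : spinv [] ≈ 1#
        spinv[] = R.trans (sym (*-identityˡ _)) (R.trans (*-congʳ (sym (+-identityʳ 1#))) (Sp*spinv [] ≡.refl z≤n))
      ... | p ∷ ν = R.trans (R.trans (+-identityʳ _) (R.trans (*-congʳ (zeroʳ 1#)) (zeroˡ _)))
        (sym (R.trans (*-congʳ (R.trans (*-congʳ (zeroˡ 1#)) (zeroˡ _))) (zeroˡ _)))
      conditional-law (suc m) parts g = R.trans (A-suc m g) (R.trans (*-congˡ (conditional-law m parts' (onward m g))) body)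
        where
        parts' : ∀ k → k ≤ m → isPartition (μ k) ≡ true
        parts' k le = parts k (ℕ.≤-trans le (ℕ.n≤1+n m))
        ν = μ (suc m)
        part = parts m (ℕ.n≤1+n m)
        part' = parts (suc m) ℕ.≤-refl
        adj = indicator (adjacentB (μ m) ν)
        sp' = Sp n a ainv ν
        body : Zinv * (C m * spinv (μ m) * ∑ᵀ (μ m) (onward m g)) ≈ C (suc m) * spinv ν * ∑ᵀ ν g
        body with length (μ m) ≤? n | length ν ≤? n
        ... | no len> | _ = R.trans
          (R.trans (*-congˡ (R.trans (*-congʳ (R.trans (*-congʳ C≈0) (zeroˡ _))) (zeroˡ _))) (zeroʳ _))
          (sym (R.trans (*-congʳ (R.trans (*-congʳ (R.trans (C-suc m) (R.trans (*-congʳ C≈0) (zeroˡ _)))) (zeroˡ _))) (zeroˡ _)))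
          where
          C≈0 : C m ≈ 0#
          C≈0 = C-too-long m part (ℕ.≰⇒> len>)
        -- No tableau has shape `ν`, so the sum over them vanishes on both sides.
        ... | yes len≤ | no len>' = R.trans
          (R.trans (*-congˡ (R.trans (*-congˡ (R.trans (∑-berele {μ m} {ν} part part' len≤ g) (R.trans (*-congˡ X≈0) (zeroʳ _)))) (zeroʳ _))) (zeroʳ _))
          (sym (R.trans (*-congˡ X≈0) (zeroʳ _)))
          where
          X≈0 : ∑ᵀ ν g ≈ 0#
          X≈0 = ∑-zero (sympTableaux n ν) λ U∈ → ⊥-elim (too-long ν part' (ℕ.≰⇒> len>') U∈)
        -- A factor `sp' * spinv ν`, equal to 1, is inserted: its first half completes the kernel
        -- inside `C (suc m)`, its second half is the new normalisation.
        ... | yes len≤ | yes len≤' = begin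
          Zinv * (C m * spinv (μ m) * ∑ᵀ (μ m) (onward m g))     ≈⟨ *-congˡ (*-congˡ (∑-berele {μ m} {ν} part part' len≤ g)) ⟩
          Zinv * (C m * spinv (μ m) * (adj * ∑ᵀ ν g))            ≈⟨ *-identityʳ _ ⟨
          Zinv * (C m * spinv (μ m) * (adj * ∑ᵀ ν g)) * 1#       ≈⟨ *-congˡ (Sp*spinv ν part' len≤') ⟨
          Zinv * (C m * spinv (μ m) * (adj * ∑ᵀ ν g)) * (sp' * spinv ν)
            ≈⟨ solve 7 (λ z q s i x p t → ((z ⊕ ((q ⊕ s) ⊕ (i ⊕ x))) ⊕ (p ⊕ t)) ⊜ (((q ⊕ (((z ⊕ p) ⊕ s) ⊕ i)) ⊕ t) ⊕ x))
                 R.refl Zinv (C m) (spinv (μ m)) adj (∑ᵀ ν g) sp' (spinv ν) ⟩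
          C m * (Zinv * sp' * spinv (μ m) * adj) * spinv ν * ∑ᵀ ν g  ≈⟨ *-congʳ (*-congʳ (C-suc m)) ⟨
          C (suc m) * spinv ν * ∑ᵀ ν g                           ∎

      path-law : ∀ m → (∀ k → k ≤ m → isPartition (μ k) ≡ true) → pathProb n a ainv Zinv m μ ≈ C m
      path-law m parts = begin
        pathProb n a ainv Zinv m μ                  ≈⟨ ∑-cong (words (alphabet n) m) (λ _ → sym (*-identityʳ _)) ⟩
        A m (λ _ → 1#)                              ≈⟨ conditional-law m parts (λ _ → 1#) ⟩
        C m * spinv (μ m) * ∑ᵀ (μ m) (λ _ → 1#)     ≈⟨ *-congˡ (∑-cong (sympTableaux n (μ m)) λ _ → *-identityʳ _) ⟩
        C m * spinv (μ m) * Sp n a ainv (μ m)       ≈⟨ xy∙z≈x∙zy _ _ _ ⟩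
        C m * (Sp n a ainv (μ m) * spinv (μ m))     ≈⟨ total ⟩
        C m                                         ∎
        where
        total : C m * (Sp n a ainv (μ m) * spinv (μ m)) ≈ C m
        total with length (μ m) ≤? n
        ... | yes len≤ = R.trans (*-congˡ (Sp*spinv (μ m) (parts m ℕ.≤-refl) len≤)) (*-identityʳ _)
        ... | no len> = let C≈0 = C-too-long m (parts m ℕ.≤-refl) (ℕ.≰⇒> len>) in
          R.trans (*-congʳ C≈0) (R.trans (zeroˡ _) (sym C≈0))

theorem2 : {c ℓ : Level} (R : CommutativeRing c ℓ) (n : ℕ) → 1 ≤ n →
  (a ainv : Fin n → CommutativeRing.Carrier R) →
  (∀ i → CommutativeRing._≈_ R (CommutativeRing._*_ R (a i) (ainv i)) (CommutativeRing.1# R)) →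
  (Zinv : CommutativeRing.Carrier R) →
  CommutativeRing._≈_ R (CommutativeRing._*_ R (Sym.Z R n a ainv) Zinv) (CommutativeRing.1# R) →
  (spinv : Partition → CommutativeRing.Carrier R) →
  (∀ μ → isPartition μ ≡ true → length μ ≤ n →
    CommutativeRing._≈_ R (CommutativeRing._*_ R (Sym.Sp R n a ainv μ) (spinv μ)) (CommutativeRing.1# R)) →
  (m : ℕ) (μ : ℕ → Partition) →
  (∀ k → k ≤ m → isPartition (μ k) ≡ true) →
  CommutativeRing._≈_ R (Sym.pathProb R n a ainv Zinv m μ) (Sym.chainProb R n a ainv Zinv spinv m μ)
theorem2 R n _ a ainv a*ainv Zinv _ spinv Sp*spinv m μ parts =
  Berele.Chain.path-law R a ainv a*ainv Zinv spinv Sp*spinv μ m parts
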